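{- Let $Q$ be a spider web quiver with any number of concentric circles and choose two adjacent circles $C,D$. Let $\tau_C$ be the mutation sequence $\mu_1\mu_2\cdots\mu_{n-2}s_{n-1,n}\mu_n\cdots\mu_1$ performed on the vertices $1,\dots,n$ of $C$ (labeled following the arrows), and $\tau_D$ the analogous sequence on $D$. Then applying $\tau_C$, then $\tau_D$, then $\tau_C$ yields the same $y$-variables as applying $\tau_D$, then $\tau_C$, then $\tau_D$.
   Context: Quiver: directed graph without loops or 2-cycles. $y$-seed mutation $\mu_k$: mutate the quiver at $k$ (add $i\to j$ for each $i\to k\to j$, reverse arrows at $k$, cancel 2-cycles), set $y_k'=y_k^{ -1}$, and for $i\ne k$ set $y_i'=y_i(1+y_k^{ -1})^{ -m}$ if there are $m$ arrows $k\to i$, $y_i'=y_i(1+y_k)^m$ if there are $m$ arrows $i\to k$. $s_{n-1,n}$ transposes vertices $n-1,n$; sequences applied rightmost first. Spider web quiver: three or more concentric circles, at least 2 vertices per circle, circle edges oriented counterclockwise, arrows between adjacent circles so each face is a directed cycle with exactly two arrows between circles and at least 3 sides. When the sequence is applied to a circle, that circle plays the role of the middle circle and its neighbors of the outer and inner circles. -}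

module Defs where

open import Level using (Level; _⊔_) renaming (suc to lsuc)
open import Data.Nat as ℕ using (ℕ; zero; suc; _∸_; _≤_)
open import Data.Nat.DivMod using (_%_; m%n<n)
open import Data.Fin as Fin using (Fin; toℕ; fromℕ<; inject₁)
import Data.Fin.Properties as FinP
open import Data.Integer as ℤ using (ℤ; +_; -[1+_]; _⊖_)
open import Data.List using (List; []; _∷_; _++_; map; concatMap; allFin; upTo; reverse; filter; length; foldl)
open import Relation.Binary.PropositionalEquality using (_≡_)
open import Data.Sum using (_⊎_)
open import Data.Product using (Σ; _×_; _,_)
open import Data.Product.Properties using (≡-dec)
open import Relation.Binary using (Rel; DecidableEquality)
open import Relation.Nullary using (yes; no)
open import Algebra.Core using (Op₁; Op₂)
open import Algebra.Structures using (IsAbelianGroup; IsCommutativeSemigroup)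
import Algebra.Definitions as AD

-- Semifields (the coefficient world of y-variables).
-- A semifield: an abelian multiplicative group together with a
-- commutative, associative addition over which multiplication distributes.
-- (Equality of y-variables as elements of the universal semifield
-- Q_sf(y) is equivalent to equality under every evaluation in every
-- semifield, which is how the theorem is stated.)

record Semifield (c ℓ : Level) : Set (lsuc (c ⊔ ℓ)) where
  infixl 7 _⊗_
  infixl 6 _⊕_
  field
    Carrier  : Set c
    _≈_      : Rel Carrier ℓ
    _⊕_      : Op₂ Carrier
    _⊗_      : Op₂ Carrier
    1#       : Carrier
    _⁻¹      : Op₁ Carrier
    ⊗-isAbelianGroup        : IsAbelianGroup _≈_ _⊗_ 1# _⁻¹
    ⊕-isCommutativeSemigroup : IsCommutativeSemigroup _≈_ _⊕_
    distrib  : AD._DistributesOver_ _≈_ _⊗_ _⊕_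

pos : ℤ → ℕ
pos (+ n)    = n
pos -[1+ n ] = 0

neg : ℤ → ℕ
neg (+ n)    = 0
neg -[1+ n ] = suc n

-- Quivers (without loops / 2-cycles) on a vertex set V are encoded by
-- their skew-symmetric exchange matrix  B i j = #(i→j) - #(j→i).

ExchangeMatrix : Set → Set
ExchangeMatrix V = V → V → ℤ

module YSeeds {c ℓ : Level} (P : Semifield c ℓ)
             {V : Set} (_≟_ : DecidableEquality V) where
  open Semifield P

  pow : Carrier → ℕ → Carrier
  pow x zero    = 1#
  pow x (suc m) = x ⊗ pow x m

  record YSeed : Set c where
    constructor yseed
    field
      B : ExchangeMatrix V
      y : V → Carrier
  open YSeed public

  yOf : YSeed → V → Carrier
  yOf s = YSeed.y s

  -- quiver mutation at k: add i→j for each path i→k→j, reverse arrows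
  -- at k, cancel 2-cycles (= matrix mutation of the exchange matrix)
  mutB : V → ExchangeMatrix V → ExchangeMatrix V
  mutB k b i j with i ≟ k | j ≟ k
  ... | yes _ | _     = ℤ.- b i j
  ... | no _  | yes _ = ℤ.- b i j
  ... | no _  | no _  =
    (b i j ℤ.+ + (pos (b i k) ℕ.* pos (b k j))) ℤ.- + (neg (b i k) ℕ.* neg (b k j))

  muty : V → ExchangeMatrix V → (V → Carrier) → V → Carrier
  muty k b y i with i ≟ k
  ... | yes _ = y k ⁻¹
  ... | no _ with b k i
  ...   | + zero    = y i
  ...   | + suc m   = y i ⊗ pow ((1# ⊕ y k ⁻¹) ⁻¹) (suc m)
  ...   | -[1+ m ]  = y i ⊗ pow (1# ⊕ y k) (suc m)

  μ : V → YSeed → YSeed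
  μ k (yseed b y) = yseed (mutB k b) (muty k b y)

  transp : V → V → V → V
  transp a a' i with i ≟ a | i ≟ a'
  ... | yes _ | _     = a'
  ... | no _  | yes _ = a
  ... | no _  | no _  = i

  swap : V → V → YSeed → YSeed
  swap a a' (yseed b y) =
    yseed (λ i j → b (transp a a' i) (transp a a' j)) (λ i → y (transp a a' i))

  data Step : Set where
    mutate : V → Step
    transpose : V → V → Step

  step : Step → YSeed → YSeed
  step (mutate k)      s = μ k s
  step (transpose a b) s = swap a b s

  run : List Step → YSeed → YSeed
  run ss s = foldl (λ t σ → step σ t) s ss

  -- τ for a circle whose vertices labeled 1..n are  lab 1, …, lab n:
  --   μ₁ μ₂ ⋯ μ_{n-2} s_{n-1,n} μ_n ⋯ μ₁   (rightmost first), i.e. in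
  --   order of application: μ₁, …, μ_n, s_{n-1,n}, μ_{n-2}, …, μ₁.
  τ : (n : ℕ) → (ℕ → V) → List Step
  τ n lab =
    map (λ i → mutate (lab (suc i))) (upTo n)
    ++ (transpose (lab (n ∸ 1)) (lab n) ∷ [])
    ++ reverse (map (λ i → mutate (lab (suc i))) (upTo (n ∸ 2)))

rot : ∀ {n} → Fin n → ℕ → Fin n
rot {suc n} i d = fromℕ< (m%n<n (toℕ i ℕ.+ d) (suc n))

prev : ∀ {n} → Fin n → Fin n
prev {suc n} i = rot i n

-- Spider web quivers.
-- Circles 0 (outermost), 1, …, M (innermost), M+1 ≥ 3 circles.
-- Circle c has n c ≥ 2 vertices (c , 0), …, (c , n c - 1) in
-- counterclockwise order; circle arrows (c,i) → (c,i+1 mod n c).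
-- Between circle a (outer) and a+1 (inner) the annulus is cut by
-- 2·k a inter-circle arrows (k a ≥ 2) into faces which are directed
-- cycles with exactly two inter-circle arrows and ≥ 3 sides.  Such a
-- configuration is exactly given by breakpoints
--   p a 0 < … < p a (k-1)  on circle a,  q a 0 < … < q a (k-1) on a+1,
-- a cyclic shift r a, and the arrows (indices j mod k, Q j = q (j + r))
--   (a , p j) → (a+1 , Q j)   and   (a+1 , Q j) → (a , p (j-1)),
-- the faces being  (a,p(j-1)) → ⋯ → (a,p j) → (a+1,Q j) → (a,p(j-1))
-- and              (a+1,Q j) → ⋯ → (a+1,Q(j+1)) → (a,p j) → (a+1,Q j).

record SpiderWeb : Set where
  field
    M    : ℕ
    M≥2  : 2 ≤ M
    n    : Fin (suc M) → ℕ
    n≥2  : ∀ c → 2 ≤ n c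
    k    : Fin M → ℕ
    k≥2  : ∀ a → 2 ≤ k a
    p    : ∀ a → Fin (k a) → Fin (n (inject₁ a))
    q    : ∀ a → Fin (k a) → Fin (n (Fin.suc a))
    p-increasing : ∀ a {i j} → i Fin.< j → p a i Fin.< p a j
    q-increasing : ∀ a {i j} → i Fin.< j → q a i Fin.< q a j
    r    : ∀ a → Fin (k a)

  Circle : Set
  Circle = Fin (suc M)

  Vertex : Set
  Vertex = Σ Circle (λ c → Fin (n c))

  _≟V_ : DecidableEquality Vertex
  _≟V_ = ≡-dec Fin._≟_ Fin._≟_

  _≟E_ : DecidableEquality (Vertex × Vertex)
  _≟E_ = ≡-dec _≟V_ _≟V_

  circleArrows : List (Vertex × Vertex)
  circleArrows =
    concatMap (λ c → map (λ i → ((c , i) , (c , rot i 1))) (allFin (n c)))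
              (allFin (suc M))

  annulusArrows : Fin M → List (Vertex × Vertex)
  annulusArrows a =
    concatMap (λ j → ((inject₁ a , p a j) , (Fin.suc a , q a (rot j (toℕ (r a)))))
                   ∷ ((Fin.suc a , q a (rot j (toℕ (r a)))) , (inject₁ a , p a (prev j)))
                   ∷ [])
              (allFin (k a))

  arrows : List (Vertex × Vertex)
  arrows = circleArrows ++ concatMap annulusArrows (allFin M)

  #arrows : Vertex → Vertex → ℕ
  #arrows i j = length (filter (λ e → e ≟E (i , j)) arrows)

  B : ExchangeMatrix Vertex
  B i j = #arrows i j ⊖ #arrows j i

  -- labeling 1, …, n c of circle c following the arrows, starting at s:
  -- label ℓ is the vertex (c , s + ℓ - 1 mod n c)
  label : (c : Circle) → Fin (n c) → ℕ → Vertex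
  label c s ℓ = (c , rot s (ℓ ∸ 1))


τ[_]_at_ : {cl ℓl : Level} (P : Semifield cl ℓl) (W : SpiderWeb) →
           (c : SpiderWeb.Circle W) → Fin (SpiderWeb.n W c) →
           List (YSeeds.Step P (SpiderWeb._≟V_ W))
τ[ P ] W at c = λ s → YSeeds.τ P (SpiderWeb._≟V_ W) (SpiderWeb.n W c) (SpiderWeb.label W c s)

Adjacent : ∀ {m} → Fin m → Fin m → Set
Adjacent C D = (toℕ D ≡ suc (toℕ C)) ⊎ (toℕ C ≡ suc (toℕ D))

yAfter : {cl ℓl : Level} (P : Semifield cl ℓl) (W : SpiderWeb) →
         (SpiderWeb.Vertex W → Semifield.Carrier P) →
         List (YSeeds.Step P (SpiderWeb._≟V_ W)) →
         SpiderWeb.Vertex W → Semifield.Carrier P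
yAfter P W y₀ steps =
  YSeeds.yOf P (SpiderWeb._≟V_ W)
    (YSeeds.run P (SpiderWeb._≟V_ W) steps (YSeeds.yseed (SpiderWeb.B W) y₀))

{-# OPTIONS --safe #-}
module Submission where

-- On the universal cover of a circle with vertices … , γ i , γ (i + 1) , … choose heights X with
-- X (i + 1) = y (γ (i + 1)) X i and let W i be the sum of the n heights X i, …, X (i + n - 1).  Mutating at a
-- vertex merges two consecutive heights of the shorter cycle that is left, so by induction on n the sequence τ
-- fixes the quiver, multiplies the variable of a vertex whose arrows to the circle enclose the arc from γ s to
-- γ e by W e / W s, and that of γ i by W (i - 1) / W (i + 1).
-- For adjacent circles with heights X, Y and windows W, V the arrows between them are encoded by a Galois pair
-- of monotone maps σ, ρ between the covers.  After τ_C and τ_D the heights on C are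
-- U m = X m (Σ Y l W (ρ l)) / (W m W (m + 1)), and the windows Ω of U satisfy W i Ω i = Σ X m V (σ m): the
-- double sum is over a rectangle of a torus, and Σ X m / (W m W (m + 1)) telescopes.  The right hand side is
-- the window of C after τ_D alone, so both sides of the braid relation multiply each variable by the same factor.

open import Defs
open import Level using (Level; _⊔_)
open import Data.Nat.Base as ℕ using (ℕ; zero; suc; _≤_; _<_; z≤n; s≤s; NonZero)
import Data.Nat.Properties as ℕₚ
import Data.Nat.DivMod as DivMod
open import Data.Nat.DivMod using (_%_; _/_)
open import Data.Nat.Divisibility using (n∣m*n)
open import Data.Fin using (Fin)
open import Data.Fin.Base as Fin using (toℕ; inject₁)
import Data.Fin.Properties as Finₚ
open import Data.Integer.Base as ℤ using (ℤ; +_; -[1+_]; _⊖_)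
import Data.Integer.Properties as ℤₚ
import Data.Integer.Tactic.RingSolver as ℤ-Solver
open import Data.Bool.Base using (if_then_else_)
open import Data.Maybe.Base using (Maybe; just; nothing)
open import Data.Maybe.Relation.Binary.Pointwise as Pointwise using (Pointwise; just; nothing; drop-just)
open import Data.Product using (∃; ∃₂; _×_; _,_; proj₁; proj₂)
open import Data.Product.Properties using (,-injectiveˡ)
open import Data.Sum using (_⊎_; inj₁; inj₂)
open import Data.List using (List; []; _∷_; _++_; map; concatMap; allFin; tabulate; filter; length; upTo; applyUpTo; reverse)
import Data.List.Properties as Listₚ
open import Function using (_∘_)
open import Algebra.Bundles using (AbelianGroup; CommutativeSemiring)
open import Algebra.Structures using (IsAbelianGroup; IsCommutativeSemigroup)
import Algebra.Properties.AbelianGroup as AbelianGroupProperties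
import Algebra.Solver.Ring.NaturalCoefficients.Default as RingSolver
open import Relation.Unary using (Pred; Decidable)
open import Relation.Nullary using (¬_; Dec; yes; no; does; contradiction)
open import Relation.Nullary.Decidable using (_×-dec_; _⊎-dec_)
open import Relation.Binary using (DecidableEquality; tri<; tri≈; tri>)
open import Relation.Binary.PropositionalEquality as ≡ using (_≡_; _≢_)
import Relation.Binary.Reasoning.Setoid as SetoidReasoning

-- Heights turn factors into ratios: the factors `W e / W s` along a neighbouring circle are ratios
-- of consecutive values of one function, so the heights after each `τ` are again explicit. The
-- price is that a vertex has many lifts. Over a full turn heights and windows change by the product
-- `z` of the variables on the circle; the scaling relations survive because both sides gain the
-- same `z`. The common source of the merging step and of the telescoping is
-- `W j - W (j + 1) = (1 - z) X j`. A semifield has no subtraction, so only a positive consequence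
-- is available: for the sum `A` of the `b` heights from `i` and `j = i + b`,
-- `A W (j + 1) + X j W i = (A + X j) W j`. The Galois relation makes the torus sum collapse. For
-- fixed `l` the rows `m < ρ l` contribute `Y l` and the later ones its translate `Y (l + N)`; the
-- factor `W (ρ l)` of this column is the common endpoint of the telescoping sums over `[i, ρ l)`
-- and `[ρ l, i + n)`, so it clears a denominator of both.

-- Semifields, and the semiring obtained by adjoining a zero

module SemifieldProperties {c ℓ : Level} (P : Semifield c ℓ) where
  open Semifield P public renaming (_≈_ to infix 4 _≈_; _⁻¹ to infix 8 _⁻¹)
  open IsAbelianGroup ⊗-isAbelianGroup public using (isEquivalence)
    renaming ( refl to ≈-refl; sym to ≈-sym; trans to ≈-trans; reflexive to ≈-reflexive
             ; ∙-cong to ⊗-cong; assoc to ⊗-assoc; comm to ⊗-comm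
             ; identityˡ to ⊗-identityˡ; identityʳ to ⊗-identityʳ
             ; inverseˡ to ⊗-inverseˡ; inverseʳ to ⊗-inverseʳ; ⁻¹-cong to ⊗-inv-cong
             ; setoid to ≈-setoid)
  open IsCommutativeSemigroup ⊕-isCommutativeSemigroup public using ()
    renaming (∙-cong to ⊕-cong; assoc to ⊕-assoc; comm to ⊕-comm)

  ⊗-abelianGroup : AbelianGroup c ℓ
  ⊗-abelianGroup = record { isAbelianGroup = ⊗-isAbelianGroup }

  ⊗-cancelʳ : ∀ z {x y} → x ⊗ z ≈ y ⊗ z → x ≈ y
  ⊗-cancelʳ z = AbelianGroupProperties.∙-cancelʳ ⊗-abelianGroup z _ _

  private
    _≈₀_ = Pointwise _≈_

    _+₀_ : Maybe Carrier → Maybe Carrier → Maybe Carrier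
    nothing +₀ y       = y
    just x  +₀ nothing = just x
    just x  +₀ just y  = just (x ⊕ y)

    _*₀_ : Maybe Carrier → Maybe Carrier → Maybe Carrier
    nothing *₀ y       = nothing
    just x  *₀ nothing = nothing
    just x  *₀ just y  = just (x ⊗ y)

    refl₀ : ∀ {x} → x ≈₀ x
    refl₀ = Pointwise.refl ≈-refl

    +-cong₀ : ∀ {x y u v} → x ≈₀ y → u ≈₀ v → (x +₀ u) ≈₀ (y +₀ v)
    +-cong₀ nothing  q        = q
    +-cong₀ (just p) nothing  = just p
    +-cong₀ (just p) (just q) = just (⊕-cong p q)

    *-cong₀ : ∀ {x y u v} → x ≈₀ y → u ≈₀ v → (x *₀ u) ≈₀ (y *₀ v)
    *-cong₀ nothing  q        = nothing
    *-cong₀ (just p) nothing  = nothing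
    *-cong₀ (just p) (just q) = just (⊗-cong p q)

    +-assoc₀ : ∀ x y z → ((x +₀ y) +₀ z) ≈₀ (x +₀ (y +₀ z))
    +-assoc₀ nothing  y        z        = refl₀
    +-assoc₀ (just x) nothing  z        = refl₀
    +-assoc₀ (just x) (just y) nothing  = refl₀
    +-assoc₀ (just x) (just y) (just z) = just (⊕-assoc x y z)

    +-comm₀ : ∀ x y → (x +₀ y) ≈₀ (y +₀ x)
    +-comm₀ nothing  nothing  = refl₀
    +-comm₀ nothing  (just y) = refl₀
    +-comm₀ (just x) nothing  = refl₀
    +-comm₀ (just x) (just y) = just (⊕-comm x y)

    +-identityʳ₀ : ∀ x → (x +₀ nothing) ≈₀ x
    +-identityʳ₀ nothing  = refl₀
    +-identityʳ₀ (just x) = refl₀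

    *-assoc₀ : ∀ x y z → ((x *₀ y) *₀ z) ≈₀ (x *₀ (y *₀ z))
    *-assoc₀ nothing  y        z        = refl₀
    *-assoc₀ (just x) nothing  z        = refl₀
    *-assoc₀ (just x) (just y) nothing  = refl₀
    *-assoc₀ (just x) (just y) (just z) = just (⊗-assoc x y z)

    *-comm₀ : ∀ x y → (x *₀ y) ≈₀ (y *₀ x)
    *-comm₀ nothing  nothing  = refl₀
    *-comm₀ nothing  (just y) = refl₀
    *-comm₀ (just x) nothing  = refl₀
    *-comm₀ (just x) (just y) = just (⊗-comm x y)

    *-identityˡ₀ : ∀ x → (just 1# *₀ x) ≈₀ x
    *-identityˡ₀ nothing  = refl₀
    *-identityˡ₀ (just x) = just (⊗-identityˡ x)

    *-identityʳ₀ : ∀ x → (x *₀ just 1#) ≈₀ x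
    *-identityʳ₀ nothing  = refl₀
    *-identityʳ₀ (just x) = just (⊗-identityʳ x)

    *-zeroʳ₀ : ∀ x → (x *₀ nothing) ≈₀ nothing
    *-zeroʳ₀ nothing  = refl₀
    *-zeroʳ₀ (just x) = refl₀

    distribˡ₀ : ∀ x y z → (x *₀ (y +₀ z)) ≈₀ ((x *₀ y) +₀ (x *₀ z))
    distribˡ₀ nothing  y        z        = refl₀
    distribˡ₀ (just x) nothing  z        = refl₀
    distribˡ₀ (just x) (just y) nothing  = refl₀
    distribˡ₀ (just x) (just y) (just z) = just (proj₁ distrib x y z)

    distribʳ₀ : ∀ x y z → ((y +₀ z) *₀ x) ≈₀ ((y *₀ x) +₀ (z *₀ x))
    distribʳ₀ x        nothing  z        = refl₀
    distribʳ₀ nothing  (just y) nothing  = refl₀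
    distribʳ₀ (just x) (just y) nothing  = refl₀
    distribʳ₀ nothing  (just y) (just z) = refl₀
    distribʳ₀ (just x) (just y) (just z) = just (proj₂ distrib x y z)

  -- Adjoining a zero makes P a commutative semiring: empty sums exist and
  -- the ring solver applies.
  P₀ : CommutativeSemiring c (c ⊔ ℓ)
  P₀ = record
    { Carrier = Maybe Carrier ; _≈_ = _≈₀_ ; _+_ = _+₀_ ; _*_ = _*₀_
    ; 0# = nothing ; 1# = just 1#
    ; isCommutativeSemiring = record
      { isSemiring = record
        { isSemiringWithoutAnnihilatingZero = record
          { +-isCommutativeMonoid = record
            { isMonoid = record
              { isSemigroup = record
                { isMagma = record { isEquivalence = Pointwise.isEquivalence isEquivalence ; ∙-cong = +-cong₀ }
                ; assoc = +-assoc₀ }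
              ; identity = (λ _ → refl₀) , +-identityʳ₀ }
            ; comm = +-comm₀ }
          ; *-cong = *-cong₀
          ; *-assoc = *-assoc₀
          ; *-identity = *-identityˡ₀ , *-identityʳ₀
          ; distrib = distribˡ₀ , distribʳ₀ }
        ; zero = (λ _ → refl₀) , *-zeroʳ₀ }
      ; *-comm = *-comm₀ } }

  module K = CommutativeSemiring P₀
  module Solver = RingSolver P₀

-- Sums over ranges, windows of a quasi-periodic sequence, and the double sum over a torus

module RangeSums {c ℓ : Level} (R : CommutativeSemiring c ℓ) where
  open CommutativeSemiring R
  open SetoidReasoning setoid
  open RingSolver R using (solve; _:+_; _:*_; _:=_)

  sum : (ℕ → Carrier) → ℕ → ℕ → Carrier
  sum f t zero    = 0#
  sum f t (suc n) = f t + sum f (suc t) n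

  sum-cong : ∀ {f g} t n → (∀ l → t ≤ l → l < t ℕ.+ n → f l ≈ g l) → sum f t n ≈ sum g t n
  sum-cong t zero    h = refl
  sum-cong t (suc n) h = +-cong
    (h t ℕₚ.≤-refl (ℕₚ.m<m+n t (s≤s z≤n)))
    (sum-cong (suc t) n λ l t<l l<u → h l (ℕₚ.<⇒≤ t<l) (≡.subst (l <_) (≡.sym (ℕₚ.+-suc t n)) l<u))

  sum-++ : ∀ f t a b → sum f t (a ℕ.+ b) ≈ sum f t a + sum f (t ℕ.+ a) b
  sum-++ f t zero    b = sym (trans (+-identityˡ _) (reflexive (≡.cong (λ u → sum f u b) (ℕₚ.+-identityʳ t))))
  sum-++ f t (suc a) b = trans
    (+-congˡ (trans (sum-++ f (suc t) a b) (+-congˡ (reflexive (≡.cong (λ u → sum f u b) (≡.sym (ℕₚ.+-suc t a)))))))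
    (sym (+-assoc _ _ _))

  sum-last : ∀ f t n → sum f t (suc n) ≈ sum f t n + f (t ℕ.+ n)
  sum-last f t n = trans
    (reflexive (≡.cong (sum f t) (ℕₚ.+-comm 1 n)))
    (trans (sum-++ f t n 1) (+-congˡ (+-identityʳ _)))

  sum-shift : ∀ f k t n → sum f (t ℕ.+ k) n ≈ sum (λ l → f (l ℕ.+ k)) t n
  sum-shift f k t zero    = refl
  sum-shift f k t (suc n) = +-congˡ (sum-shift f k (suc t) n)

  *-distribˡ-sum : ∀ x f t n → x * sum f t n ≈ sum (λ l → x * f l) t n
  *-distribˡ-sum x f t zero    = zeroʳ x
  *-distribˡ-sum x f t (suc n) = trans (distribˡ x _ _) (+-congˡ (*-distribˡ-sum x f (suc t) n))

  sum-+ : ∀ f g t n → sum (λ l → f l + g l) t n ≈ sum f t n + sum g t n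
  sum-+ f g t zero    = sym (+-identityˡ 0#)
  sum-+ f g t (suc n) = trans (+-congˡ (sum-+ f g (suc t) n))
    (solve 4 (λ a b x y → (a :+ b) :+ (x :+ y) := (a :+ x) :+ (b :+ y)) refl _ _ _ _)

  sum-0 : ∀ t n → sum (λ _ → 0#) t n ≈ 0#
  sum-0 t zero    = refl
  sum-0 t (suc n) = trans (+-identityˡ _) (sum-0 (suc t) n)

  sum-swap : ∀ (f : ℕ → ℕ → Carrier) i n t k →
             sum (λ m → sum (f m) t k) i n ≈ sum (λ l → sum (λ m → f m l) i n) t k
  sum-swap f i zero    t k = sym (sum-0 t k)
  sum-swap f i (suc n) t k = trans (+-congˡ (sum-swap f (suc i) n t k)) (sym (sum-+ (f i) _ t k))

  -- Selects by the side of a cut `t` on which the index lies. Windows with different starting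
  -- points thus become sums over one common range, which interchanging the double sum requires.
  from : ℕ → ℕ → Carrier → Carrier → Carrier
  from t l x y with t ℕₚ.≤? l
  ... | yes _ = x
  ... | no  _ = y

  from-≤ : ∀ {t l x y} → t ≤ l → from t l x y ≈ x
  from-≤ {t} {l} t≤l with t ℕₚ.≤? l
  ... | yes _  = refl
  ... | no t≰l = contradiction t≤l t≰l

  from-> : ∀ {t l x y} → l < t → from t l x y ≈ y
  from-> {t} {l} l<t with t ℕₚ.≤? l
  ... | yes t≤l = contradiction t≤l (ℕₚ.<⇒≱ l<t)
  ... | no _    = refl

  -- No periodicity of `g` is involved: the indices below the cut are only renamed by their
  -- translates.
  sum-wrap : ∀ g t a b → sum g (t ℕ.+ a) (a ℕ.+ b) ≈
             sum (λ l → from (t ℕ.+ a) l (g l) (g (l ℕ.+ (a ℕ.+ b)))) t (a ℕ.+ b)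
  sum-wrap g t a b = begin
    sum g (t ℕ.+ a) (a ℕ.+ b)
      ≡⟨ ≡.cong (sum g (t ℕ.+ a)) (ℕₚ.+-comm a b) ⟩
    sum g (t ℕ.+ a) (b ℕ.+ a)
      ≈⟨ sum-++ g (t ℕ.+ a) b a ⟩
    sum g (t ℕ.+ a) b + sum g (t ℕ.+ a ℕ.+ b) a
      ≈⟨ +-comm _ _ ⟩
    sum g (t ℕ.+ a ℕ.+ b) a + sum g (t ℕ.+ a) b
      ≡⟨ ≡.cong (λ u → sum g u a + sum g (t ℕ.+ a) b) (ℕₚ.+-assoc t a b) ⟩
    sum g (t ℕ.+ (a ℕ.+ b)) a + sum g (t ℕ.+ a) b
      ≈⟨ +-congʳ (sum-shift g (a ℕ.+ b) t a) ⟩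
    sum (λ l → g (l ℕ.+ (a ℕ.+ b))) t a + sum g (t ℕ.+ a) b
      ≈⟨ +-cong (sum-cong t a λ l _ l<u → sym (from-> l<u))
                (sum-cong (t ℕ.+ a) b λ l u≤l _ → sym (from-≤ u≤l)) ⟩
    sum h t a + sum h (t ℕ.+ a) b
      ≈⟨ sum-++ h t a b ⟨
    sum h t (a ℕ.+ b) ∎
    where h = λ l → from (t ℕ.+ a) l (g l) (g (l ℕ.+ (a ℕ.+ b)))

  sum-wrap′ : ∀ g {t t′ n} → t ≤ t′ → t′ ≤ t ℕ.+ n →
              sum g t′ n ≈ sum (λ l → from t′ l (g l) (g (l ℕ.+ n))) t n
  sum-wrap′ g {t} {t′} {n} t≤t′ t′≤t+n
    with a , ≡.refl ← ℕₚ.m≤n⇒∃[o]m+o≡n t≤t′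
    with b , ≡.refl ← ℕₚ.m≤n⇒∃[o]m+o≡n (ℕₚ.+-cancelˡ-≤ t a n t′≤t+n)
    = sum-wrap g t a b

  module Windows (n : ℕ) (X : ℕ → Carrier) (z : Carrier) (X-period : ∀ i → X (i ℕ.+ n) ≈ z * X i) where

    W : ℕ → Carrier
    W i = sum X i n

    W-period : ∀ i → W (i ℕ.+ n) ≈ z * W i
    W-period i = trans (sum-shift X n i n)
      (trans (sum-cong i n λ l _ _ → X-period l) (sym (*-distribˡ-sum z X i n)))

    -- (1 - z) X_j = W_j - W_{j+1}, freed of subtractions
    exchange : ∀ i b → suc b ≤ n →
      sum X i b * W (suc (i ℕ.+ b)) + X (i ℕ.+ b) * W i ≈ sum X i (suc b) * W (i ℕ.+ b)
    exchange i b b<n with d , ≡.refl ← ℕₚ.m≤n⇒∃[o]m+o≡n b<n = begin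
      A * W (suc j) + x * W i   ≈⟨ +-cong (*-congˡ W-suc) (*-congˡ W-i) ⟩
      A * (V + z * x) + x * (A + (x + T))
        ≈⟨ +-congʳ (*-congˡ (+-congʳ V-split)) ⟩
      A * ((T + z * A) + z * x) + x * (A + (x + T))
        ≈⟨ solve 4 (λ A T z x → A :* ((T :+ z :* A) :+ z :* x) :+ x :* (A :+ (x :+ T))
                             := (A :+ x) :* (x :+ (T :+ z :* A))) refl A T z x ⟩
      (A + x) * (x + (T + z * A)) ≈⟨ *-cong (sum-last X i b) (+-congˡ V-split) ⟨
      sum X i (suc b) * W j ∎
      where
      j = i ℕ.+ b
      A = sum X i b
      x = X j
      T = sum X (suc j) d
      -- `V` is the part shared by `W j` and `W (suc j)`. It runs past the end of `W i`, where its
      -- last `b` terms repeat `A` with the factor `z`.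
      V = sum X (suc j) (b ℕ.+ d)
      W-i : W i ≈ A + (x + T)
      W-i = trans (reflexive (≡.cong (sum X i) (≡.sym (ℕₚ.+-suc b d)))) (sum-++ X i b (suc d))
      V-split : V ≈ T + z * A
      V-split = begin
        V                     ≡⟨ ≡.cong (sum X (suc j)) (ℕₚ.+-comm b d) ⟩
        sum X (suc j) (d ℕ.+ b)   ≈⟨ sum-++ X (suc j) d b ⟩
        T + sum X (suc j ℕ.+ d) b
          ≡⟨ ≡.cong (λ u → T + sum X u b) (≡.trans (≡.cong suc (ℕₚ.+-assoc i b d)) (≡.sym (ℕₚ.+-suc i (b ℕ.+ d)))) ⟩
        T + sum X (i ℕ.+ n) b ≈⟨ +-congˡ (sum-shift X n i b) ⟩
        T + sum (λ l → X (l ℕ.+ n)) i b ≈⟨ +-congˡ (sum-cong i b λ l _ _ → X-period l) ⟩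
        T + sum (λ l → z * X l) i b ≈⟨ +-congˡ (*-distribˡ-sum z X i b) ⟨
        T + z * A ∎
      W-suc : W (suc j) ≈ V + z * x
      W-suc = begin
        W (suc j) ≈⟨ sum-last X (suc j) (b ℕ.+ d) ⟩
        V + X (suc j ℕ.+ (b ℕ.+ d)) ≡⟨ ≡.cong (λ u → V + X u) (≡.sym (ℕₚ.+-suc j (b ℕ.+ d))) ⟩
        V + X (j ℕ.+ n) ≈⟨ +-congˡ (X-period j) ⟩
        V + z * x ∎

    module Telescope (W⁻¹ : ℕ → Carrier) (W-inverse : ∀ i → W⁻¹ i * W i ≈ 1#) where

      -- The semiring need not be cancellative; only windows are assumed invertible.
      W-cancel : ∀ i {x y} → x * W i ≈ y * W i → x ≈ y
      W-cancel i {x} {y} e = begin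
        x                  ≈⟨ expand x ⟩
        W⁻¹ i * (x * W i)  ≈⟨ *-congˡ e ⟩
        W⁻¹ i * (y * W i)  ≈⟨ expand y ⟨
        y ∎
        where
        expand : ∀ x → x ≈ W⁻¹ i * (x * W i)
        expand x = begin
          x                  ≈⟨ *-identityˡ x ⟨
          1# * x             ≈⟨ *-congʳ (W-inverse i) ⟨
          W⁻¹ i * W i * x    ≈⟨ solve 3 (λ v w x → v :* w :* x := v :* (x :* w)) refl (W⁻¹ i) (W i) x ⟩
          W⁻¹ i * (x * W i)  ∎

      x : ℕ → Carrier
      x m = X m * (W⁻¹ m * W⁻¹ (suc m))

      -- With subtraction, `x m = (1 / W (suc m) - 1 / W m) / (1 - z)`, and clearing denominators in
      -- the telescoped sum leaves `(W i - W (i + b)) / (1 - z)`, the sum of `b` heights. `exchange`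
      -- is one step of this; the bound `n` enters because it splits `W i` after `b` terms.
      telescope : ∀ i b → b ≤ n → sum x i b * (W i * W (i ℕ.+ b)) ≈ sum X i b
      telescope i zero    _   = zeroˡ _
      -- The factor `W j` completes the product that the induction hypothesis needs and is cancelled
      -- afterwards.
      telescope i (suc b) b<n = W-cancel j (begin
        sum x i (suc b) * (W i * W (i ℕ.+ suc b)) * W j
          ≈⟨ *-congʳ (*-cong (sum-last x i b) (*-congˡ (reflexive (≡.cong W (ℕₚ.+-suc i b))))) ⟩
        (sum x i b + X j * (W⁻¹ j * W⁻¹ (suc j))) * (W i * W (suc j)) * W j
          ≈⟨ solve 7 (λ s x v v′ w w′ w″ → (s :+ x :* (v :* v′)) :* (w :* w″) :* w′
                := s :* (w :* w′) :* w″ :+ x :* w :* (v :* w′) :* (v′ :* w″)) refl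
                (sum x i b) (X j) (W⁻¹ j) (W⁻¹ (suc j)) (W i) (W j) (W (suc j)) ⟩
        sum x i b * (W i * W j) * W (suc j) + X j * W i * (W⁻¹ j * W j) * (W⁻¹ (suc j) * W (suc j))
          ≈⟨ +-cong (*-congʳ (telescope i b (ℕₚ.<⇒≤ b<n)))
               (trans (*-cong (trans (*-congˡ (W-inverse j)) (*-identityʳ _)) (W-inverse (suc j))) (*-identityʳ _)) ⟩
        sum X i b * W (suc j) + X j * W i
          ≈⟨ exchange i b b<n ⟩
        sum X i (suc b) * W j ∎)
        where j = i ℕ.+ b

  module Braid
    (n N : ℕ) (X Y : ℕ → Carrier) (z ζ : Carrier) (σ ρ : ℕ → ℕ)
    (X-period : ∀ i → X (i ℕ.+ n) ≈ z * X i)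
    (Y-period : ∀ l → Y (l ℕ.+ N) ≈ ζ * Y l)
    (σ-period : ∀ i → σ (i ℕ.+ n) ≡ σ i ℕ.+ N)
    (ρ-period : ∀ l → ρ (l ℕ.+ N) ≡ ρ l ℕ.+ n)
    (σ-mono : ∀ {i j} → i ≤ j → σ i ≤ σ j)
    (galois : ∀ {m l} → σ m ≤ l → m < ρ l)
    (galois⁻¹ : ∀ {m l} → l < σ m → ρ l ≤ m)
    (W⁻¹ : ℕ → Carrier) (W-inverse : ∀ i → W⁻¹ i * sum X i n ≈ 1#)
    where

    open Windows n X z X-period
    open Telescope W⁻¹ W-inverse

    V : ℕ → Carrier
    V t = sum Y t N

    -- `ρ l` is the first `m` with `σ m > l`. All inner windows, on both sides, are rewritten over
    -- `[σ i, σ i + N)`; after interchanging the sums the two sides agree column by column.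
    braid : ∀ i → W i * sum (λ m → X m * sum (λ l → Y l * W (ρ l)) (σ m) N * (W⁻¹ m * W⁻¹ (suc m))) i n
                ≈ sum (λ m → X m * V (σ m)) i n
    braid i = begin
      W i * sum (λ m → X m * sum YW (σ m) N * (W⁻¹ m * W⁻¹ (suc m))) i n
        ≈⟨ *-congˡ (sum-cong i n λ m i≤m m<u → begin
             X m * sum YW (σ m) N * (W⁻¹ m * W⁻¹ (suc m))
               ≈⟨ solve 3 (λ a b c → a :* b :* c := (a :* c) :* b) refl _ _ _ ⟩
             x m * sum YW (σ m) N
               ≈⟨ *-congˡ (wrap YW i≤m m<u) ⟩
             x m * sum (λ l → from (σ m) l (YW l) (YW (l ℕ.+ N))) (σ i) N
               ≈⟨ *-distribˡ-sum (x m) _ (σ i) N ⟩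
             sum (λ l → x m * from (σ m) l (YW l) (YW (l ℕ.+ N))) (σ i) N ∎) ⟩
      W i * sum (λ m → sum (λ l → x m * from (σ m) l (YW l) (YW (l ℕ.+ N))) (σ i) N) i n
        ≈⟨ *-congˡ (sum-swap _ i n (σ i) N) ⟩
      W i * sum (λ l → sum (λ m → x m * from (σ m) l (YW l) (YW (l ℕ.+ N))) i n) (σ i) N
        ≈⟨ *-distribˡ-sum (W i) _ (σ i) N ⟩
      sum (λ l → W i * sum (λ m → x m * from (σ m) l (YW l) (YW (l ℕ.+ N))) i n) (σ i) N
        ≈⟨ sum-cong (σ i) N (λ l → column l) ⟩
      sum (λ l → sum (λ m → X m * from (σ m) l (Y l) (Y (l ℕ.+ N))) i n) (σ i) N
        ≈⟨ sum-swap _ i n (σ i) N ⟨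
      sum (λ m → sum (λ l → X m * from (σ m) l (Y l) (Y (l ℕ.+ N))) (σ i) N) i n
        ≈⟨ sum-cong i n (λ m i≤m m<u → sym (begin
             X m * V (σ m)
               ≈⟨ *-congˡ (wrap Y i≤m m<u) ⟩
             X m * sum (λ l → from (σ m) l (Y l) (Y (l ℕ.+ N))) (σ i) N
               ≈⟨ *-distribˡ-sum (X m) _ (σ i) N ⟩
             sum (λ l → X m * from (σ m) l (Y l) (Y (l ℕ.+ N))) (σ i) N ∎)) ⟩
      sum (λ m → X m * V (σ m)) i n ∎
      where
      YW : ℕ → Carrier
      YW l = Y l * W (ρ l)

      wrap : ∀ g {m} → i ≤ m → m < i ℕ.+ n →
             sum g (σ m) N ≈ sum (λ l → from (σ m) l (g l) (g (l ℕ.+ N))) (σ i) N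
      wrap g {m} i≤m m<u = sum-wrap′ g (σ-mono i≤m) (≡.subst (σ m ≤_) (σ-period i) (σ-mono (ℕₚ.<⇒≤ m<u)))

      -- As `m` grows, the selection `from (σ m) l` switches exactly at `m = ρ l`; `b` and `d` count
      -- the rows before and after the switch.
      split : ∀ (h : ℕ → Carrier) l b d → ρ l ≡ i ℕ.+ b → n ≡ b ℕ.+ d → ∀ u v →
              sum (λ m → h m * from (σ m) l u v) i n ≈ sum h i b * u + sum h (i ℕ.+ b) d * v
      split h l b d ρl≡ ≡.refl u v = trans (sum-++ _ i b d) (+-cong
        (trans (sum-cong i b λ m _ m<r → trans
                  (*-congˡ (from-≤ (ℕₚ.≮⇒≥ λ l<σm → ℕₚ.<⇒≱ m<r (≡.subst (_≤ m) ρl≡ (galois⁻¹ l<σm)))))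
                  (*-comm _ u))
               (trans (sym (*-distribˡ-sum u h i b)) (*-comm u _)))
        (trans (sum-cong (i ℕ.+ b) d λ m r≤m _ → trans
                  (*-congˡ (from-> (ℕₚ.≰⇒> λ σm≤l → ℕₚ.<⇒≱ (≡.subst (m <_) ρl≡ (galois σm≤l)) r≤m)))
                  (*-comm _ v))
               (trans (sym (*-distribˡ-sum v h (i ℕ.+ b) d)) (*-comm v _))))

      column : ∀ l → σ i ≤ l → l < σ i ℕ.+ N →
               W i * sum (λ m → x m * from (σ m) l (YW l) (YW (l ℕ.+ N))) i n
               ≈ sum (λ m → X m * from (σ m) l (Y l) (Y (l ℕ.+ N))) i n
      column l σi≤l l<u
        with b , i+b≡ρl ← ℕₚ.m≤n⇒∃[o]m+o≡n (ℕₚ.<⇒≤ (galois σi≤l))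
        with d , b+d≡n ← ℕₚ.m≤n⇒∃[o]m+o≡n (ℕₚ.+-cancelˡ-≤ i b n (≡.subst (_≤ i ℕ.+ n) (≡.sym i+b≡ρl)
               (galois⁻¹ (≡.subst (l <_) (≡.sym (σ-period i)) l<u))))
        = begin
        W i * sum (λ m → x m * from (σ m) l (YW l) (YW (l ℕ.+ N))) i n
          ≈⟨ *-congˡ (split x l b d (≡.sym i+b≡ρl) (≡.sym b+d≡n) _ _) ⟩
        W i * (sum x i b * (Y l * W (ρ l)) + sum x r d * (Y (l ℕ.+ N) * W (ρ (l ℕ.+ N))))
          ≈⟨ *-congˡ (+-cong (*-congˡ (*-congˡ (reflexive (≡.cong W (≡.sym i+b≡ρl)))))
               (*-congˡ (*-congˡ (trans (reflexive (≡.cong W (≡.trans (ρ-period l) (≡.cong (ℕ._+ n) (≡.sym i+b≡ρl))))) (W-period r))))) ⟩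
        W i * (sum x i b * (Y l * W r) + sum x r d * (Y (l ℕ.+ N) * (z * W r)))
          -- The factor `z` gained by `W (ρ (l + N))` is handed to `W i`, which becomes `W (i + n)`,
          -- the right end of the second telescoping sum.
          ≈⟨ solve 7 (λ a s y b t y′ z → a :* (s :* (y :* b) :+ t :* (y′ :* (z :* b)))
                 := s :* (a :* b) :* y :+ t :* (b :* (z :* a)) :* y′) refl
                 (W i) (sum x i b) (Y l) (W r) (sum x r d) (Y (l ℕ.+ N)) z ⟩
        sum x i b * (W i * W r) * Y l + sum x r d * (W r * (z * W i)) * Y (l ℕ.+ N)
          ≈⟨ +-congˡ (*-congʳ (*-congˡ (*-congˡ (trans (sym (W-period i))
               (reflexive (≡.cong W (≡.sym (≡.trans (ℕₚ.+-assoc i b d) (≡.cong (i ℕ.+_) b+d≡n))))))))) ⟩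
        sum x i b * (W i * W r) * Y l + sum x r d * (W r * W (r ℕ.+ d)) * Y (l ℕ.+ N)
          ≈⟨ +-cong (*-congʳ (telescope i b (≡.subst (b ≤_) b+d≡n (ℕₚ.m≤m+n b d))))
                    (*-congʳ (telescope r d (≡.subst (d ≤_) b+d≡n (ℕₚ.m≤n+m d b)))) ⟩
        sum X i b * Y l + sum X r d * Y (l ℕ.+ N)
          ≈⟨ split X l b d (≡.sym i+b≡ρl) (≡.sym b+d≡n) _ _ ⟨
        sum (λ m → X m * from (σ m) l (Y l) (Y (l ℕ.+ N))) i n ∎
        where r = i ℕ.+ b

-- Mutation of exchange matrices and of variables

pos-neg : ∀ x → pos (ℤ.- x) ≡ neg x
pos-neg (+ zero)  = ≡.refl
pos-neg (+ suc n) = ≡.refl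
pos-neg -[1+ n ]  = ≡.refl

neg-neg : ∀ x → neg (ℤ.- x) ≡ pos x
neg-neg (+ zero)  = ≡.refl
neg-neg (+ suc n) = ≡.refl
neg-neg -[1+ n ]  = ≡.refl

-- Matrix mutation away from the mutated vertex, isolated as a function of three entries so that
-- known values can be substituted for them.
through : ℤ → ℤ → ℤ → ℤ
through b u v = (b ℤ.+ + (pos u ℕ.* pos v)) ℤ.- + (neg u ℕ.* neg v)

through-zeroʳ : ∀ b u → through b u (+ 0) ≡ b
through-zeroʳ b u = ≡.trans
  (≡.cong₂ (λ p q → (b ℤ.+ + p) ℤ.- + q) (ℕₚ.*-zeroʳ (pos u)) (ℕₚ.*-zeroʳ (neg u)))
  (≡.trans (ℤₚ.+-identityʳ _) (ℤₚ.+-identityʳ b))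

through-zeroˡ : ∀ b v → through b (+ 0) v ≡ b
through-zeroˡ b v = ≡.trans (ℤₚ.+-identityʳ _) (ℤₚ.+-identityʳ b)

-- Reversing both arrows at the mutated vertex swaps the positive and the negative product, so the
-- second correction undoes the first.
through-neg : ∀ b u v → through (through b u v) (ℤ.- u) (ℤ.- v) ≡ b
through-neg b u v = ≡.trans
  (≡.cong₂ (λ p q → (through b u v ℤ.+ + p) ℤ.- + q)
    (≡.cong₂ ℕ._*_ (pos-neg u) (pos-neg v)) (≡.cong₂ ℕ._*_ (neg-neg u) (neg-neg v)))
  (cancel b (+ (pos u ℕ.* pos v)) (+ (neg u ℕ.* neg v)))
  where
  cancel : ∀ b p q → (b ℤ.+ p ℤ.- q) ℤ.+ q ℤ.- p ≡ b
  cancel b p q = ℤ-Solver.solve (b ∷ p ∷ q ∷ [])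

through-skew : ∀ b u v → through (ℤ.- b) (ℤ.- v) (ℤ.- u) ≡ ℤ.- through b u v
through-skew b u v = ≡.trans
  (≡.cong₂ (λ p q → (ℤ.- b ℤ.+ + p) ℤ.- + q)
    (≡.trans (≡.cong₂ ℕ._*_ (pos-neg v) (pos-neg u)) (ℕₚ.*-comm (neg v) (neg u)))
    (≡.trans (≡.cong₂ ℕ._*_ (neg-neg v) (neg-neg u)) (ℕₚ.*-comm (pos v) (pos u))))
  (skew b (+ (pos u ℕ.* pos v)) (+ (neg u ℕ.* neg v)))
  where
  skew : ∀ b p q → (ℤ.- b ℤ.+ q) ℤ.- p ≡ ℤ.- (b ℤ.+ p ℤ.- q)
  skew b p q = ℤ-Solver.solve (b ∷ p ∷ q ∷ [])

i≡-i⇒i≡0 : ∀ {i} → i ≡ ℤ.- i → i ≡ + 0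
i≡-i⇒i≡0 {+ zero}   _ = ≡.refl
i≡-i⇒i≡0 {+ suc n}  ()
i≡-i⇒i≡0 { -[1+ n ]} ()

SkewSymmetric : {V : Set} → ExchangeMatrix V → Set
SkewSymmetric B = ∀ i j → B i j ≡ ℤ.- B j i

module Seeds {c ℓ : Level} (P : Semifield c ℓ) {V : Set} (_≟_ : DecidableEquality V) where
  open SemifieldProperties P public
  open YSeeds P _≟_ public
  open SetoidReasoning ≈-setoid public

  mutB-selfˡ : ∀ k b j → mutB k b k j ≡ ℤ.- b k j
  mutB-selfˡ k b j with k ≟ k
  ... | yes _  = ≡.refl
  ... | no k≢k = contradiction ≡.refl k≢k

  mutB-selfʳ : ∀ k b i → mutB k b i k ≡ ℤ.- b i k
  mutB-selfʳ k b i with i ≟ k | k ≟ k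
  ... | yes _ | _      = ≡.refl
  ... | no _  | yes _  = ≡.refl
  ... | no _  | no k≢k = contradiction ≡.refl k≢k

  mutB-other : ∀ {k} b {i j} → i ≢ k → j ≢ k → mutB k b i j ≡ through (b i j) (b i k) (b k j)
  mutB-other {k} b {i} {j} i≢k j≢k with i ≟ k | j ≟ k
  ... | yes i≡k | _       = contradiction i≡k i≢k
  ... | no _    | yes j≡k = contradiction j≡k j≢k
  ... | no _    | no _    = ≡.refl

  mutB-cong : ∀ k {b b′} → (∀ i j → b i j ≡ b′ i j) → ∀ i j → mutB k b i j ≡ mutB k b′ i j
  mutB-cong k {b} {b′} e i j with i ≟ k | j ≟ k
  ... | yes _ | _     = ≡.cong ℤ.-_ (e i j)
  ... | no _  | yes _ = ≡.cong ℤ.-_ (e i j)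
  ... | no _  | no _ rewrite e i j | e i k | e k j = ≡.refl

  mutB-involutive : ∀ k b i j → mutB k (mutB k b) i j ≡ b i j
  mutB-involutive k b i j with i ≟ k | j ≟ k
  ... | yes ≡.refl | _          = ≡.trans (≡.cong ℤ.-_ (mutB-selfˡ k b j)) (ℤₚ.neg-involutive _)
  ... | no _       | yes ≡.refl = ≡.trans (≡.cong ℤ.-_ (mutB-selfʳ k b i)) (ℤₚ.neg-involutive _)
  ... | no i≢k     | no j≢k
    rewrite mutB-other b i≢k j≢k | mutB-selfʳ k b i | mutB-selfˡ k b j = through-neg (b i j) (b i k) (b k j)

  mutB-skew : ∀ k {b} → SkewSymmetric b → SkewSymmetric (mutB k b)
  mutB-skew k {b} skew i j with i ≟ k | j ≟ k
  ... | yes _ | yes _ = ≡.cong ℤ.-_ (skew i j)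
  ... | yes _ | no _  = ≡.cong ℤ.-_ (skew i j)
  ... | no _  | yes _ = ≡.cong ℤ.-_ (skew i j)
  ... | no _  | no _
    rewrite skew i j | skew i k | skew k j = through-skew (b j i) (b j k) (b k i)

  -- The case distinction of `muty` as a function of the matrix entry, so that an equation for
  -- `b k i` can be substituted.
  exchange-y : ℤ → Carrier → Carrier → Carrier
  exchange-y (+ zero)  yk yi = yi
  exchange-y (+ suc m) yk yi = yi ⊗ pow ((1# ⊕ yk ⁻¹) ⁻¹) (suc m)
  exchange-y -[1+ m ]  yk yi = yi ⊗ pow (1# ⊕ yk) (suc m)

  muty-self : ∀ k b y → muty k b y k ≡ y k ⁻¹
  muty-self k b y with k ≟ k
  ... | yes _  = ≡.refl
  ... | no k≢k = contradiction ≡.refl k≢k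

  muty-other : ∀ {k} b y {i} → i ≢ k → muty k b y i ≡ exchange-y (b k i) (y k) (y i)
  muty-other {k} b y {i} i≢k with i ≟ k
  ... | yes i≡k = contradiction i≡k i≢k
  ... | no _ with b k i
  ...   | + zero   = ≡.refl
  ...   | + suc m  = ≡.refl
  ...   | -[1+ m ] = ≡.refl

  muty-0 : ∀ {k} b y {i} → i ≢ k → b k i ≡ + 0 → muty k b y i ≈ y i
  muty-0 {k} b y i≢k e = ≈-reflexive (≡.trans (muty-other b y i≢k) (≡.cong (λ t → exchange-y t _ _) e))

  muty-pos : ∀ {k} b y {i} → i ≢ k → b k i ≡ + 1 → muty k b y i ≈ y i ⊗ (1# ⊕ y k ⁻¹) ⁻¹
  muty-pos {k} b y i≢k e = ≈-trans
    (≈-reflexive (≡.trans (muty-other b y i≢k) (≡.cong (λ t → exchange-y t _ _) e)))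
    (⊗-cong ≈-refl (⊗-identityʳ _))

  muty-neg : ∀ {k} b y {i} → i ≢ k → b k i ≡ -[1+ 0 ] → muty k b y i ≈ y i ⊗ (1# ⊕ y k)
  muty-neg {k} b y i≢k e = ≈-trans
    (≈-reflexive (≡.trans (muty-other b y i≢k) (≡.cong (λ t → exchange-y t _ _) e)))
    (⊗-cong ≈-refl (⊗-identityʳ _))

  run-++ : ∀ xs ys s → run (xs ++ ys) s ≡ run ys (run xs s)
  run-++ xs ys s = Listₚ.foldl-++ (λ t σ → step σ t) s xs ys

  -- From three vertices on the sequence begins and ends with a mutation at the first vertex. With
  -- two vertices the final run `μ_{n-2}, …, μ_1` is empty, so the recursion stops there.
  τ-suc : ∀ k lab → τ (3 ℕ.+ k) lab ≡ mutate (lab 1) ∷ τ (2 ℕ.+ k) (lab ∘ suc) ++ mutate (lab 1) ∷ []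
  τ-suc k lab = ≡.cong (mutate (lab 1) ∷_) (≡.trans
    (≡.cong₂ (λ xs ys → xs ++ transpose (lab (2 ℕ.+ k)) (lab (3 ℕ.+ k)) ∷ ys) (maps (2 ℕ.+ k))
      (≡.trans (Listₚ.unfold-reverse (mutate (lab 1)) (map (λ i → mutate (lab (suc i))) (applyUpTo suc k)))
               (≡.cong (λ xs → reverse xs ++ mutate (lab 1) ∷ []) (maps k))))
    (≡.sym (Listₚ.++-assoc (map (λ i → mutate (lab (suc (suc i)))) (upTo (2 ℕ.+ k))) _ _)))
    where
    maps : ∀ k → map (λ i → mutate (lab (suc i))) (applyUpTo suc k)
               ≡ map (λ i → mutate (lab (suc (suc i)))) (upTo k)
    maps k = ≡.trans (Listₚ.map-applyUpTo suc (λ i → mutate (lab (suc i))) k)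
                     (≡.sym (Listₚ.map-applyUpTo (λ i → i) (λ i → mutate (lab (suc (suc i)))) k))

-- Arcs on an oriented cycle, and the shorter cycle left by a mutation

δ : ℕ → ℕ → ℤ
δ zero    zero    = + 1
δ zero    (suc i) = + 0
δ (suc e) zero    = + 0
δ (suc e) (suc i) = δ e i

-- For a vertex with column `b`: one arrow arrives from cycle vertex `e` and one leaves to `s`; for
-- `s = e` they cancel and there is no arrow. Mutation at the first cycle vertex preserves this
-- shape, which makes it the invariant of the induction. `δ` is recursive so that dropping that
-- vertex computes.
record Arc (m : ℕ) (b : ℕ → ℤ) (s e : ℕ) : Set where
  field
    source : s < m
    target : e < m
    column : ∀ i → i < m → b i ≡ δ e i ℤ.- δ s i
open Arc public

-- Mutating at cycle vertex `0` composes the arrows through it: an arrow to `0` is continued to its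
-- successor, an arrow from `0` is pulled back to its predecessor. Positions are counted on the
-- shorter cycle, where these two neighbours are `0` and `suc k`.
cut : ℕ → ℕ → ℕ → ℕ × ℕ
cut k zero    zero    = zero , zero
cut k zero    (suc e) = zero , e
cut k (suc s) zero    = s , suc k
cut k (suc s) (suc e) = s , e

neg-δ-suc-zero : ∀ k i → neg (δ (suc k) i ℤ.- δ 0 i) ℕ.* 1 ≡ pos (δ 0 i)
neg-δ-suc-zero k zero = ≡.refl
neg-δ-suc-zero zero (suc zero) = ≡.refl
neg-δ-suc-zero zero (suc (suc i)) = ≡.refl
neg-δ-suc-zero (suc k) (suc zero) = ≡.refl
neg-δ-suc-zero (suc k) (suc (suc i)) = neg-δ-suc-zero k (suc i)

module _ {V : Set} where

  col : ExchangeMatrix V → (ℕ → V) → V → ℕ → ℤ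
  col B a v i = B (a i) v

  -- For `k = 0` successor and predecessor of a vertex coincide, so `first` and `last` are trivial
  -- arcs and the two vertices are not joined. `arcs` asks every vertex of the quiver, on the cycle
  -- or not, to meet the cycle in an arc.
  record Cycle (k : ℕ) (B : ExchangeMatrix V) (a : ℕ → V) : Set where
    field
      injective : ∀ i j → i < 2 ℕ.+ k → j < 2 ℕ.+ k → a i ≡ a j → i ≡ j
      skew      : SkewSymmetric B
      arcs      : ∀ v → ∃₂ (Arc (2 ℕ.+ k) (col B a v))
      first     : Arc (2 ℕ.+ k) (col B a (a 0)) 1 (suc k)
      inner     : ∀ i → i < k → Arc (2 ℕ.+ k) (col B a (a (suc i))) (2 ℕ.+ i) i
      last      : Arc (2 ℕ.+ k) (col B a (a (suc k))) 0 k

module CycleMutation {c ℓ : Level} (P : Semifield c ℓ) {V : Set} (_≟_ : DecidableEquality V) where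
  open Seeds P _≟_ using (mutB; mutB-other; mutB-selfʳ; mutB-skew)

  module _ {k : ℕ} {B : ExchangeMatrix V} {a : ℕ → V} (C : Cycle (suc k) B a) where
    open Cycle C

    head≢ : ∀ i → i < 2 ℕ.+ k → a (suc i) ≢ a 0
    head≢ i i<m e with injective (suc i) 0 (s≤s i<m) (s≤s z≤n) e
    ... | ()

    cut-Arc : ∀ {v s e} → v ≢ a 0 → Arc (3 ℕ.+ k) (col B a v) s e →
              Arc (2 ℕ.+ k) (col (mutB (a 0) B) (a ∘ suc) v) (proj₁ (cut k s e)) (proj₂ (cut k s e))
    cut-Arc {v} {s} {e} v≢ A = record
      { source = source′ s e (source A)
      ; target = target′ s e (target A)
      ; column = λ i i<m → ≡.trans (mutB-other B (head≢ i i<m) v≢)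
          (≡.trans (≡.cong₂ (λ x y → through x y (B (a 0) v)) (column A (suc i) (s≤s i<m)) (column first (suc i) (s≤s i<m)))
          (≡.trans (≡.cong (through (δ e (suc i) ℤ.- δ s (suc i)) (δ (suc k) i ℤ.- δ 0 i)) (column A 0 (s≤s z≤n)))
                   (column′ s e i))) }
      where
      source′ : ∀ s e → s < 3 ℕ.+ k → proj₁ (cut k s e) < 2 ℕ.+ k
      source′ zero    zero    _         = s≤s z≤n
      source′ zero    (suc e) _         = s≤s z≤n
      source′ (suc s) zero    (s≤s s<m) = s<m
      source′ (suc s) (suc e) (s≤s s<m) = s<m
      target′ : ∀ s e → e < 3 ℕ.+ k → proj₂ (cut k s e) < 2 ℕ.+ k
      target′ zero    zero    _         = s≤s z≤n
      target′ zero    (suc e) (s≤s e<m) = e<m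
      target′ (suc s) zero    _         = ℕₚ.≤-refl
      target′ (suc s) (suc e) (s≤s e<m) = e<m
      pos-lemma : ∀ i → pos (δ (suc k) i ℤ.- δ 0 i) ℕ.* 1 ≡ pos (δ (suc k) i)
      pos-lemma zero    = ≡.refl
      pos-lemma (suc i) = ≡.trans (ℕₚ.*-identityʳ _) (≡.cong pos (ℤₚ.+-identityʳ (δ k i)))
      +pos-δ : ∀ e i → + pos (δ e i) ≡ δ e i
      +pos-δ zero    zero    = ≡.refl
      +pos-δ zero    (suc i) = ≡.refl
      +pos-δ (suc e) zero    = ≡.refl
      +pos-δ (suc e) (suc i) = +pos-δ e i
      column′ : ∀ s e i → through (δ e (suc i) ℤ.- δ s (suc i)) (δ (suc k) i ℤ.- δ 0 i) (δ e 0 ℤ.- δ s 0)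
                        ≡ δ (proj₂ (cut k s e)) i ℤ.- δ (proj₁ (cut k s e)) i
      column′ zero zero i = ≡.trans (through-zeroʳ _ (δ (suc k) i ℤ.- δ 0 i)) (≡.sym (ℤₚ.+-inverseʳ (δ 0 i)))
      column′ zero (suc e) i = ≡.cong₂ (λ x y → x ℤ.- y)
        (≡.trans (≡.cong (λ t → (δ e i ℤ.- + 0) ℤ.+ + t) (ℕₚ.*-zeroʳ (pos (δ (suc k) i ℤ.- δ 0 i))))
                 (≡.trans (ℤₚ.+-identityʳ _) (ℤₚ.+-identityʳ (δ e i))))
        (≡.trans (≡.cong +_ (neg-δ-suc-zero k i)) (+pos-δ 0 i))
      column′ (suc s) zero i = ≡.trans
        (≡.cong₂ (λ x y → (+ 0 ℤ.- δ s i) ℤ.+ + x ℤ.- + y) (pos-lemma i) (ℕₚ.*-zeroʳ (neg (δ (suc k) i ℤ.- δ 0 i))))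
        (≡.trans (ℤₚ.+-identityʳ _)
          (≡.trans (ℤₚ.+-comm (+ 0 ℤ.- δ s i) _)
            (≡.cong₂ ℤ._+_ (+pos-δ (suc k) i) (ℤₚ.+-identityˡ (ℤ.- δ s i)))))
      column′ (suc s) (suc e) i = through-zeroʳ _ (δ (suc k) i ℤ.- δ 0 i)

    -- The removed vertex remains as an outside vertex of the shorter cycle: its reversed arrows
    -- enclose the arc from the last vertex to the first.
    head-Arc : Arc (2 ℕ.+ k) (col (mutB (a 0) B) (a ∘ suc) (a 0)) (suc k) 0
    head-Arc = record
      { source = ℕₚ.≤-refl
      ; target = s≤s z≤n
      ; column = λ i i<m → ≡.trans (mutB-selfʳ (a 0) B (a (suc i)))
          (≡.trans (≡.cong ℤ.-_ (column first (suc i) (s≤s i<m)))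
          (≡.trans (ℤₚ.neg-distrib-+ (δ (suc k) i) (ℤ.- δ 0 i))
          (≡.trans (ℤₚ.+-comm (ℤ.- δ (suc k) i) _) (≡.cong (ℤ._- δ (suc k) i) (ℤₚ.neg-involutive (δ 0 i)))))) }

    cut-arcs : ∀ v → ∃₂ (Arc (2 ℕ.+ k) (col (mutB (a 0) B) (a ∘ suc) v))
    cut-arcs v = by-cases (v ≟ a 0)
      where
      by-cases : Dec (v ≡ a 0) → ∃₂ (Arc (2 ℕ.+ k) (col (mutB (a 0) B) (a ∘ suc) v))
      by-cases (yes ≡.refl) = suc k , 0 , head-Arc
      by-cases (no v≢)      = _ , _ , cut-Arc v≢ (proj₂ (proj₂ (arcs v)))

    cut-Cycle : Cycle k (mutB (a 0) B) (a ∘ suc)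
    cut-Cycle = record
      { injective = λ i j i<m j<m e → ℕₚ.suc-injective (injective (suc i) (suc j) (s≤s i<m) (s≤s j<m) e)
      ; skew      = mutB-skew (a 0) skew
      ; arcs      = cut-arcs
      ; first     = cut-Arc (head≢ 0 (s≤s z≤n)) (inner 0 (s≤s z≤n))
      ; inner     = λ i i<k → cut-Arc (head≢ (suc i) (ℕₚ.m≤n⇒m≤1+n (s≤s i<k))) (inner (suc i) (s≤s i<k))
      ; last      = cut-Arc (head≢ (suc k) ℕₚ.≤-refl) last
      }

δ-refl : ∀ i → δ i i ≡ + 1
δ-refl zero    = ≡.refl
δ-refl (suc i) = δ-refl i

δ-≢ : ∀ {e i} → e ≢ i → δ e i ≡ + 0
δ-≢ {zero}  {zero}  e≢i = contradiction ≡.refl e≢i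
δ-≢ {zero}  {suc i} e≢i = ≡.refl
δ-≢ {suc e} {zero}  e≢i = ≡.refl
δ-≢ {suc e} {suc i} e≢i = δ-≢ (e≢i ∘ ≡.cong suc)

module _ {m : ℕ} {b : ℕ → ℤ} where

  -- The entry `-1` of a nontrivial column can only come from the source, and the entry `1` only
  -- from the target.
  Arc-unique : ∀ {s e s′ e′} → s′ ≢ e′ → Arc m b s′ e′ → Arc m b s e → s ≡ s′ × e ≡ e′
  Arc-unique {s} {e} {s′} {e′} s′≢e′ A′ A = at-source (s ℕₚ.≟ s′) , at-target (e ℕₚ.≟ e′)
    where
    compare : ∀ i → i < m → δ e i ℤ.- δ s i ≡ δ e′ i ℤ.- δ s′ i
    compare i i<m = ≡.trans (≡.sym (column A i i<m)) (column A′ i i<m)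
    nonneg : ∀ e i → δ e i ℤ.- + 0 ≢ -[1+ 0 ]
    nonneg e i eq with e ℕₚ.≟ i
    ... | yes ≡.refl = contradiction (≡.trans (≡.cong (ℤ._- + 0) (≡.sym (δ-refl i))) eq) λ ()
    ... | no e≢i     = contradiction (≡.trans (≡.cong (ℤ._- + 0) (≡.sym (δ-≢ e≢i))) eq) λ ()
    nonpos : ∀ s i → + 0 ℤ.- δ s i ≢ + 1
    nonpos s i eq with s ℕₚ.≟ i
    ... | yes ≡.refl = contradiction (≡.trans (≡.cong (λ t → + 0 ℤ.- t) (≡.sym (δ-refl i))) eq) λ ()
    ... | no s≢i     = contradiction (≡.trans (≡.cong (λ t → + 0 ℤ.- t) (≡.sym (δ-≢ s≢i))) eq) λ ()
    at-source : Dec (s ≡ s′) → s ≡ s′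
    at-source (yes s≡s′) = s≡s′
    at-source (no s≢s′)  = contradiction
      (≡.trans (≡.cong (λ t → δ e s′ ℤ.- t) (≡.sym (δ-≢ s≢s′))) (≡.trans (compare s′ (source A′))
        (≡.cong₂ ℤ._-_ (δ-≢ (s′≢e′ ∘ ≡.sym)) (δ-refl s′)))) (nonneg e s′)
    at-target : Dec (e ≡ e′) → e ≡ e′
    at-target (yes e≡e′) = e≡e′
    at-target (no e≢e′)  = contradiction
      (≡.trans (≡.cong (λ t → t ℤ.- δ s e′) (≡.sym (δ-≢ e≢e′))) (≡.trans (compare e′ (target A′))
        (≡.cong₂ ℤ._-_ (δ-refl e′) (δ-≢ s′≢e′)))) (nonpos s e′)

  Arc-zero : ∀ {s e} → (∀ i → i < m → b i ≡ + 0) → Arc m b s e → s ≡ e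
  Arc-zero {s} {e} b≡0 A with e ℕₚ.≟ s
  ... | yes e≡s = ≡.sym e≡s
  ... | no e≢s  = contradiction
    (≡.trans (≡.sym (b≡0 s (source A))) (≡.trans (column A s (source A)) (≡.cong₂ ℤ._-_ (δ-≢ e≢s) (δ-refl s)))) λ ()

-- The reflection in a cycle and how it scales the variables

module SemifieldIdentities {c ℓ : Level} (P : Semifield c ℓ) where
  open SemifieldProperties P
  open SetoidReasoning ≈-setoid
  open Solver using (solve; _:*_; _:+_; _:=_; con)

  -- A vertex with an arrow into the head of the cycle. `x` and `q` are the variable of the head at
  -- the two mutations there, with the shorter reflection in between. They contribute
  -- `(1 + x) / (1 + q⁻¹)`, which is `W₁ / W₀` since `(1 + q⁻¹) W₁` and `(1 + x) W₀` both equal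
  -- `W₁ + x w₀`.
  incoming : ∀ {x q w₀ W₀ W₁ Wₑ κ y y′ u u′} →
    (1# ⊕ x) ⊗ W₀ ≈ W₁ ⊕ x ⊗ w₀ → q ⊗ w₀ ≈ x ⁻¹ ⊗ W₁ →
    y′ ≈ y ⊗ (1# ⊕ x) → u ⊗ (κ ⊗ W₁) ≈ y′ ⊗ Wₑ → u′ ≈ u ⊗ (1# ⊕ q ⁻¹) ⁻¹ →
    u′ ⊗ (κ ⊗ W₀) ≈ y ⊗ Wₑ
  incoming {x} {q} {w₀} {W₀} {W₁} {Wₑ} {κ} {y} {y′} {u} {u′} R Q Ey Eu Eu′ = ⊗-cancelʳ (J ⊗ W₁) (begin
    u′ ⊗ (κ ⊗ W₀) ⊗ (J ⊗ W₁)        ≈⟨ ⊗-cong (⊗-cong Eu′ ≈-refl) ≈-refl ⟩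
    u ⊗ J ⁻¹ ⊗ (κ ⊗ W₀) ⊗ (J ⊗ W₁)  ≈⟨ drop-just (solve 6 (λ u I κ W₀ J W₁ →
      u :* I :* (κ :* W₀) :* (J :* W₁) := (I :* J) :* (u :* (κ :* W₁)) :* W₀) K.refl
      (just u) (just (J ⁻¹)) (just κ) (just W₀) (just J) (just W₁)) ⟩
    (J ⁻¹ ⊗ J) ⊗ (u ⊗ (κ ⊗ W₁)) ⊗ W₀ ≈⟨ ⊗-cong (⊗-cong (⊗-inverseˡ J) (≈-trans Eu (⊗-cong Ey ≈-refl))) ≈-refl ⟩
    1# ⊗ (y ⊗ (1# ⊕ x) ⊗ Wₑ) ⊗ W₀   ≈⟨ ⊗-cong (⊗-identityˡ _) ≈-refl ⟩
    y ⊗ (1# ⊕ x) ⊗ Wₑ ⊗ W₀   ≈⟨ drop-just (solve 4 (λ y t Wₑ W₀ →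
      y :* t :* Wₑ :* W₀ := y :* Wₑ :* (t :* W₀)) K.refl (just y) (just (1# ⊕ x)) (just Wₑ) (just W₀)) ⟩
    y ⊗ Wₑ ⊗ ((1# ⊕ x) ⊗ W₀)         ≈⟨ ⊗-cong ≈-refl (≈-trans R (≈-sym JW)) ⟩
    y ⊗ Wₑ ⊗ (J ⊗ W₁) ∎)
    where
    J = 1# ⊕ q ⁻¹
    JW : J ⊗ W₁ ≈ W₁ ⊕ x ⊗ w₀
    JW = begin
      (1# ⊕ q ⁻¹) ⊗ W₁       ≈⟨ proj₂ distrib W₁ 1# (q ⁻¹) ⟩
      1# ⊗ W₁ ⊕ q ⁻¹ ⊗ W₁    ≈⟨ ⊕-cong (⊗-identityˡ W₁) (⊗-cancelʳ (q ⊗ x ⁻¹) (begin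
        q ⁻¹ ⊗ W₁ ⊗ (q ⊗ x ⁻¹)     ≈⟨ drop-just (solve 4 (λ q′ w q x′ → q′ :* w :* (q :* x′) := (q′ :* q) :* (x′ :* w)) K.refl
                                      (just (q ⁻¹)) (just W₁) (just q) (just (x ⁻¹))) ⟩
        (q ⁻¹ ⊗ q) ⊗ (x ⁻¹ ⊗ W₁)   ≈⟨ ⊗-cong (≈-trans (⊗-inverseˡ q) (≈-sym (⊗-inverseʳ x))) (≈-sym Q) ⟩
        (x ⊗ x ⁻¹) ⊗ (q ⊗ w₀)     ≈⟨ drop-just (solve 4 (λ x x′ q w → (x :* x′) :* (q :* w) := x :* w :* (q :* x′)) K.refl
                                      (just x) (just (x ⁻¹)) (just q) (just w₀)) ⟩
        x ⊗ w₀ ⊗ (q ⊗ x ⁻¹) ∎)) ⟩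
      W₁ ⊕ x ⊗ w₀ ∎

  -- A vertex with an arrow from the head: the factors `1 / (1 + x⁻¹)` and `1 + q` combine to
  -- `W₀ / w₀`, because `(1 + q) w₀` and `(1 + x⁻¹) W₀` are `x⁻¹` times the two sides of the
  -- exchange relation.
  outgoing : ∀ {x q w₀ W₀ W₁ Wₛ κ y y′ u u′ z} →
    (1# ⊕ x) ⊗ W₀ ≈ W₁ ⊕ x ⊗ w₀ → q ⊗ w₀ ≈ x ⁻¹ ⊗ W₁ →
    y′ ≈ y ⊗ (1# ⊕ x ⁻¹) ⁻¹ → u ⊗ (κ ⊗ Wₛ) ≈ y′ ⊗ (z ⊗ w₀) → u′ ≈ u ⊗ (1# ⊕ q) →
    u′ ⊗ (κ ⊗ Wₛ) ≈ y ⊗ (z ⊗ W₀)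
  outgoing {x} {q} {w₀} {W₀} {W₁} {Wₛ} {κ} {y} {y′} {u} {u′} {z} R Q Ey Eu Eu′ = begin
    u′ ⊗ (κ ⊗ Wₛ)                ≈⟨ ⊗-cong Eu′ ≈-refl ⟩
    u ⊗ (1# ⊕ q) ⊗ (κ ⊗ Wₛ)      ≈⟨ drop-just (solve 4 (λ u t κ w → u :* t :* (κ :* w) := t :* (u :* (κ :* w))) K.refl
                                     (just u) (just (1# ⊕ q)) (just κ) (just Wₛ)) ⟩
    (1# ⊕ q) ⊗ (u ⊗ (κ ⊗ Wₛ))    ≈⟨ ⊗-cong ≈-refl (≈-trans Eu (⊗-cong Ey ≈-refl)) ⟩
    (1# ⊕ q) ⊗ (y ⊗ J ⁻¹ ⊗ (z ⊗ w₀)) ≈⟨ drop-just (solve 5 (λ t y I z w → t :* (y :* I :* (z :* w)) := y :* z :* I :* (t :* w)) K.refl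
                                     (just (1# ⊕ q)) (just y) (just (J ⁻¹)) (just z) (just w₀)) ⟩
    y ⊗ z ⊗ J ⁻¹ ⊗ ((1# ⊕ q) ⊗ w₀) ≈⟨ ⊗-cong ≈-refl qw ⟩
    y ⊗ z ⊗ J ⁻¹ ⊗ (J ⊗ W₀) ≈⟨ drop-just (solve 5 (λ y z I J W → y :* z :* I :* (J :* W) := (I :* J) :* (y :* (z :* W))) K.refl
                                     (just y) (just z) (just (J ⁻¹)) (just J) (just W₀)) ⟩
    (J ⁻¹ ⊗ J) ⊗ (y ⊗ (z ⊗ W₀)) ≈⟨ ≈-trans (⊗-cong (⊗-inverseˡ J) ≈-refl) (⊗-identityˡ _) ⟩
    y ⊗ (z ⊗ W₀) ∎
    where
    J = 1# ⊕ x ⁻¹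
    xx⁻¹ : ∀ t → x ⁻¹ ⊗ (x ⊗ t) ≈ t
    xx⁻¹ t = ≈-trans (≈-sym (⊗-assoc _ _ _)) (≈-trans (⊗-cong (⊗-inverseˡ x) ≈-refl) (⊗-identityˡ t))
    qw : (1# ⊕ q) ⊗ w₀ ≈ J ⊗ W₀
    qw = begin
      (1# ⊕ q) ⊗ w₀                     ≈⟨ proj₂ distrib w₀ 1# q ⟩
      1# ⊗ w₀ ⊕ q ⊗ w₀                  ≈⟨ ⊕-cong (≈-trans (⊗-identityˡ w₀) (≈-sym (xx⁻¹ w₀))) Q ⟩
      x ⁻¹ ⊗ (x ⊗ w₀) ⊕ x ⁻¹ ⊗ W₁       ≈⟨ drop-just (solve 3 (λ x′ a b → x′ :* a :+ x′ :* b := x′ :* (b :+ a)) K.refl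
                                            (just (x ⁻¹)) (just (x ⊗ w₀)) (just W₁)) ⟩
      x ⁻¹ ⊗ (W₁ ⊕ x ⊗ w₀)              ≈⟨ ⊗-cong ≈-refl (≈-sym R) ⟩
      x ⁻¹ ⊗ ((1# ⊕ x) ⊗ W₀)            ≈⟨ drop-just (solve 4 (λ e x x′ w → x′ :* ((e :+ x) :* w) := (x′ :* e :+ x′ :* x) :* w) K.refl
                                            (just 1#) (just x) (just (x ⁻¹)) (just W₀)) ⟩
      (x ⁻¹ ⊗ 1# ⊕ x ⁻¹ ⊗ x) ⊗ W₀       ≈⟨ ⊗-cong (≈-trans (⊕-cong (⊗-identityʳ _) (⊗-inverseˡ x)) (⊕-comm _ _)) ≈-refl ⟩
      J ⊗ W₀ ∎

module CycleReflection {c ℓ : Level} (P : Semifield c ℓ) {V : Set} (_≟_ : DecidableEquality V) where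
  open Seeds P _≟_ renaming (B to matrix; y to vars)
  open SemifieldIdentities P
  open CycleMutation P _≟_
  open Solver using (solve; _:*_; _:+_; _:=_)

  -- The window at the first lift of `e` not before `s`, hence one turn later when `e < s`.
  windowAt : Carrier → (ℕ → Carrier) → ℕ → ℕ → Carrier
  windowAt z W zero    e       = W e
  windowAt z W (suc s) zero    = z ⊗ W 0
  windowAt z W (suc s) (suc e) = windowAt z (W ∘ suc) s e

  windowAt-≤ : ∀ {z} W {s e} → s ≤ e → windowAt z W s e ≡ W e
  windowAt-≤ W z≤n       = ≡.refl
  windowAt-≤ W (s≤s s≤e) = windowAt-≤ (W ∘ suc) s≤e

  windowAt-> : ∀ {z} W {s e} → e < s → windowAt z W s e ≡ z ⊗ W e
  windowAt-> W {suc s} {zero}  _         = ≡.refl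
  windowAt-> W {suc s} {suc e} (s≤s e<s) = windowAt-> (W ∘ suc) e<s

  -- On the full circle W k is the sum of the window X k, …, X (k + n - 1), w₀ = z⁻¹ W n and p = X (-1).
  -- Mutating at the first vertex merges the two heights p and X 0 and leaves all windows unchanged.
  Heights : (z w₀ : Carrier) → ℕ → Carrier → (X W : ℕ → Carrier) → Set ℓ
  Heights z w₀ zero p X W =
    p ⊕ X 0 ≈ w₀ × X 0 ⊕ z ⊗ p ≈ W 0 × W 1 ≈ z ⊗ w₀
  Heights z w₀ (suc k) p X W =
    (p ⊕ X 0) ⊗ W 0 ≈ p ⊗ W 1 ⊕ X 0 ⊗ w₀ × Heights z w₀ k (p ⊕ X 0) (X ∘ suc) (W ∘ suc)

  Heights-last : ∀ {z w₀} k {p} X W → Heights z w₀ k p X W → W (suc k) ≈ z ⊗ w₀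
  Heights-last zero    X W (_ , _ , h) = h
  Heights-last (suc k) X W (_ , h)     = Heights-last k (X ∘ suc) (W ∘ suc) h

  record Slopes (k : ℕ) (a : ℕ → V) (y : V → Carrier) (z p : Carrier) (X : ℕ → Carrier) : Set ℓ where
    field
      first : y (a 0) ⊗ p ≈ X 0
      inner : ∀ i → i < k → y (a (suc i)) ⊗ X i ≈ X (suc i)
      last  : y (a (suc k)) ⊗ X k ≈ z ⊗ p

  -- For a vertex of the cycle the arc runs from its successor to its predecessor one turn later, so
  -- the window at its end carries an extra `z`, which this weight removes.
  Weight : Carrier → ℕ → (ℕ → V) → V → Carrier → Set ℓ
  Weight z m a v κ = (∃ λ i → i < m × v ≡ a i × κ ≈ z) ⊎ ((∀ i → i < m → v ≢ a i) × κ ≈ 1#)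

  record Reflected (z : Carrier) (k : ℕ) (a : ℕ → V) (W : ℕ → Carrier) (s s′ : YSeed) : Set (c ⊔ ℓ) where
    field
      matrix-fixed : ∀ i j → matrix s′ i j ≡ matrix s i j
      vars-scaled  : ∀ {v κ σ e} → Weight z (2 ℕ.+ k) a v κ → Arc (2 ℕ.+ k) (col (matrix s) a v) σ e →
                     vars s′ v ⊗ (κ ⊗ W σ) ≈ vars s v ⊗ windowAt z W σ e

  transp-fst : ∀ a b → transp a b a ≡ b
  transp-fst a b with a ≟ a
  ... | yes _  = ≡.refl
  ... | no a≢a = contradiction ≡.refl a≢a

  transp-snd : ∀ a b → transp a b b ≡ a
  transp-snd a b with b ≟ a | b ≟ b
  ... | yes b≡a | _      = b≡a
  ... | no _    | yes _  = ≡.refl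
  ... | no _    | no b≢b = contradiction ≡.refl b≢b

  transp-other : ∀ {a b i} → i ≢ a → i ≢ b → transp a b i ≡ i
  transp-other {a} {b} {i} i≢a i≢b with i ≟ a | i ≟ b
  ... | yes i≡a | _       = contradiction i≡a i≢a
  ... | no _    | yes i≡b = contradiction i≡b i≢b
  ... | no _    | no _    = ≡.refl

  module Twins (lab : ℕ → V) (s : YSeed) (C : Cycle 0 (matrix s) (lab ∘ suc)) where
    open Cycle C
    a₀ = lab 1
    a₁ = lab 2
    b  = matrix s
    s₁ = μ a₀ s
    s₂ = μ a₁ s₁
    b₁ = matrix s₁
    b₂ = matrix s₂
    t  = transp a₀ a₁

    a₁≢a₀ : a₁ ≢ a₀
    a₁≢a₀ e with injective 1 0 (s≤s (s≤s z≤n)) (s≤s z≤n) e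
    ... | ()

    a₀≢a₁ : a₀ ≢ a₁
    a₀≢a₁ = a₁≢a₀ ∘ ≡.sym

    opposite-arc : ∀ {v s e} → Arc 2 (col b (lab ∘ suc) v) s e → b a₁ v ≡ ℤ.- b a₀ v
    opposite-arc {v} {s} {e} A = ≡.trans (column A 1 (s≤s (s≤s z≤n)))
      (≡.trans (values s e (source A) (target A)) (≡.cong ℤ.-_ (≡.sym (column A 0 (s≤s z≤n)))))
      where
      values : ∀ s e → s < 2 → e < 2 → δ e 1 ℤ.- δ s 1 ≡ ℤ.- (δ e 0 ℤ.- δ s 0)
      values 0 0 _ _ = ≡.refl
      values 0 1 _ _ = ≡.refl
      values 1 0 _ _ = ≡.refl
      values 1 1 _ _ = ≡.refl
      values (suc (suc _)) _ (s≤s (s≤s ())) _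
      values _ (suc (suc _)) _ (s≤s (s≤s ()))

    -- On two vertices an arc is trivial or joins one to the other, so its two entries are negatives
    -- of each other.
    opposite : ∀ v → b a₁ v ≡ ℤ.- b a₀ v
    opposite v = opposite-arc (proj₂ (proj₂ (arcs v)))

    b₀₁ : b a₀ a₁ ≡ + 0
    b₀₁ = column last 0 (s≤s z≤n)

    b₁₀ : b a₁ a₀ ≡ + 0
    b₁₀ = column first 1 (s≤s (s≤s z≤n))

    b₁-a₁ : ∀ v → v ≢ a₀ → b₁ a₁ v ≡ b a₁ v
    b₁-a₁ v v≢ = ≡.trans (mutB-other b a₁≢a₀ v≢)
      (≡.trans (≡.cong (λ u → through (b a₁ v) u (b a₀ v)) b₁₀) (through-zeroˡ _ (b a₀ v)))

    b₁-a₁a₀ : b₁ a₁ a₀ ≡ + 0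
    b₁-a₁a₀ = ≡.trans (mutB-selfʳ a₀ b a₁) (≡.cong ℤ.-_ b₁₀)

    b₂-skew : SkewSymmetric b₂
    b₂-skew = mutB-skew a₁ (mutB-skew a₀ skew)

    b₂-a₁ : ∀ {v} → v ≢ a₀ → b₂ a₁ v ≡ b a₀ v
    b₂-a₁ {v} v≢ = ≡.trans (mutB-selfˡ a₁ b₁ v) (≡.trans (≡.cong ℤ.-_ (≡.trans (b₁-a₁ v v≢) (opposite v))) (ℤₚ.neg-involutive _))

    b₂-a₀ : ∀ {v} → v ≢ a₁ → b₂ a₀ v ≡ b a₁ v
    b₂-a₀ {v} v≢ = ≡.trans (mutB-other b₁ a₀≢a₁ v≢)
      (≡.trans (≡.cong (λ u → through (b₁ a₀ v) u (b₁ a₁ v)) (≡.trans (mutB-selfˡ a₀ b a₁) (≡.cong ℤ.-_ b₀₁)))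
      (≡.trans (through-zeroˡ _ (b₁ a₁ v)) (≡.trans (mutB-selfˡ a₀ b v) (≡.sym (opposite v)))))

    b₂-other : ∀ {i j} → i ≢ a₀ → i ≢ a₁ → j ≢ a₀ → j ≢ a₁ → b₂ i j ≡ b i j
    b₂-other {i} {j} i≢a₀ i≢a₁ j≢a₀ j≢a₁ = ≡.trans (mutB-other b₁ i≢a₁ j≢a₁)
      (≡.trans (≡.cong₂ (λ u v → through (b₁ i j) u v) b₁-i (≡.trans (b₁-a₁ j j≢a₀) (opposite j)))
      (≡.trans (≡.cong (λ u → through u (ℤ.- b i a₀) (ℤ.- b a₀ j)) (mutB-other b i≢a₀ j≢a₀))
               (through-neg (b i j) (b i a₀) (b a₀ j))))
      where
      b₁-i : b₁ i a₁ ≡ ℤ.- b i a₀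
      b₁-i = ≡.trans (mutB-skew a₀ skew i a₁)
        (≡.cong ℤ.-_ (≡.trans (b₁-a₁ i i≢a₀) (≡.trans (opposite i) (≡.sym (skew i a₀)))))

    swapped-rows : ∀ {i j} → j ≢ a₀ → j ≢ a₁ → Dec (i ≡ a₀) → Dec (i ≡ a₁) → b₂ (t i) j ≡ b i j
    swapped-rows {j = j} j≢a₀ j≢a₁ (yes ≡.refl) _ = ≡.trans (≡.cong (λ u → b₂ u j) (transp-fst a₀ a₁)) (b₂-a₁ j≢a₀)
    swapped-rows {j = j} j≢a₀ j≢a₁ (no _) (yes ≡.refl) = ≡.trans (≡.cong (λ u → b₂ u j) (transp-snd a₀ a₁)) (b₂-a₀ j≢a₁)
    swapped-rows {j = j} j≢a₀ j≢a₁ (no i≢a₀) (no i≢a₁) =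
      ≡.trans (≡.cong (λ u → b₂ u j) (transp-other i≢a₀ i≢a₁)) (b₂-other i≢a₀ i≢a₁ j≢a₀ j≢a₁)

    Twin : V → Set
    Twin i = i ≡ a₀ ⊎ i ≡ a₁

    b₂-a₁a₀ : b₂ a₁ a₀ ≡ + 0
    b₂-a₁a₀ = ≡.trans (mutB-selfˡ a₁ b₁ a₀) (≡.cong ℤ.-_ b₁-a₁a₀)

    diagonal : ∀ {b} → SkewSymmetric b → ∀ (i : V) → b i i ≡ + 0
    diagonal skew i = i≡-i⇒i≡0 (skew i i)

    twins : ∀ {i j} → Twin i → Twin j → b i j ≡ + 0
    twins (inj₁ ≡.refl) (inj₁ ≡.refl) = diagonal skew a₀
    twins (inj₁ ≡.refl) (inj₂ ≡.refl) = b₀₁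
    twins (inj₂ ≡.refl) (inj₁ ≡.refl) = b₁₀
    twins (inj₂ ≡.refl) (inj₂ ≡.refl) = diagonal skew a₁

    twins₂ : ∀ {i j} → Twin i → Twin j → b₂ i j ≡ + 0
    twins₂ (inj₁ ≡.refl) (inj₁ ≡.refl) = diagonal b₂-skew a₀
    twins₂ (inj₁ ≡.refl) (inj₂ ≡.refl) = ≡.trans (b₂-skew a₀ a₁) (≡.cong ℤ.-_ b₂-a₁a₀)
    twins₂ (inj₂ ≡.refl) (inj₁ ≡.refl) = b₂-a₁a₀
    twins₂ (inj₂ ≡.refl) (inj₂ ≡.refl) = diagonal b₂-skew a₁

    t-twin : ∀ {i} → Twin i → Twin (t i)
    t-twin (inj₁ ≡.refl) = inj₂ (transp-fst a₀ a₁)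
    t-twin (inj₂ ≡.refl) = inj₁ (transp-snd a₀ a₁)

    -- The twins are not joined. Away from them the arrows created at `a₁` cancel those created at
    -- `a₀` because the rows are opposite; reversing the arrows at both twins amounts to exchanging
    -- them, which the transposition undoes.
    matrix-fixed : ∀ i j → b₂ (t i) (t j) ≡ b i j
    matrix-fixed i j = by-cases (i ≟ a₀) (i ≟ a₁) (j ≟ a₀) (j ≟ a₁)
      where
      corner : Twin i → Twin j → b₂ (t i) (t j) ≡ b i j
      corner ti tj = ≡.trans (twins₂ (t-twin ti) (t-twin tj)) (≡.sym (twins ti tj))
      by-cases : Dec (i ≡ a₀) → Dec (i ≡ a₁) → Dec (j ≡ a₀) → Dec (j ≡ a₁) → b₂ (t i) (t j) ≡ b i j
      by-cases p q (no j≢a₀) (no j≢a₁) =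
        ≡.trans (≡.cong (b₂ (t i)) (transp-other j≢a₀ j≢a₁)) (swapped-rows j≢a₀ j≢a₁ p q)
      by-cases (no i≢a₀) (no i≢a₁) p q = ≡.trans (≡.cong (λ u → b₂ u (t j)) (transp-other i≢a₀ i≢a₁))
        (≡.trans (b₂-skew i (t j)) (≡.trans (≡.cong ℤ.-_ (swapped-rows i≢a₀ i≢a₁ p q)) (≡.sym (skew i j))))
      by-cases (yes p) _ (yes r) _ = corner (inj₁ p) (inj₁ r)
      by-cases (yes p) _ _ (yes r) = corner (inj₁ p) (inj₂ r)
      by-cases _ (yes p) (yes r) _ = corner (inj₂ p) (inj₁ r)
      by-cases _ (yes p) _ (yes r) = corner (inj₂ p) (inj₂ r)

    module _ {z w₀ p : Carrier} {X W : ℕ → Carrier}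
             (S : Slopes 0 (lab ∘ suc) (vars s) z p X) (H : Heights z w₀ 0 p X W) where
      open Slopes S using () renaming (first to slope₀; last to slope₁)
      h₀ = proj₁ H
      h₁ = proj₁ (proj₂ H)
      h₂ = proj₂ (proj₂ H)
      y = vars s
      x₀ = y a₀
      x₁ = y a₁
      y₁ = vars s₁
      y₂ = vars s₂

      y₁-a₁ : y₁ a₁ ≈ x₁
      y₁-a₁ = muty-0 b y a₁≢a₀ b₀₁

      x₀x₁ : x₀ ⊗ x₁ ≈ z
      x₀x₁ = ⊗-cancelʳ (p ⊗ X 0) (begin
        x₀ ⊗ x₁ ⊗ (p ⊗ X 0)   ≈⟨ drop-just (solve 4 (λ a b p x → a :* b :* (p :* x) := (a :* p) :* (b :* x)) K.refl
                                   (just x₀) (just x₁) (just p) (just (X 0))) ⟩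
        (x₀ ⊗ p) ⊗ (x₁ ⊗ X 0) ≈⟨ ⊗-cong slope₀ slope₁ ⟩
        X 0 ⊗ (z ⊗ p)         ≈⟨ drop-just (solve 3 (λ x z p → x :* (z :* p) := z :* (p :* x)) K.refl
                                   (just (X 0)) (just z) (just p)) ⟩
        z ⊗ (p ⊗ X 0) ∎)

      twin-scaled : ∀ {κ σ e v y′} → κ ≈ z → Arc 2 (col b (lab ∘ suc) v) σ e →
                    (∀ i → i < 2 → b (lab (suc i)) v ≡ + 0) → y′ ⊗ z ≈ y v →
                    y′ ⊗ (κ ⊗ W σ) ≈ y v ⊗ windowAt z W σ e
      twin-scaled {κ} {σ} {e} {v} {y′} κ≈z A b≡0 y′z with Arc-zero b≡0 A
      ... | ≡.refl = begin
        y′ ⊗ (κ ⊗ W σ) ≈⟨ ⊗-cong ≈-refl (⊗-cong κ≈z ≈-refl) ⟩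
        y′ ⊗ (z ⊗ W σ) ≈⟨ ⊗-assoc _ _ _ ⟨
        y′ ⊗ z ⊗ W σ   ≈⟨ ⊗-cong y′z (≈-reflexive (≡.sym (windowAt-≤ W ℕₚ.≤-refl))) ⟩
        y v ⊗ windowAt z W σ σ ∎

      rotate : ∀ u v {w} → u ⊗ v ≈ w → u ⁻¹ ⊗ w ≈ v
      rotate u v {w} e = begin
        u ⁻¹ ⊗ w       ≈⟨ ⊗-cong ≈-refl e ⟨
        u ⁻¹ ⊗ (u ⊗ v) ≈⟨ ⊗-assoc _ _ _ ⟨
        u ⁻¹ ⊗ u ⊗ v   ≈⟨ ⊗-cong (⊗-inverseˡ u) ≈-refl ⟩
        1# ⊗ v         ≈⟨ ⊗-identityˡ v ⟩
        v ∎

      sum-scale : ∀ {x u v} → x ⊗ u ≈ v → (1# ⊕ x) ⊗ u ≈ u ⊕ v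
      sum-scale {x} {u} {v} e = ≈-trans (proj₂ distrib u 1# x) (⊕-cong (⊗-identityˡ u) e)

      inv-scale : ∀ {x u v} → x ⊗ u ≈ v → (1# ⊕ x ⁻¹) ⊗ v ≈ v ⊕ u
      inv-scale {x} {u} {v} e = ≈-trans (proj₂ distrib v 1# (x ⁻¹)) (⊕-cong (⊗-identityˡ v) (rotate x u e))

      y₂-other : ∀ {v} → v ≢ a₀ → v ≢ a₁ → ∀ {σ e} → Arc 2 (col b (lab ∘ suc) v) σ e →
                 y₂ v ⊗ W σ ≈ y v ⊗ windowAt z W σ e
      y₂-other {v} v≢a₀ v≢a₁ {σ} {e} A = by-arc σ e (source A) (target A) (column A 0 (s≤s z≤n))
          (≡.trans (b₁-a₁ v v≢a₀) (column A 1 (s≤s (s≤s z≤n))))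
        where
        by-arc : ∀ σ e → σ < 2 → e < 2 → b a₀ v ≡ δ e 0 ℤ.- δ σ 0 → b₁ a₁ v ≡ δ e 1 ℤ.- δ σ 1 →
                 y₂ v ⊗ W σ ≈ y v ⊗ windowAt z W σ e
        by-arc 0 0 _ _ e₀ e₁ = ⊗-cong (≈-trans (muty-0 b₁ y₁ v≢a₁ e₁) (muty-0 b y v≢a₀ e₀)) ≈-refl
        by-arc 1 1 _ _ e₀ e₁ = ⊗-cong (≈-trans (muty-0 b₁ y₁ v≢a₁ e₁) (muty-0 b y v≢a₀ e₀)) ≈-refl
        -- The factor is `(1 + x₀) / (1 + x₁⁻¹)`, where `(1 + x₀) p = w₀` and
        -- `(1 + x₁⁻¹) z p = W 0`; so it equals `z w₀ / W 0 = W 1 / W 0`.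
        by-arc 0 1 _ _ e₀ e₁ = ⊗-cancelʳ p (begin
          y₂ v ⊗ W 0 ⊗ p
            ≈⟨ ⊗-cong (⊗-cong (≈-trans (muty-pos b₁ y₁ v≢a₁ e₁) (⊗-cong (muty-neg b y v≢a₀ e₀)
                 (⊗-inv-cong (⊕-cong ≈-refl (⊗-inv-cong y₁-a₁))))) (≈-sym h₁)) ≈-refl ⟩
          y v ⊗ (1# ⊕ x₀) ⊗ J ⁻¹ ⊗ (X 0 ⊕ z ⊗ p) ⊗ p
            ≈⟨ ⊗-cong (⊗-cong ≈-refl (≈-trans (⊕-comm _ _) (≈-sym (inv-scale slope₁)))) ≈-refl ⟩
          y v ⊗ (1# ⊕ x₀) ⊗ J ⁻¹ ⊗ (J ⊗ (z ⊗ p)) ⊗ p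
            ≈⟨ drop-just (solve 6 (λ y t I J z p → y :* t :* I :* (J :* (z :* p)) :* p := (I :* J) :* (y :* (z :* (t :* p)) :* p)) K.refl
                 (just (y v)) (just (1# ⊕ x₀)) (just (J ⁻¹)) (just J) (just z) (just p)) ⟩
          J ⁻¹ ⊗ J ⊗ (y v ⊗ (z ⊗ ((1# ⊕ x₀) ⊗ p)) ⊗ p)
            ≈⟨ ≈-trans (⊗-cong (⊗-inverseˡ J) ≈-refl) (⊗-identityˡ _) ⟩
          y v ⊗ (z ⊗ ((1# ⊕ x₀) ⊗ p)) ⊗ p
            ≈⟨ ⊗-cong (⊗-cong ≈-refl (≈-trans (⊗-cong ≈-refl (≈-trans (sum-scale slope₀) h₀)) (≈-sym h₂))) ≈-refl ⟩
          y v ⊗ W 1 ⊗ p ∎)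
          where J = 1# ⊕ x₁ ⁻¹
        by-arc 1 0 _ _ e₀ e₁ = begin
          y₂ v ⊗ W 1
            ≈⟨ ⊗-cong (≈-trans (muty-neg b₁ y₁ v≢a₁ e₁) (⊗-cong (muty-pos b y v≢a₀ e₀) (⊕-cong ≈-refl y₁-a₁)))
                 (≈-trans h₂ (⊗-cong ≈-refl (≈-trans (≈-sym h₀) (≈-trans (⊕-comm _ _) (≈-sym (inv-scale slope₀)))))) ⟩
          y v ⊗ J ⁻¹ ⊗ (1# ⊕ x₁) ⊗ (z ⊗ (J ⊗ X 0))
            ≈⟨ drop-just (solve 6 (λ y I t z J x → y :* I :* t :* (z :* (J :* x)) := (I :* J) :* (y :* (z :* (t :* x)))) K.refl
                 (just (y v)) (just (J ⁻¹)) (just (1# ⊕ x₁)) (just z) (just J) (just (X 0))) ⟩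
          J ⁻¹ ⊗ J ⊗ (y v ⊗ (z ⊗ ((1# ⊕ x₁) ⊗ X 0)))
            ≈⟨ ≈-trans (⊗-cong (⊗-inverseˡ J) ≈-refl) (⊗-identityˡ _) ⟩
          y v ⊗ (z ⊗ ((1# ⊕ x₁) ⊗ X 0))
            ≈⟨ ⊗-cong ≈-refl (⊗-cong ≈-refl (≈-trans (sum-scale slope₁) h₁)) ⟩
          y v ⊗ (z ⊗ W 0) ∎
          where J = 1# ⊕ x₀ ⁻¹
        by-arc (suc (suc _)) _ (s≤s (s≤s ())) _
        by-arc _ (suc (suc _)) _ (s≤s (s≤s ()))

      zero-column : ∀ {v} → Twin v → ∀ i → i < 2 → b (lab (suc i)) v ≡ + 0
      zero-column tv 0 _ = twins (inj₁ ≡.refl) tv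
      zero-column tv 1 _ = twins (inj₂ ≡.refl) tv
      zero-column tv (suc (suc _)) (s≤s (s≤s ()))

      vars-scaled : ∀ {v κ σ e} → Weight z 2 (lab ∘ suc) v κ → Arc 2 (col b (lab ∘ suc) v) σ e →
                    y₂ (t v) ⊗ (κ ⊗ W σ) ≈ y v ⊗ windowAt z W σ e
      -- The transposition gives `a₀` the value `x₁⁻¹`, which is `x₀ / z` because `x₀ x₁ = z`.
      vars-scaled (inj₁ (0 , _ , ≡.refl , κ≈z)) A = twin-scaled κ≈z A (zero-column (inj₁ ≡.refl)) (begin
        y₂ (t a₀) ⊗ z    ≡⟨ ≡.cong (λ u → y₂ u ⊗ z) (transp-fst a₀ a₁) ⟩
        y₂ a₁ ⊗ z        ≈⟨ ⊗-cong (≈-trans (≈-reflexive (muty-self a₁ b₁ y₁)) (⊗-inv-cong y₁-a₁)) ≈-refl ⟩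
        x₁ ⁻¹ ⊗ z        ≈⟨ rotate x₁ x₀ (≈-trans (⊗-comm _ _) x₀x₁) ⟩
        x₀ ∎)
      vars-scaled (inj₁ (1 , _ , ≡.refl , κ≈z)) A = twin-scaled κ≈z A (zero-column (inj₂ ≡.refl)) (begin
        y₂ (t a₁) ⊗ z    ≡⟨ ≡.cong (λ u → y₂ u ⊗ z) (transp-snd a₀ a₁) ⟩
        y₂ a₀ ⊗ z        ≈⟨ ⊗-cong (≈-trans (muty-0 b₁ y₁ a₀≢a₁ b₁-a₁a₀) (≈-reflexive (muty-self a₀ b y))) ≈-refl ⟩
        x₀ ⁻¹ ⊗ z        ≈⟨ rotate x₀ x₁ x₀x₁ ⟩
        x₁ ∎)
      vars-scaled (inj₁ (suc (suc _) , s≤s (s≤s ()) , _)) A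
      vars-scaled {v} {κ} {σ} {e} (inj₂ (v≢ , κ≈1)) A = begin
        y₂ (t v) ⊗ (κ ⊗ W σ) ≈⟨ ⊗-cong (≈-reflexive (≡.cong y₂ (transp-other v≢a₀ v≢a₁))) (≈-trans (⊗-cong κ≈1 ≈-refl) (⊗-identityˡ _)) ⟩
        y₂ v ⊗ W σ           ≈⟨ y₂-other v≢a₀ v≢a₁ A ⟩
        y v ⊗ windowAt z W σ e ∎
        where
        v≢a₀ = v≢ 0 (s≤s z≤n)
        v≢a₁ = v≢ 1 (s≤s (s≤s z≤n))

      reflected : Reflected z 0 (lab ∘ suc) W s (run (τ 2 lab) s)
      reflected = record { matrix-fixed = matrix-fixed ; vars-scaled = vars-scaled }

  module Inductive {k : ℕ} (lab : ℕ → V) (s s₂ : YSeed) (C : Cycle (suc k) (matrix s) (lab ∘ suc))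
              {z w₀ p : Carrier} {X W : ℕ → Carrier}
              (S : Slopes (suc k) (lab ∘ suc) (vars s) z p X) (H : Heights z w₀ (suc k) p X W)
              (R : Reflected z k (lab ∘ suc ∘ suc) (W ∘ suc) (μ (lab 1) s) s₂) where
    a : ℕ → V
    a = lab ∘ suc
    a₀ = lab 1
    open Cycle C
    open Slopes S renaming (first to slope₀; inner to slopes; last to slopeₙ)
    open Reflected R renaming (matrix-fixed to matrix-fixed′; vars-scaled to vars-scaled′)
    b = matrix s
    y = vars s
    s₁ = μ a₀ s
    b₁ = matrix s₁
    y₁ = vars s₁
    y₂ = vars s₂
    s₃ = μ a₀ s₂
    x = y a₀
    q = y₂ a₀

    matrix-fixed : ∀ i j → matrix s₃ i j ≡ matrix s i j
    matrix-fixed i j = ≡.trans (mutB-cong a₀ matrix-fixed′ i j) (mutB-involutive a₀ b i j)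

    Wₙ : W (2 ℕ.+ k) ≈ z ⊗ w₀
    Wₙ = Heights-last k (X ∘ suc) (W ∘ suc) (proj₂ H)

    -- The induction hypothesis applied to the head itself, which the first mutation has turned into
    -- a vertex off the shorter cycle.
    q-scaled : q ⊗ w₀ ≈ x ⁻¹ ⊗ W 1
    q-scaled = ⊗-cancelʳ z (begin
      q ⊗ w₀ ⊗ z          ≈⟨ ≈-trans (⊗-assoc _ _ _) (⊗-cong ≈-refl (⊗-comm _ _)) ⟩
      q ⊗ (z ⊗ w₀)        ≈⟨ ⊗-cong ≈-refl (≈-trans (⊗-identityˡ _) Wₙ) ⟨
      q ⊗ (1# ⊗ W (2 ℕ.+ k)) ≈⟨ vars-scaled′ (inj₂ ((λ i i<m e → head≢ C i i<m (≡.sym e)) , ≈-refl)) (head-Arc C) ⟩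
      y₁ a₀ ⊗ (z ⊗ W 1)   ≈⟨ ⊗-cong (≈-reflexive (muty-self a₀ b y)) (⊗-comm _ _) ⟩
      x ⁻¹ ⊗ (W 1 ⊗ z)    ≈⟨ ⊗-assoc _ _ _ ⟨
      x ⁻¹ ⊗ W 1 ⊗ z ∎)

    exchanged : (1# ⊕ x) ⊗ W 0 ≈ W 1 ⊕ x ⊗ w₀
    exchanged = ⊗-cancelʳ p (begin
      (1# ⊕ x) ⊗ W 0 ⊗ p        ≈⟨ drop-just (solve 4 (λ e x w p → (e :+ x) :* w :* p := (e :* p :+ x :* p) :* w) K.refl
                                     (just 1#) (just x) (just (W 0)) (just p)) ⟩
      (1# ⊗ p ⊕ x ⊗ p) ⊗ W 0    ≈⟨ ⊗-cong (⊕-cong (⊗-identityˡ p) slope₀) ≈-refl ⟩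
      (p ⊕ X 0) ⊗ W 0           ≈⟨ proj₁ H ⟩
      p ⊗ W 1 ⊕ X 0 ⊗ w₀        ≈⟨ ⊕-cong ≈-refl (⊗-cong (≈-sym slope₀) ≈-refl) ⟩
      p ⊗ W 1 ⊕ x ⊗ p ⊗ w₀      ≈⟨ drop-just (solve 4 (λ p v x w → p :* v :+ x :* p :* w := (v :+ x :* w) :* p) K.refl
                                     (just p) (just (W 1)) (just x) (just w₀)) ⟩
      (W 1 ⊕ x ⊗ w₀) ⊗ p ∎)

    b₁-head : ∀ v → b₁ a₀ v ≡ ℤ.- b a₀ v
    b₁-head v = mutB-selfˡ a₀ b v

    b₂-head : ∀ {v t} → b a₀ v ≡ t → matrix s₂ a₀ v ≡ ℤ.- t
    b₂-head {v} e = ≡.trans (matrix-fixed′ a₀ v) (≡.trans (b₁-head v) (≡.cong ℤ.-_ e))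

    cut-weight : ∀ {v κ} → v ≢ a₀ → Weight z (3 ℕ.+ k) a v κ → Weight z (2 ℕ.+ k) (a ∘ suc) v κ
    cut-weight v≢ (inj₁ (zero , _ , v≡ , _))        = contradiction v≡ v≢
    cut-weight v≢ (inj₁ (suc i , s≤s i<m , v≡ , e)) = inj₁ (i , i<m , v≡ , e)
    cut-weight v≢ (inj₂ (nonmember , e))            = inj₂ ((λ i i<m → nonmember (suc i) (s≤s i<m)) , e)

    other-scaled : ∀ {v κ} → v ≢ a₀ → Weight z (3 ℕ.+ k) a v κ → ∀ σ e → Arc (3 ℕ.+ k) (col b a v) σ e →
                   vars s₃ v ⊗ (κ ⊗ W σ) ≈ y v ⊗ windowAt z W σ e
    other-scaled {v} {κ} v≢ wt σ e A = by-arc σ e (column A 0 (s≤s z≤n)) A (vars-scaled′ (cut-weight v≢ wt) (cut-Arc C v≢ A))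
      where
      by-arc : ∀ σ e → b a₀ v ≡ δ e 0 ℤ.- δ σ 0 → Arc (3 ℕ.+ k) (col b a v) σ e →
               y₂ v ⊗ (κ ⊗ W (suc (proj₁ (cut k σ e)))) ≈ y₁ v ⊗ windowAt z (W ∘ suc) (proj₁ (cut k σ e)) (proj₂ (cut k σ e)) →
               vars s₃ v ⊗ (κ ⊗ W σ) ≈ y v ⊗ windowAt z W σ e
      -- `cut` represents a trivial arc at the head by one at its successor, so the induction
      -- hypothesis speaks of `W 1` instead of `W 0`; either window cancels.
      by-arc zero zero e₀ _ ih = ≈-trans (≈-sym (⊗-assoc _ _ _)) (⊗-cong (⊗-cancelʳ (W 1) (begin
        vars s₃ v ⊗ κ ⊗ W 1 ≈⟨ ⊗-cong (⊗-cong (muty-0 (matrix s₂) y₂ v≢ (b₂-head e₀)) ≈-refl) ≈-refl ⟩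
        y₂ v ⊗ κ ⊗ W 1      ≈⟨ ⊗-assoc _ _ _ ⟩
        y₂ v ⊗ (κ ⊗ W 1)    ≈⟨ ≈-trans ih (⊗-cong (muty-0 b y v≢ e₀) ≈-refl) ⟩
        y v ⊗ W 1 ∎)) ≈-refl)
      by-arc zero (suc e) e₀ _ ih =
        incoming exchanged q-scaled (muty-neg b y v≢ e₀) ih (muty-pos (matrix s₂) y₂ v≢ (b₂-head e₀))
      by-arc (suc σ) zero e₀ A′ ih =
        outgoing exchanged q-scaled (muty-pos b y v≢ e₀)
          (≈-trans ih (⊗-cong ≈-refl (≈-trans (≈-reflexive (windowAt-≤ (W ∘ suc) (ℕₚ.≤-pred (ℕₚ.≤-pred (source A′))))) Wₙ)))
          (muty-neg (matrix s₂) y₂ v≢ (b₂-head e₀))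
      by-arc (suc σ) (suc e) e₀ _ ih =
        ≈-trans (⊗-cong (muty-0 (matrix s₂) y₂ v≢ (b₂-head e₀)) ≈-refl)
          (≈-trans ih (⊗-cong (muty-0 b y v≢ e₀) ≈-refl))

    head-scaled : ∀ {κ σ e} → κ ≈ z → Arc (3 ℕ.+ k) (col b a a₀) σ e →
                  vars s₃ a₀ ⊗ (κ ⊗ W σ) ≈ x ⊗ windowAt z W σ e
    head-scaled {κ} κ≈z A with Arc-unique (λ ()) first A
    ... | ≡.refl , ≡.refl = begin
      vars s₃ a₀ ⊗ (κ ⊗ W 1) ≈⟨ ⊗-cong (≈-reflexive (muty-self a₀ (matrix s₂) y₂)) (⊗-cong κ≈z ≈-refl) ⟩
      q ⁻¹ ⊗ (z ⊗ W 1)       ≈⟨ ⊗-cancelʳ (x ⁻¹) (begin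
        q ⁻¹ ⊗ (z ⊗ W 1) ⊗ x ⁻¹   ≈⟨ drop-just (solve 4 (λ q z w x → q :* (z :* w) :* x := q :* (z :* (x :* w))) K.refl
                                       (just (q ⁻¹)) (just z) (just (W 1)) (just (x ⁻¹))) ⟩
        q ⁻¹ ⊗ (z ⊗ (x ⁻¹ ⊗ W 1)) ≈⟨ ⊗-cong ≈-refl (⊗-cong ≈-refl q-scaled) ⟨
        q ⁻¹ ⊗ (z ⊗ (q ⊗ w₀))     ≈⟨ drop-just (solve 4 (λ q′ z q w → q′ :* (z :* (q :* w)) := (q′ :* q) :* (z :* w)) K.refl
                                       (just (q ⁻¹)) (just z) (just q) (just w₀)) ⟩
        q ⁻¹ ⊗ q ⊗ (z ⊗ w₀)       ≈⟨ ⊗-cong (≈-trans (⊗-inverseˡ q) (≈-sym (⊗-inverseʳ x))) ≈-refl ⟩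
        x ⊗ x ⁻¹ ⊗ (z ⊗ w₀)       ≈⟨ drop-just (solve 4 (λ x x′ z w → x :* x′ :* (z :* w) := x :* (z :* w) :* x′) K.refl
                                       (just x) (just (x ⁻¹)) (just z) (just w₀)) ⟩
        x ⊗ (z ⊗ w₀) ⊗ x ⁻¹ ∎) ⟩
      x ⊗ (z ⊗ w₀)           ≈⟨ ⊗-cong ≈-refl Wₙ ⟨
      x ⊗ W (2 ℕ.+ k) ∎

    reflected : Reflected z (suc k) a W s s₃
    reflected = record { matrix-fixed = matrix-fixed ; vars-scaled = λ {v} wt A → by-cases (v ≟ a₀) wt A }
      where
      by-cases : ∀ {v κ σ e} → Dec (v ≡ a₀) → Weight z (3 ℕ.+ k) a v κ → Arc (3 ℕ.+ k) (col b a v) σ e →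
                 vars s₃ v ⊗ (κ ⊗ W σ) ≈ y v ⊗ windowAt z W σ e
      by-cases (yes ≡.refl) (inj₁ (_ , _ , _ , κ≈z)) A = head-scaled κ≈z A
      by-cases (yes ≡.refl) (inj₂ (nonmember , _))   A = contradiction ≡.refl (nonmember 0 (s≤s z≤n))
      by-cases (no v≢)      wt                       A = other-scaled v≢ wt _ _ A

  -- The merged height `p ⊕ X 0` is `1 + x⁻¹` times `X 0` and `1 + x` times `p`; these are exactly
  -- the exchange factors at the successor and at the predecessor of the head.
  cut-Slopes : ∀ {k a b y z p X} → Cycle (suc k) b a → Slopes (suc k) a y z p X →
               Slopes k (a ∘ suc) (muty (a 0) b y) z (p ⊕ X 0) (X ∘ suc)
  cut-Slopes {k} {a} {b} {y} {z} {p} {X} C S = record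
    { first = begin
        muty (a 0) b y (a 1) ⊗ (p ⊕ X 0)
          ≈⟨ ⊗-cong (muty-pos b y (head≢ C 0 (s≤s z≤n)) (column (inner 0 (s≤s z≤n)) 0 (s≤s z≤n))) merged ⟩
        y (a 1) ⊗ J ⁻¹ ⊗ (J ⊗ X 0)
          ≈⟨ drop-just (solve 4 (λ y I J x → y :* I :* (J :* x) := (I :* J) :* (y :* x)) K.refl
               (just (y (a 1))) (just (J ⁻¹)) (just J) (just (X 0))) ⟩
        J ⁻¹ ⊗ J ⊗ (y (a 1) ⊗ X 0)
          ≈⟨ ≈-trans (⊗-cong (⊗-inverseˡ J) ≈-refl) (⊗-identityˡ _) ⟩
        y (a 1) ⊗ X 0 ≈⟨ slopes 0 (s≤s z≤n) ⟩
        X 1 ∎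
    ; inner = λ i i<k → ≈-trans
        (⊗-cong (muty-0 b y (head≢ C (suc i) (s≤s (ℕₚ.m≤n⇒m≤1+n i<k))) (column (inner (suc i) (s≤s i<k)) 0 (s≤s z≤n))) ≈-refl)
        (slopes (suc i) (s≤s i<k))
    ; last = begin
        muty (a 0) b y (a (2 ℕ.+ k)) ⊗ X (suc k)
          ≈⟨ ⊗-cong (muty-neg b y (head≢ C (suc k) ℕₚ.≤-refl) (column last 0 (s≤s z≤n))) ≈-refl ⟩
        y (a (2 ℕ.+ k)) ⊗ (1# ⊕ x) ⊗ X (suc k)
          ≈⟨ drop-just (solve 3 (λ y t u → y :* t :* u := y :* u :* t) K.refl
               (just (y (a (2 ℕ.+ k)))) (just (1# ⊕ x)) (just (X (suc k)))) ⟩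
        y (a (2 ℕ.+ k)) ⊗ X (suc k) ⊗ (1# ⊕ x)
          ≈⟨ ⊗-cong slopeₙ ≈-refl ⟩
        z ⊗ p ⊗ (1# ⊕ x)
          ≈⟨ drop-just (solve 4 (λ z p e x → z :* p :* (e :+ x) := z :* (p :* e :+ x :* p)) K.refl
               (just z) (just p) (just 1#) (just x)) ⟩
        z ⊗ (p ⊗ 1# ⊕ x ⊗ p)
          ≈⟨ ⊗-cong ≈-refl (⊕-cong (⊗-identityʳ p) slope₀) ⟩
        z ⊗ (p ⊕ X 0) ∎
    }
    where
    open Cycle C
    open Slopes S renaming (first to slope₀; inner to slopes; last to slopeₙ)
    x = y (a 0)
    J = 1# ⊕ x ⁻¹
    merged : p ⊕ X 0 ≈ J ⊗ X 0
    merged = begin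
      p ⊕ X 0                ≈⟨ ⊕-cong (begin
        p                      ≈⟨ ⊗-identityˡ p ⟨
        1# ⊗ p                 ≈⟨ ⊗-cong (⊗-inverseˡ x) ≈-refl ⟨
        x ⁻¹ ⊗ x ⊗ p           ≈⟨ ⊗-assoc _ _ _ ⟩
        x ⁻¹ ⊗ (x ⊗ p)         ≈⟨ ⊗-cong ≈-refl slope₀ ⟩
        x ⁻¹ ⊗ X 0 ∎) (≈-sym (⊗-identityˡ _)) ⟩
      x ⁻¹ ⊗ X 0 ⊕ 1# ⊗ X 0  ≈⟨ ⊕-comm _ _ ⟩
      1# ⊗ X 0 ⊕ x ⁻¹ ⊗ X 0  ≈⟨ proj₂ distrib (X 0) 1# (x ⁻¹) ⟨
      J ⊗ X 0 ∎

  -- τ is the conjugate by the mutation μ at the first vertex of the τ of the cycle without that vertex, which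
  -- is a cycle of the quiver mutated by μ.
  τ-reflects : ∀ k lab s {z w₀ p X W} → Cycle k (matrix s) (lab ∘ suc) →
               Slopes k (lab ∘ suc) (vars s) z p X → Heights z w₀ k p X W →
               Reflected z k (lab ∘ suc) W s (run (τ (2 ℕ.+ k) lab) s)
  τ-reflects zero    lab s C S H = Twins.reflected lab s C S H
  τ-reflects (suc k) lab s {z} {W = W} C S H = ≡.subst (Reflected z (suc k) (lab ∘ suc) W s)
    (≡.sym (≡.trans (≡.cong (λ ss → run ss s) (τ-suc k lab)) (run-++ (τ (2 ℕ.+ k) (lab ∘ suc)) _ (μ (lab 1) s))))
    (Inductive.reflected lab s _ C S H (τ-reflects k (lab ∘ suc) (μ (lab 1) s) (cut-Cycle C) (cut-Slopes C S) (proj₂ H)))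

-- Rotations of a finite circle

module _ {n : ℕ} .{{_ : NonZero n}} where

  toℕ-rot : ∀ (i : Fin n) d → toℕ (rot i d) ≡ (toℕ i ℕ.+ d) % n
  toℕ-rot = go n
    where
    go : ∀ n .{{_ : NonZero n}} (i : Fin n) d → toℕ (rot i d) ≡ (toℕ i ℕ.+ d) % n
    go (suc n) i d = Finₚ.toℕ-fromℕ< _

  rot-≡ : ∀ (i j : Fin n) {d e} → (toℕ i ℕ.+ d) % n ≡ (toℕ j ℕ.+ e) % n → rot i d ≡ rot j e
  rot-≡ i j eq = Finₚ.toℕ-injective (≡.trans (toℕ-rot i _) (≡.trans eq (≡.sym (toℕ-rot j _))))

  rot-rot : ∀ (i : Fin n) d e → rot (rot i d) e ≡ rot i (d ℕ.+ e)
  rot-rot i d e = rot-≡ (rot i d) i (begin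
    (toℕ (rot i d) ℕ.+ e) % n        ≡⟨ ≡.cong (λ t → (t ℕ.+ e) % n) (toℕ-rot i d) ⟩
    ((toℕ i ℕ.+ d) % n ℕ.+ e) % n    ≡⟨ DivMod.%-distribˡ-+ ((toℕ i ℕ.+ d) % n) e n ⟩
    ((toℕ i ℕ.+ d) % n % n ℕ.+ e % n) % n
      ≡⟨ ≡.cong (λ t → (t ℕ.+ e % n) % n) (DivMod.m%n%n≡m%n (toℕ i ℕ.+ d) n) ⟩
    ((toℕ i ℕ.+ d) % n ℕ.+ e % n) % n ≡⟨ DivMod.%-distribˡ-+ (toℕ i ℕ.+ d) e n ⟨
    (toℕ i ℕ.+ d ℕ.+ e) % n          ≡⟨ ≡.cong (_% n) (ℕₚ.+-assoc (toℕ i) d e) ⟩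
    (toℕ i ℕ.+ (d ℕ.+ e)) % n ∎)
    where open ≡.≡-Reasoning

  rot-0 : ∀ (i : Fin n) → rot i 0 ≡ i
  rot-0 i = Finₚ.toℕ-injective (≡.trans (toℕ-rot i 0)
    (≡.trans (≡.cong (_% n) (ℕₚ.+-identityʳ (toℕ i))) (DivMod.m<n⇒m%n≡m (Finₚ.toℕ<n i))))

  rot-+* : ∀ (i : Fin n) d k → rot i (d ℕ.+ k ℕ.* n) ≡ rot i d
  rot-+* i d k = rot-≡ i i (≡.trans (≡.cong (_% n) (≡.sym (ℕₚ.+-assoc (toℕ i) d (k ℕ.* n))))
    (DivMod.[m+kn]%n≡m%n (toℕ i ℕ.+ d) k n))

  rot-+ : ∀ (i : Fin n) d → rot i (d ℕ.+ n) ≡ rot i d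
  rot-+ i d = ≡.trans (≡.cong (λ t → rot i (d ℕ.+ t)) (≡.sym (ℕₚ.*-identityˡ n))) (rot-+* i d 1)

  -- A further rotation by `d * n ∸ d` completes `d` full turns.
  rot-injective : ∀ {i j : Fin n} d → rot i d ≡ rot j d → i ≡ j
  rot-injective {i} {j} d eq = ≡.trans (≡.sym (undo i)) (≡.trans (≡.cong (λ t → rot t (d ℕ.* n ℕ.∸ d)) eq) (undo j))
    where
    undo : ∀ i → rot (rot i d) (d ℕ.* n ℕ.∸ d) ≡ i
    undo i = ≡.trans (rot-rot i d _) (≡.trans (≡.cong (rot i) (ℕₚ.m+[n∸m]≡n (ℕₚ.m≤m*n d n))) (≡.trans (rot-+* i 0 d) (rot-0 i)))

  -- Congruence without subtraction: each side is supplemented by the quotient of the other, so both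
  -- become the common residue plus the same multiples of `n`.
  rot-≡⇒ : ∀ (i j : Fin n) {d e} → rot i d ≡ rot j e →
           ∃₂ λ a b → toℕ i ℕ.+ d ℕ.+ a ℕ.* n ≡ toℕ j ℕ.+ e ℕ.+ b ℕ.* n
  rot-≡⇒ i j {d} {e} eq = y / n , x / n , (begin
    x ℕ.+ y / n ℕ.* n                       ≡⟨ ≡.cong (ℕ._+ y / n ℕ.* n) (DivMod.m≡m%n+[m/n]*n x n) ⟩
    x % n ℕ.+ x / n ℕ.* n ℕ.+ y / n ℕ.* n   ≡⟨ ≡.cong (λ t → t ℕ.+ x / n ℕ.* n ℕ.+ y / n ℕ.* n)
                                                 (≡.trans (≡.sym (toℕ-rot i d)) (≡.trans (≡.cong toℕ eq) (toℕ-rot j e))) ⟩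
    y % n ℕ.+ x / n ℕ.* n ℕ.+ y / n ℕ.* n   ≡⟨ ℕₚ.+-assoc (y % n) _ _ ⟩
    y % n ℕ.+ (x / n ℕ.* n ℕ.+ y / n ℕ.* n) ≡⟨ ≡.cong (y % n ℕ.+_) (ℕₚ.+-comm (x / n ℕ.* n) _) ⟩
    y % n ℕ.+ (y / n ℕ.* n ℕ.+ x / n ℕ.* n) ≡⟨ ℕₚ.+-assoc (y % n) _ _ ⟨
    y % n ℕ.+ y / n ℕ.* n ℕ.+ x / n ℕ.* n   ≡⟨ ≡.cong (ℕ._+ x / n ℕ.* n) (DivMod.m≡m%n+[m/n]*n y n) ⟨
    y ℕ.+ x / n ℕ.* n ∎)
    where
    open ≡.≡-Reasoning
    x = toℕ i ℕ.+ d
    y = toℕ j ℕ.+ e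

  rot-injectiveʳ : ∀ (i : Fin n) {d e} → d < n → e < n → rot i d ≡ rot i e → d ≡ e
  rot-injectiveʳ i {d} {e} d<n e<n eq with a , b , eq′ ← rot-≡⇒ i i eq = begin
    d                   ≡⟨ DivMod.m<n⇒m%n≡m d<n ⟨
    d % n               ≡⟨ DivMod.[m+kn]%n≡m%n d a n ⟨
    (d ℕ.+ a ℕ.* n) % n ≡⟨ ≡.cong (_% n) (ℕₚ.+-cancelˡ-≡ (toℕ i) _ _ (≡.trans (≡.sym (ℕₚ.+-assoc (toℕ i) d _))
                             (≡.trans eq′ (ℕₚ.+-assoc (toℕ i) e _)))) ⟩
    (e ℕ.+ b ℕ.* n) % n ≡⟨ DivMod.[m+kn]%n≡m%n e b n ⟩
    e % n               ≡⟨ DivMod.m<n⇒m%n≡m e<n ⟩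
    e ∎
    where open ≡.≡-Reasoning

  rot-pred : ∀ (i : Fin n) → rot i (1 ℕ.+ ℕ.pred n) ≡ i
  rot-pred i = ≡.trans (≡.cong (rot i) (ℕₚ.suc-pred n)) (≡.trans (rot-+ i 0) (rot-0 i))

  prev-≡ : ∀ (i : Fin n) → prev i ≡ rot i (ℕ.pred n)
  prev-≡ = go n
    where
    go : ∀ n .{{_ : NonZero n}} (i : Fin n) → prev i ≡ rot i (ℕ.pred n)
    go (suc n) i = ≡.refl

  prev-rot : ∀ (i : Fin n) → prev (rot i 1) ≡ i
  prev-rot i = ≡.trans (prev-≡ (rot i 1)) (≡.trans (rot-rot i 1 (ℕ.pred n)) (rot-pred i))

  rot-prev : ∀ (i : Fin n) → rot (prev i) 1 ≡ i
  rot-prev i = rot-injective (ℕ.pred n) (≡.trans (rot-rot (prev i) 1 _) (≡.trans (rot-pred (prev i)) (prev-≡ i)))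

-- Counting the arrows of a spider web

indicator : ∀ {p} {A : Set p} → Dec A → ℕ
indicator d = if does d then 1 else 0

indicator-⇔ : ∀ {p q} {A : Set p} {B : Set q} (a? : Dec A) (b? : Dec B) → (A → B) → (B → A) → indicator a? ≡ indicator b?
indicator-⇔ (yes a) (yes b) _ _ = ≡.refl
indicator-⇔ (yes a) (no ¬b) f _ = contradiction (f a) ¬b
indicator-⇔ (no ¬a) (yes b) _ g = contradiction (g b) ¬a
indicator-⇔ (no ¬a) (no ¬b) _ _ = ≡.refl

indicator-no : ∀ {p} {A : Set p} (a? : Dec A) → ¬ A → indicator a? ≡ 0
indicator-no (yes a) ¬a = contradiction a ¬a
indicator-no (no _)  _  = ≡.refl

map-as-concatMap : ∀ {a b} {A : Set a} {B : Set b} (f : B → A) xs → map f xs ≡ concatMap (λ x → f x ∷ []) xs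
map-as-concatMap f []       = ≡.refl
map-as-concatMap f (x ∷ xs) = ≡.cong (f x ∷_) (map-as-concatMap f xs)

module Counting {a p : Level} {A : Set a} {P : Pred A p} (P? : Decidable P) where

  count : List A → ℕ
  count xs = length (filter P? xs)

  count-∷ : ∀ x xs → count (x ∷ xs) ≡ indicator (P? x) ℕ.+ count xs
  count-∷ x xs with P? x
  ... | yes _ = ≡.refl
  ... | no _  = ≡.refl

  count-++ : ∀ xs ys → count (xs ++ ys) ≡ count xs ℕ.+ count ys
  count-++ xs ys = ≡.trans (≡.cong length (Listₚ.filter-++ P? xs ys)) (Listₚ.length-++ (filter P? xs))

  count-concatMap-0 : ∀ {b} {B : Set b} (f : B → List A) {n} (g : Fin n → B) →
                      (∀ i → count (f (g i)) ≡ 0) → count (concatMap f (tabulate g)) ≡ 0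
  count-concatMap-0 f {zero}  g h = ≡.refl
  count-concatMap-0 f {suc n} g h = ≡.trans (count-++ (f (g Fin.zero)) _)
    (≡.cong₂ ℕ._+_ (h Fin.zero) (count-concatMap-0 f (g ∘ Fin.suc) (h ∘ Fin.suc)))

  -- Localises a multiplicity to the single circle, annulus or breakpoint whose arrows can match.
  count-concatMap : ∀ {b} {B : Set b} (f : B → List A) {n} (g : Fin n → B) x →
                    (∀ i → i ≢ x → count (f (g i)) ≡ 0) → count (concatMap f (tabulate g)) ≡ count (f (g x))
  count-concatMap f {suc n} g Fin.zero h = ≡.trans (count-++ (f (g Fin.zero)) _)
    (≡.trans (≡.cong (count (f (g Fin.zero)) ℕ.+_) (count-concatMap-0 f (g ∘ Fin.suc) λ i → h (Fin.suc i) λ ())) (ℕₚ.+-identityʳ _))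
  count-concatMap f {suc n} g (Fin.suc x) h = ≡.trans (count-++ (f (g Fin.zero)) _)
    (≡.cong₂ ℕ._+_ (h Fin.zero λ ()) (count-concatMap f (g ∘ Fin.suc) x λ i i≢x → h (Fin.suc i) (i≢x ∘ Finₚ.suc-injective)))

δᶠ : ∀ {n} → Fin n → Fin n → ℤ
δᶠ e i = + indicator (e Finₚ.≟ i)

module Columns (W : SpiderWeb) where
  open SpiderWeb W

  instance
    n-nonZero : ∀ {c} → NonZero (n c)
    n-nonZero {c} = ℕ.>-nonZero (ℕₚ.≤-trans (s≤s z≤n) (n≥2 c))

    k-nonZero : ∀ {a} → NonZero (k a)
    k-nonZero {a} = ℕ.>-nonZero (ℕₚ.≤-trans (s≤s z≤n) (k≥2 a))

  -- The counterpart of `Arc` for positions on the circle itself, independent of where a labelling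
  -- starts.
  ColumnArc : (c : Circle) → Vertex → Fin (n c) → Fin (n c) → Set
  ColumnArc c v s e = ∀ i → B (c , i) v ≡ δᶠ e i ℤ.- δᶠ s i

  Q : ∀ a → Fin (k a) → Fin (n (Fin.suc a))
  Q a j = q a (rot j (toℕ (r a)))

  increasing-injective : ∀ {k n} (f : Fin k → Fin n) → (∀ {i j} → i Fin.< j → f i Fin.< f j) → ∀ {i j} → f i ≡ f j → i ≡ j
  increasing-injective f f-mono {i} {j} eq with Finₚ.<-cmp i j
  ... | tri< i<j _ _ = contradiction eq (Finₚ.<⇒≢ (f-mono i<j))
  ... | tri≈ _ i≡j _ = i≡j
  ... | tri> _ _ j<i = contradiction (≡.sym eq) (Finₚ.<⇒≢ (f-mono j<i))

  p-injective : ∀ a {i j} → p a i ≡ p a j → i ≡ j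
  p-injective a = increasing-injective (p a) (p-increasing a)

  Q-injective : ∀ a {i j} → Q a i ≡ Q a j → i ≡ j
  Q-injective a = rot-injective (toℕ (r a)) ∘ increasing-injective (q a) (q-increasing a)

  inject₁≢suc : ∀ {m} {a : Fin m} → inject₁ a ≢ Fin.suc a
  inject₁≢suc {a = a} eq = ℕₚ.1+n≢n (≡.trans (≡.sym (≡.cong toℕ eq)) (Finₚ.toℕ-inject₁ a))

  module _ (u v : Vertex) where
    open Counting (_≟E (u , v)) public using (count; count-∷; count-++; count-concatMap; count-concatMap-0)

  circleArrowsOf : Circle → List (Vertex × Vertex)
  circleArrowsOf c = map (λ i → (c , i) , (c , rot i 1)) (allFin (n c))

  circle-0 : ∀ u v {c} → c ≢ proj₁ u ⊎ c ≢ proj₁ v → count u v (circleArrowsOf c) ≡ 0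
  circle-0 u v {c} c≢ = ≡.trans (≡.cong (count u v) (map-as-concatMap _ (allFin (n c))))
    (count-concatMap-0 u v (λ i → arrow i ∷ []) (λ i → i) λ i → ≡.trans (count-∷ u v (arrow i) [])
      (≡.trans (ℕₚ.+-identityʳ _) (indicator-no (arrow i ≟E (u , v)) (apart c≢))))
    where
    arrow : Fin (n c) → Vertex × Vertex
    arrow i = (c , i) , (c , rot i 1)
    apart : ∀ {i} → c ≢ proj₁ u ⊎ c ≢ proj₁ v → arrow i ≢ (u , v)
    apart (inj₁ c≢u) e = c≢u (,-injectiveˡ (,-injectiveˡ e))
    apart (inj₂ c≢v) ≡.refl = c≢v ≡.refl

  circle-count : ∀ c i j → count (c , i) (c , j) (circleArrowsOf c) ≡ indicator (rot i 1 Finₚ.≟ j)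
  circle-count c i j = ≡.trans (≡.cong (count (c , i) (c , j)) (map-as-concatMap _ (allFin (n c))))
    (≡.trans (count-concatMap (c , i) (c , j) (λ i → arrow i ∷ []) (λ i → i) i λ i′ i′≢i → ≡.trans (count-∷ (c , i) (c , j) (arrow i′) [])
        (≡.trans (ℕₚ.+-identityʳ _) (indicator-no (arrow i′ ≟E ((c , i) , (c , j))) λ { ≡.refl → i′≢i ≡.refl })))
    (≡.trans (count-∷ (c , i) (c , j) (arrow i) []) (≡.trans (ℕₚ.+-identityʳ _)
      (indicator-⇔ (((c , i) , (c , rot i 1)) ≟E ((c , i) , (c , j))) (rot i 1 Finₚ.≟ j)
        (λ { ≡.refl → ≡.refl }) (λ { ≡.refl → ≡.refl })))))
    where
    arrow : Fin (n c) → Vertex × Vertex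
    arrow i = (c , i) , (c , rot i 1)

  inward outward : ∀ a → Fin (k a) → Vertex × Vertex
  inward  a j = (inject₁ a , p a j) , (Fin.suc a , Q a j)
  outward a j = (Fin.suc a , Q a j) , (inject₁ a , p a (prev j))

  block : ∀ a → Fin (k a) → List (Vertex × Vertex)
  block a j = inward a j ∷ outward a j ∷ []

  Apart : Vertex → Vertex → ∀ a → Fin (k a) → Set
  Apart u v a j = inward a j ≢ (u , v) × outward a j ≢ (u , v)

  block-count : ∀ u v a j → count u v (block a j) ≡ indicator (inward a j ≟E (u , v)) ℕ.+ indicator (outward a j ≟E (u , v))
  block-count u v a j = ≡.trans (count-∷ u v (inward a j) (outward a j ∷ []))
    (≡.cong (indicator (inward a j ≟E (u , v)) ℕ.+_) (≡.trans (count-∷ u v (outward a j) []) (ℕₚ.+-identityʳ _)))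

  block-0 : ∀ {u v} a j → Apart u v a j → count u v (block a j) ≡ 0
  block-0 {u} {v} a j (x , y) = ≡.trans (block-count u v a j)
    (≡.cong₂ ℕ._+_ (indicator-no (inward a j ≟E (u , v)) x) (indicator-no (outward a j ≟E (u , v)) y))

  annulus-0 : ∀ u v a → (∀ j → Apart u v a j) → count u v (annulusArrows a) ≡ 0
  annulus-0 u v a h = count-concatMap-0 u v (block a) (λ j → j) λ j → block-0 a j (h j)

  annulus-count : ∀ u v a j → (∀ j′ → j′ ≢ j → Apart u v a j′) →
    count u v (annulusArrows a) ≡ indicator (inward a j ≟E (u , v)) ℕ.+ indicator (outward a j ≟E (u , v))
  annulus-count u v a j h = ≡.trans
    (count-concatMap u v (block a) (λ j → j) j λ j′ j′≢j → block-0 a j′ (h j′ j′≢j)) (block-count u v a j)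

  Vertex-injective : ∀ {c i j} → _≡_ {A = Vertex} (c , i) (c , j) → i ≡ j
  Vertex-injective ≡.refl = ≡.refl

  inward-apart : ∀ {a j u l} → inward a j ≢ ((Fin.suc a , u) , (inject₁ a , l))
  inward-apart e = inject₁≢suc (,-injectiveˡ (,-injectiveˡ e))

  outward-apart : ∀ {a j u l} → outward a j ≢ ((inject₁ a , u) , (Fin.suc a , l))
  outward-apart e = inject₁≢suc (≡.sym (,-injectiveˡ (,-injectiveˡ e)))

  inward-count : ∀ a j i l → (∀ j′ → j′ ≢ j → inward a j′ ≢ ((inject₁ a , i) , (Fin.suc a , l))) →
    count (inject₁ a , i) (Fin.suc a , l) (annulusArrows a) ≡ indicator (inward a j ≟E ((inject₁ a , i) , (Fin.suc a , l)))
  inward-count a j i l h = ≡.trans (annulus-count _ _ a j λ j′ j′≢j → h j′ j′≢j , outward-apart)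
    (≡.trans (≡.cong (indicator (inward a j ≟E (u , v)) ℕ.+_) (indicator-no (outward a j ≟E (u , v)) outward-apart)) (ℕₚ.+-identityʳ _))
    where
    u = (inject₁ a , i)
    v = (Fin.suc a , l)

  outward-count : ∀ a j i l → (∀ j′ → j′ ≢ j → outward a j′ ≢ ((Fin.suc a , l) , (inject₁ a , i))) →
    count (Fin.suc a , l) (inject₁ a , i) (annulusArrows a) ≡ indicator (outward a j ≟E ((Fin.suc a , l) , (inject₁ a , i)))
  outward-count a j i l h = ≡.trans (annulus-count _ _ a j λ j′ j′≢j → inward-apart , h j′ j′≢j)
    (≡.cong (ℕ._+ indicator (outward a j ≟E (v , u))) (indicator-no (inward a j ≟E (v , u)) inward-apart))
    where
    u = (inject₁ a , i)
    v = (Fin.suc a , l)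

  edge-target : ∀ {x y u v : Vertex} → (x , y) ≡ (u , v) → y ≡ v
  edge-target ≡.refl = ≡.refl

  inward-p : ∀ a j l → count (inject₁ a , p a j) (Fin.suc a , l) (annulusArrows a) ≡ indicator (Q a j Finₚ.≟ l)
  inward-p a j l = ≡.trans
    (inward-count a j _ l λ j′ j′≢j e → j′≢j (p-injective a (Vertex-injective (,-injectiveˡ e))))
    (indicator-⇔ (inward a j ≟E (_ , (Fin.suc a , l))) (Q a j Finₚ.≟ l) (λ { ≡.refl → ≡.refl }) (λ { ≡.refl → ≡.refl }))

  inward-Q : ∀ a j i → count (inject₁ a , i) (Fin.suc a , Q a j) (annulusArrows a) ≡ indicator (p a j Finₚ.≟ i)
  inward-Q a j i = ≡.trans
    (inward-count a j i _ λ j′ j′≢j e → j′≢j (Q-injective a (Vertex-injective (edge-target e))))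
    (indicator-⇔ (inward a j ≟E ((inject₁ a , i) , _)) (p a j Finₚ.≟ i) (λ { ≡.refl → ≡.refl }) (λ { ≡.refl → ≡.refl }))

  outward-Q : ∀ a j i → count (Fin.suc a , Q a j) (inject₁ a , i) (annulusArrows a) ≡ indicator (p a (prev j) Finₚ.≟ i)
  outward-Q a j i = ≡.trans
    (outward-count a j i _ λ j′ j′≢j e → j′≢j (Q-injective a (Vertex-injective (,-injectiveˡ e))))
    (indicator-⇔ (outward a j ≟E (_ , (inject₁ a , i))) (p a (prev j) Finₚ.≟ i) (λ { ≡.refl → ≡.refl }) (λ { ≡.refl → ≡.refl }))

  outward-p : ∀ a j l → count (Fin.suc a , l) (inject₁ a , p a j) (annulusArrows a) ≡ indicator (Q a (rot j 1) Finₚ.≟ l)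
  outward-p a j l = ≡.trans
    (outward-count a (rot j 1) _ l λ j′ j′≢ e → j′≢ (≡.trans (≡.sym (rot-prev j′)) (≡.cong (λ t → rot t 1) (p-injective a (Vertex-injective (edge-target e))))))
    (indicator-⇔ (outward a (rot j 1) ≟E ((Fin.suc a , l) , _)) (Q a (rot j 1) Finₚ.≟ l)
      (λ e → Vertex-injective (,-injectiveˡ e))
      (λ { ≡.refl → ≡.cong (λ t → (Fin.suc a , Q a (rot j 1)) , (inject₁ a , p a t)) (prev-rot j) }))

  circles-own : ∀ c i j → count (c , i) (c , j) circleArrows ≡ indicator (rot i 1 Finₚ.≟ j)
  circles-own c i j = ≡.trans
    (count-concatMap (c , i) (c , j) circleArrowsOf (λ c → c) c λ c′ c′≢c → circle-0 (c , i) (c , j) (inj₁ c′≢c))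
    (circle-count c i j)

  circles-0 : ∀ {c c′} i j → c ≢ c′ → count (c , i) (c′ , j) circleArrows ≡ 0
  circles-0 {c} {c′} i j c≢c′ = count-concatMap-0 (c , i) (c′ , j) circleArrowsOf (λ c → c) λ d →
    circle-0 (c , i) (c′ , j) (differ d)
    where
    differ : ∀ d → d ≢ c ⊎ d ≢ c′
    differ d with d Finₚ.≟ c
    ... | yes ≡.refl = inj₂ c≢c′
    ... | no d≢c     = inj₁ d≢c

  Between : Fin M → Circle → Circle → Set
  Between a c c′ = (inject₁ a ≡ c × Fin.suc a ≡ c′) ⊎ (Fin.suc a ≡ c × inject₁ a ≡ c′)

  between-irreflexive : ∀ {a c} → ¬ Between a c c
  between-irreflexive (inj₁ (≡.refl , e)) = inject₁≢suc (≡.sym e)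
  between-irreflexive (inj₂ (≡.refl , e)) = inject₁≢suc e

  annulus-away : ∀ {c c′} i j a → ¬ Between a c c′ → count (c , i) (c′ , j) (annulusArrows a) ≡ 0
  annulus-away i j a ¬between = annulus-0 _ _ a λ b →
      (λ { ≡.refl → ¬between (inj₁ (≡.refl , ≡.refl)) })
    , (λ { ≡.refl → ¬between (inj₂ (≡.refl , ≡.refl)) })

  annuli-0 : ∀ {c c′} i j → (∀ a → ¬ Between a c c′) → count (c , i) (c′ , j) (concatMap annulusArrows (allFin M)) ≡ 0
  annuli-0 {c} {c′} i j away = count-concatMap-0 (c , i) (c′ , j) annulusArrows (λ a → a) λ a → annulus-away i j a (away a)

  suc-inject₁-cycle : ∀ {m} {a a′ : Fin m} → Fin.suc a′ ≡ inject₁ a → inject₁ a′ ≢ Fin.suc a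
  suc-inject₁-cycle {a = a} {a′} e e′ = ℕₚ.m≢1+m+n (toℕ a′) {1} (begin
    toℕ a′               ≡⟨ Finₚ.toℕ-inject₁ a′ ⟨
    toℕ (inject₁ a′)     ≡⟨ ≡.cong toℕ e′ ⟩
    suc (toℕ a)          ≡⟨ ≡.cong suc (≡.trans (≡.sym (Finₚ.toℕ-inject₁ a)) (≡.sym (≡.cong toℕ e))) ⟩
    suc (suc (toℕ a′))   ≡⟨ ≡.cong suc (ℕₚ.+-comm 1 (toℕ a′)) ⟩
    suc (toℕ a′ ℕ.+ 1) ∎)
    where open ≡.≡-Reasoning

  annuli-inward : ∀ a i l → count (inject₁ a , i) (Fin.suc a , l) (concatMap annulusArrows (allFin M))
                          ≡ count (inject₁ a , i) (Fin.suc a , l) (annulusArrows a)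
  annuli-inward a i l = count-concatMap (inject₁ a , i) (Fin.suc a , l) annulusArrows (λ a → a) a λ a′ a′≢a →
    annulus-away i l a′ λ { (inj₁ (e , _)) → a′≢a (Finₚ.inject₁-injective e)
                          ; (inj₂ (e , e′)) → suc-inject₁-cycle e e′ }

  annuli-outward : ∀ a i l → count (Fin.suc a , l) (inject₁ a , i) (concatMap annulusArrows (allFin M))
                           ≡ count (Fin.suc a , l) (inject₁ a , i) (annulusArrows a)
  annuli-outward a i l = count-concatMap (Fin.suc a , l) (inject₁ a , i) annulusArrows (λ a → a) a λ a′ a′≢a →
    annulus-away l i a′ λ { (inj₁ (e , e′)) → suc-inject₁-cycle e′ e
                          ; (inj₂ (e , _)) → a′≢a (Finₚ.suc-injective e) }

  #arrows-split : ∀ u v → #arrows u v ≡ count u v circleArrows ℕ.+ count u v (concatMap annulusArrows (allFin M))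
  #arrows-split u v = count-++ u v circleArrows _

  #arrows-own : ∀ c i j → #arrows (c , i) (c , j) ≡ indicator (rot i 1 Finₚ.≟ j)
  #arrows-own c i j = ≡.trans (#arrows-split (c , i) (c , j))
    (≡.trans (≡.cong₂ ℕ._+_ (circles-own c i j) (annuli-0 i j λ a → between-irreflexive)) (ℕₚ.+-identityʳ _))

  #arrows-away : ∀ {c c′} i j → c ≢ c′ → (∀ a → ¬ Between a c c′) → #arrows (c , i) (c′ , j) ≡ 0
  #arrows-away {c} {c′} i j c≢c′ away = ≡.trans (#arrows-split (c , i) (c′ , j))
    (≡.cong₂ ℕ._+_ (circles-0 i j c≢c′) (annuli-0 i j away))

  #arrows-inward : ∀ a i l → #arrows (inject₁ a , i) (Fin.suc a , l) ≡ count (inject₁ a , i) (Fin.suc a , l) (annulusArrows a)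
  #arrows-inward a i l = ≡.trans (#arrows-split (inject₁ a , i) (Fin.suc a , l))
    (≡.cong₂ ℕ._+_ (circles-0 i l inject₁≢suc) (annuli-inward a i l))

  #arrows-outward : ∀ a i l → #arrows (Fin.suc a , l) (inject₁ a , i) ≡ count (Fin.suc a , l) (inject₁ a , i) (annulusArrows a)
  #arrows-outward a i l = ≡.trans (#arrows-split (Fin.suc a , l) (inject₁ a , i))
    (≡.cong₂ ℕ._+_ (circles-0 l i (inject₁≢suc ∘ ≡.sym)) (annuli-outward a i l))

  ⊖-indicators : ∀ {x y m n} → x ≡ m → y ≡ n → x ⊖ y ≡ + m ℤ.- + n
  ⊖-indicators {m = m} {n} ≡.refl ≡.refl = ≡.sym (ℤₚ.m-n≡m⊖n m n)

  -- On a circle with two vertices successor and predecessor coincide, and this says that the two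
  -- circle arrows cancel.
  own-arc : ∀ c j → ColumnArc c (c , j) (rot j 1) (prev j)
  own-arc c j i = ⊖-indicators
    (≡.trans (#arrows-own c i j) (indicator-⇔ (rot i 1 Finₚ.≟ j) (prev j Finₚ.≟ i)
      (λ { ≡.refl → prev-rot i }) (λ { ≡.refl → rot-prev j })))
    (#arrows-own c j i)

  outer-arc : ∀ a j → ColumnArc (inject₁ a) (Fin.suc a , Q a j) (p a (prev j)) (p a j)
  outer-arc a j i = ⊖-indicators
    (≡.trans (#arrows-inward a i (Q a j)) (inward-Q a j i))
    (≡.trans (#arrows-outward a i (Q a j)) (outward-Q a j i))

  -- The arrow into `p a j` belongs to the block `rot j 1`, since block `j` sends `Q a j` back to
  -- the breakpoint before `p a j`.
  inner-arc : ∀ a j → ColumnArc (Fin.suc a) (inject₁ a , p a j) (Q a j) (Q a (rot j 1))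
  inner-arc a j l = ⊖-indicators
    (≡.trans (#arrows-outward a (p a j) l) (outward-p a j l))
    (≡.trans (#arrows-inward a (p a j) l) (inward-p a j l))

  no-arc : ∀ {c v} → (∀ i → #arrows (c , i) v ≡ 0) → (∀ i → #arrows v (c , i) ≡ 0) → ∀ x → ColumnArc c v x x
  no-arc in-0 out-0 x i = ≡.trans (⊖-indicators (in-0 i) (out-0 i)) (≡.sym (ℤₚ.+-inverseʳ (δᶠ x i)))

  no-outer-arc : ∀ a l → (∀ j → Q a j ≢ l) → ∀ x → ColumnArc (inject₁ a) (Fin.suc a , l) x x
  no-outer-arc a l l∉Q = no-arc
    (λ i → ≡.trans (#arrows-inward a i l) (annulus-0 _ _ a λ j → (λ { ≡.refl → l∉Q j ≡.refl }) , outward-apart))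
    (λ i → ≡.trans (#arrows-outward a i l) (annulus-0 _ _ a λ j → inward-apart , (λ { ≡.refl → l∉Q j ≡.refl })))

  no-inner-arc : ∀ a i → (∀ j → p a j ≢ i) → ∀ x → ColumnArc (Fin.suc a) (inject₁ a , i) x x
  no-inner-arc a i i∉p = no-arc
    (λ l → ≡.trans (#arrows-outward a i l) (annulus-0 _ _ a λ j → inward-apart , (λ { ≡.refl → i∉p (prev j) ≡.refl })))
    (λ l → ≡.trans (#arrows-inward a i l) (annulus-0 _ _ a λ j → (λ { ≡.refl → i∉p j ≡.refl }) , outward-apart))

  between? : ∀ a c c′ → Dec (Between a c c′)
  between? a c c′ = ((inject₁ a Finₚ.≟ c) ×-dec (Fin.suc a Finₚ.≟ c′)) ⊎-dec ((Fin.suc a Finₚ.≟ c) ×-dec (inject₁ a Finₚ.≟ c′))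

  swap-between : ∀ {a c c′} → Between a c c′ → Between a c′ c
  swap-between (inj₁ (e , e′)) = inj₂ (e′ , e)
  swap-between (inj₂ (e , e′)) = inj₁ (e′ , e)

  position₀ : ∀ c → Fin (n c)
  position₀ c = Fin.fromℕ< (ℕₚ.≤-trans (s≤s z≤n) (n≥2 c))

  -- A breakpoint has one arrow from and one to the neighbouring circle; a vertex with no arrows to
  -- or from the circle `c` gets the trivial arc at an arbitrary position.
  column-arc : ∀ c v → ∃₂ (ColumnArc c v)
  column-arc c (c′ , j) with c Finₚ.≟ c′
  ... | yes ≡.refl = rot j 1 , prev j , own-arc c j
  ... | no c≢c′ with Finₚ.any? (λ a → between? a c c′)
  ...   | no away = position₀ c , position₀ c , no-arc
            (λ i → #arrows-away i j c≢c′ λ a b → away (a , b))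
            (λ i → #arrows-away j i (c≢c′ ∘ ≡.sym) λ a b → away (a , swap-between b)) (position₀ c)
  ...   | yes (a , inj₁ (≡.refl , ≡.refl)) with Finₚ.any? (λ b → Q a b Finₚ.≟ j)
  ...     | yes (b , ≡.refl) = p a (prev b) , p a b , outer-arc a b
  ...     | no j∉Q           = position₀ c , position₀ c , no-outer-arc a j (λ b e → j∉Q (b , e)) (position₀ c)
  column-arc c (c′ , j) | no c≢c′ | yes (a , inj₂ (≡.refl , ≡.refl)) with Finₚ.any? (λ b → p a b Finₚ.≟ j)
  ...     | yes (b , ≡.refl) = Q a b , Q a (rot b 1) , inner-arc a b
  ...     | no j∉p           = position₀ c , position₀ c , no-inner-arc a j (λ b e → j∉p (b , e)) (position₀ c)

δᶠ-rot : ∀ {n} .{{_ : NonZero n}} (s : Fin n) {i j} → i < n → j < n → δᶠ (rot s i) (rot s j) ≡ δ i j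
δᶠ-rot s {i} {j} i<n j<n with i ℕₚ.≟ j
... | yes ≡.refl = ≡.trans (≡.cong +_ (indicator-⇔ (rot s i Finₚ.≟ rot s i) (yes ≡.refl) (λ e → e) λ e → e)) (≡.sym (δ-refl i))
... | no i≢j     = ≡.trans (≡.cong +_ (indicator-no (rot s i Finₚ.≟ rot s j) (i≢j ∘ rot-injectiveʳ s i<n j<n))) (≡.sym (δ-≢ i≢j))

rot-surjective : ∀ {n} .{{_ : NonZero n}} (s f : Fin n) → ∃ λ i → i < n × rot s i ≡ f
rot-surjective {n} s f = x % n , DivMod.m%n<n x n , Finₚ.toℕ-injective (begin
  toℕ (rot s (x % n))           ≡⟨ toℕ-rot s (x % n) ⟩
  (toℕ s ℕ.+ x % n) % n         ≡⟨ DivMod.%-distribˡ-+ (toℕ s) (x % n) n ⟩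
  (toℕ s % n ℕ.+ x % n % n) % n ≡⟨ ≡.cong (λ t → (toℕ s % n ℕ.+ t) % n) (DivMod.m%n%n≡m%n x n) ⟩
  (toℕ s % n ℕ.+ x % n) % n     ≡⟨ DivMod.%-distribˡ-+ (toℕ s) x n ⟨
  (toℕ s ℕ.+ x) % n             ≡⟨ ≡.cong (_% n) (≡.trans (≡.cong (toℕ s ℕ.+_) (ℕₚ.+-comm (toℕ f) _))
                                     (≡.sym (ℕₚ.+-assoc (toℕ s) _ (toℕ f)))) ⟩
  (toℕ s ℕ.+ (n ℕ.∸ toℕ s) ℕ.+ toℕ f) % n ≡⟨ ≡.cong (λ t → (t ℕ.+ toℕ f) % n) (ℕₚ.m+[n∸m]≡n (ℕₚ.<⇒≤ (Finₚ.toℕ<n s))) ⟩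
  (n ℕ.+ toℕ f) % n             ≡⟨ ≡.trans (≡.cong (_% n) (ℕₚ.+-comm n (toℕ f))) (DivMod.[m+n]%n≡m%n (toℕ f) n) ⟩
  toℕ f % n                     ≡⟨ DivMod.m<n⇒m%n≡m (Finₚ.toℕ<n f) ⟩
  toℕ f ∎)
  where
  open ≡.≡-Reasoning
  -- The rotation from `s` to `f`, with a full turn added to avoid a negative difference.
  x = toℕ f ℕ.+ (n ℕ.∸ toℕ s)

shift-base : ∀ {t n} u i → t ≤ n → t ℕ.+ (u ℕ.+ (n ℕ.∸ t) ℕ.+ i) ≡ u ℕ.+ i ℕ.+ n
shift-base {t} {n} u i t≤n = begin
  t ℕ.+ (u ℕ.+ (n ℕ.∸ t) ℕ.+ i)   ≡⟨ ℕₚ.+-comm t _ ⟩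
  u ℕ.+ (n ℕ.∸ t) ℕ.+ i ℕ.+ t     ≡⟨ ℕₚ.+-assoc (u ℕ.+ (n ℕ.∸ t)) i t ⟩
  u ℕ.+ (n ℕ.∸ t) ℕ.+ (i ℕ.+ t)   ≡⟨ ℕₚ.+-assoc u _ _ ⟩
  u ℕ.+ ((n ℕ.∸ t) ℕ.+ (i ℕ.+ t)) ≡⟨ ≡.cong (u ℕ.+_) (≡.trans (ℕₚ.+-comm (n ℕ.∸ t) _) (ℕₚ.+-assoc i t _)) ⟩
  u ℕ.+ (i ℕ.+ (t ℕ.+ (n ℕ.∸ t))) ≡⟨ ≡.cong (λ r → u ℕ.+ (i ℕ.+ r)) (ℕₚ.m+[n∸m]≡n t≤n) ⟩
  u ℕ.+ (i ℕ.+ n)                 ≡⟨ ℕₚ.+-assoc u i n ⟨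
  u ℕ.+ i ℕ.+ n ∎
  where open ≡.≡-Reasoning

-- The mutation sequence on one circle of the spider web

module SemifieldWindows {c ℓ : Level} (P : Semifield c ℓ) where
  open SemifieldProperties P
  open RangeSums P₀ public

  private
    partialWindow : (ℕ → Carrier) → ℕ → ℕ → Carrier
    partialWindow X i zero    = X i
    partialWindow X i (suc m) = X i ⊕ partialWindow X (suc i) m

    partialWindow-sum : ∀ X i m → just (partialWindow X i m) K.≈ sum (just ∘ X) i (suc m)
    partialWindow-sum X i zero    = K.refl
    partialWindow-sum X i (suc m) = K.+-congˡ {x = just (X i)} (partialWindow-sum X (suc i) m)

  -- The sum of the n terms of X from X i on; it is nonempty even for n = 0, as a semifield has no zero.
  window : ℕ → (ℕ → Carrier) → ℕ → Carrier
  window n X i = partialWindow X i (ℕ.pred n)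

  window-sum : ∀ n .{{_ : NonZero n}} X i → just (window n X i) K.≈ sum (just ∘ X) i n
  window-sum (suc n) X i = partialWindow-sum X i n

  module PeriodicWindows (n : ℕ) .{{n≢0 : NonZero n}} (X : ℕ → Carrier) (z : Carrier)
                         (X-period : ∀ i → X (i ℕ.+ n) ≈ z ⊗ X i) where
    private
      module Ws = Windows n (just ∘ X) (just z) (λ i → just (X-period i))

    window-period : ∀ i → window n X (i ℕ.+ n) ≈ z ⊗ window n X i
    window-period i = drop-just (K.trans (window-sum n X _) (K.trans (Ws.W-period i) (K.*-congˡ {x = just z} (K.sym (window-sum n X i)))))

    -- A partial sum is an element of the semifield only if it is nonempty; hence `p` is tied to the
    -- sum by an equation in the semiring with zero.
    window-exchange : ∀ {p} i b → just p K.≈ sum (just ∘ X) i b → suc b ≤ n →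
      (p ⊕ X (i ℕ.+ b)) ⊗ window n X (i ℕ.+ b) ≈ p ⊗ window n X (suc (i ℕ.+ b)) ⊕ X (i ℕ.+ b) ⊗ window n X i
    window-exchange {p} i b p≈ b<n = drop-just (K.sym (K.trans
      (K.+-cong (K.*-cong p≈ (window-sum n X _)) (K.*-congˡ {x = just (X (i ℕ.+ b))} (window-sum n X i)))
      (K.trans (Ws.exchange i b b<n)
        (K.*-cong (K.trans (sum-last (just ∘ X) i b) (K.+-congʳ {x = just (X (i ℕ.+ b))} (K.sym p≈))) (K.sym (window-sum n X _))))))

module CircleReflection {cℓ ℓ : Level} (P : Semifield cℓ ℓ) (Web : SpiderWeb) where
  open SpiderWeb Web using (n; n≥2; Circle; Vertex; _≟V_; B; #arrows; label)
  open Columns Web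
  open Seeds P _≟V_ renaming (B to matrix; y to vars) public
  open SemifieldWindows P public
  open CycleReflection P _≟V_

  B-skew : SkewSymmetric B
  B-skew i j = ℤₚ.⊖-swap (#arrows i j) (#arrows j i)

  module _ (c : Circle) (s₀ s₁ : Fin (n c)) (S : YSeed) (B-fixed : ∀ i j → matrix S i j ≡ B i j)
           (X : ℕ → Carrier) (X-slope : ∀ i → vars S (c , rot s₀ (suc i)) ⊗ X i ≈ X (suc i)) where

    private
      N = n c
      k = N ℕ.∸ 2
      N≡ : 2 ℕ.+ k ≡ N
      N≡ = ℕₚ.m+[n∸m]≡n (n≥2 c)
      y = vars S
      S′ = run (τ N (label c s₁)) S

    -- The product of the variables on the circle, written as the growth of the heights over one
    -- turn.
    z : Carrier
    z = X N ⊗ X 0 ⁻¹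

    X-period : ∀ i → X (i ℕ.+ N) ≈ z ⊗ X i
    X-period zero    = ≈-sym (≈-trans (⊗-assoc _ _ _) (≈-trans (⊗-cong ≈-refl (⊗-inverseˡ _)) (⊗-identityʳ _)))
    X-period (suc i) = begin
      X (suc i ℕ.+ N)                                    ≈⟨ X-slope (i ℕ.+ N) ⟨
      y (c , rot s₀ (suc i ℕ.+ N)) ⊗ X (i ℕ.+ N)         ≈⟨ ⊗-cong (≈-reflexive (≡.cong (λ f → y (c , f)) (rot-+ s₀ (suc i)))) (X-period i) ⟩
      y (c , rot s₀ (suc i)) ⊗ (z ⊗ X i)                 ≈⟨ ≈-trans (≈-sym (⊗-assoc _ _ _)) (≈-trans (⊗-cong (⊗-comm _ _) ≈-refl) (⊗-assoc _ _ _)) ⟩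
      z ⊗ (y (c , rot s₀ (suc i)) ⊗ X i)                 ≈⟨ ⊗-cong ≈-refl (X-slope i) ⟩
      z ⊗ X (suc i) ∎

    W : ℕ → Carrier
    W = window N X

    open PeriodicWindows N X z X-period

    private
      a : ℕ → Vertex
      a i = (c , rot s₁ i)

      -- `o` is a lift of the first label `s₁` to the cover based at `s₀`. It is positive since
      -- `toℕ s₀ < N`, which leaves room for the height `X o′` before the first mutated vertex.
      o o′ : ℕ
      o  = toℕ s₁ ℕ.+ (N ℕ.∸ toℕ s₀)
      o′ = ℕ.pred o

      o≡ : suc o′ ≡ o
      o≡ = ℕₚ.suc-pred o {{ℕ.>-nonZero (ℕₚ.<-≤-trans (ℕₚ.m<n⇒0<n∸m (Finₚ.toℕ<n s₀)) (ℕₚ.m≤n+m _ (toℕ s₁)))}}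

      rot-o : ∀ i → rot s₀ (o ℕ.+ i) ≡ rot s₁ i
      rot-o i = rot-≡ s₀ s₁ (≡.trans
        (≡.cong (_% N) (shift-base (toℕ s₁) i (ℕₚ.<⇒≤ (Finₚ.toℕ<n s₀)))) (DivMod.[m+n]%n≡m%n (toℕ s₁ ℕ.+ i) N))

      slope-at : ∀ i → y (a i) ⊗ X (o′ ℕ.+ i) ≈ X (o ℕ.+ i)
      slope-at i = ≈-trans
        (⊗-cong (≈-reflexive (≡.cong (λ f → y (c , f)) (≡.trans (≡.sym (rot-o i)) (≡.cong (λ t → rot s₀ (t ℕ.+ i)) (≡.sym o≡))))) ≈-refl)
        (≈-trans (X-slope (o′ ℕ.+ i)) (≈-reflexive (≡.cong (λ t → X (t ℕ.+ i)) o≡)))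

      slopes : Slopes k a y z (X o′) (λ i → X (o ℕ.+ i))
      slopes = record
        { first = ≈-trans (⊗-cong ≈-refl (≈-reflexive (≡.cong X (≡.sym (ℕₚ.+-identityʳ o′))))) (slope-at 0)
        ; inner = λ i _ → shifted i
        ; last  = ≈-trans (shifted k) (≈-trans (≈-reflexive (≡.cong X (≡.trans (≡.cong (ℕ._+ suc k) (≡.sym o≡))
                    (≡.trans (≡.sym (ℕₚ.+-suc o′ (suc k))) (≡.cong (o′ ℕ.+_) N≡))))) (X-period o′))
        }
        where
        shifted : ∀ i → y (a (suc i)) ⊗ X (o ℕ.+ i) ≈ X (o ℕ.+ suc i)
        shifted i = ≈-trans (⊗-cong ≈-refl (≈-reflexive (≡.cong X
          (≡.trans (≡.cong (ℕ._+ i) (≡.sym o≡)) (≡.sym (ℕₚ.+-suc o′ i)))))) (slope-at (suc i))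

      -- After `j` merges the height before the first remaining vertex is the sum of `suc j`
      -- original heights from `o′`, and the relation demanded by the next merge is
      -- `window-exchange`. `r` counts the merges still to come.
      heights-from : ∀ r j → j ℕ.+ r ≡ k → ∀ {p F G} → just p K.≈ sum (just ∘ X) o′ (suc j) →
                     (∀ i → F i ≡ X (o′ ℕ.+ suc j ℕ.+ i)) → (∀ i → G i ≡ W (o′ ℕ.+ suc j ℕ.+ i)) →
                     Heights z (W o′) r p F G
      heights-from zero j j≡ {p} {F} {G} p≈ F≡ G≡ =
          drop-just (K.trans (K.+-cong p≈ (just (≈-reflexive F0)))
            (K.trans (K.sym (sum-last (just ∘ X) o′ (suc j))) (K.trans (K.reflexive (≡.cong (sum (just ∘ X) o′) N≡′)) (K.sym (window-sum N X o′)))))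
        , drop-just (K.trans (K.+-cong (just (≈-reflexive F0)) (K.*-congˡ {x = just z} p≈))
            (K.trans (K.+-congˡ {x = just (X t)} (K.sym tail-sum))
              (K.trans (K.reflexive (≡.cong (sum (just ∘ X) t) N≡′)) (K.trans (K.sym (window-sum N X t)) (just (≈-reflexive (≡.sym G0)))))))
        , ≈-trans (≈-reflexive (≡.trans (G≡ 1) (≡.cong W (≡.trans (ℕₚ.+-assoc o′ (suc j) 1)
            (≡.cong (o′ ℕ.+_) (≡.trans (ℕₚ.+-comm (suc j) 1) N≡′)))))) (window-period o′)
        where
        t = o′ ℕ.+ suc j
        F0 : F 0 ≡ X t
        F0 = ≡.trans (F≡ 0) (≡.cong X (ℕₚ.+-identityʳ t))
        G0 : G 0 ≡ W t
        G0 = ≡.trans (G≡ 0) (≡.cong W (ℕₚ.+-identityʳ t))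
        N≡′ : 2 ℕ.+ j ≡ N
        N≡′ = ≡.trans (≡.cong (λ j → 2 ℕ.+ j) (≡.trans (≡.sym (ℕₚ.+-identityʳ j)) j≡)) N≡
        tail-sum : sum (just ∘ X) (suc t) (suc j) K.≈ just z K.* sum (just ∘ X) o′ (suc j)
        tail-sum = K.trans (K.reflexive (≡.cong (λ u → sum (just ∘ X) u (suc j)) (≡.trans (≡.sym (ℕₚ.+-suc o′ (suc j))) (≡.cong (o′ ℕ.+_) N≡′))))
          (K.trans (sum-shift (just ∘ X) N o′ (suc j)) (K.trans (sum-cong o′ (suc j) λ l _ _ → just (X-period l))
            (K.sym (*-distribˡ-sum (just z) (just ∘ X) o′ (suc j)))))
      heights-from (suc r) j j≡ {p} {F} {G} p≈ F≡ G≡ =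
          ≈-trans (⊗-cong (⊕-cong ≈-refl (≈-reflexive F0)) (≈-reflexive G0))
            (≈-trans (window-exchange o′ (suc j) p≈ j<N)
              (⊕-cong (⊗-cong ≈-refl (≈-reflexive (≡.sym G1))) (⊗-cong (≈-reflexive (≡.sym F0)) ≈-refl)))
        , heights-from r (suc j) (≡.trans (≡.sym (ℕₚ.+-suc j r)) j≡)
            (K.trans (K.+-cong p≈ (just (≈-reflexive F0))) (K.sym (sum-last (just ∘ X) o′ (suc j))))
            (λ i → ≡.trans (F≡ (suc i)) (≡.cong X (shift i))) (λ i → ≡.trans (G≡ (suc i)) (≡.cong W (shift i)))
        where
        t = o′ ℕ.+ suc j
        F0 : F 0 ≡ X t
        F0 = ≡.trans (F≡ 0) (≡.cong X (ℕₚ.+-identityʳ t))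
        G0 : G 0 ≡ W t
        G0 = ≡.trans (G≡ 0) (≡.cong W (ℕₚ.+-identityʳ t))
        G1 : G 1 ≡ W (suc t)
        G1 = ≡.trans (G≡ 1) (≡.cong W (ℕₚ.+-comm t 1))
        j<N : 2 ℕ.+ j ≤ N
        j<N = ≡.subst (2 ℕ.+ j ≤_) N≡ (s≤s (s≤s (≡.subst (j ≤_) j≡ (ℕₚ.m≤m+n j (suc r)))))
        shift : ∀ i → t ℕ.+ suc i ≡ o′ ℕ.+ suc (suc j) ℕ.+ i
        shift i = ≡.trans (ℕₚ.+-suc t i) (≡.cong (ℕ._+ i) (≡.sym (ℕₚ.+-suc o′ (suc j))))

      heights : Heights z (W o′) k (X o′) (λ i → X (o ℕ.+ i)) (λ i → W (o ℕ.+ i))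
      heights = heights-from k 0 ≡.refl (K.sym (K.+-identityʳ _))
        (λ i → ≡.cong (λ t → X (t ℕ.+ i)) o-suc) (λ i → ≡.cong (λ t → W (t ℕ.+ i)) o-suc)
        where
        o-suc : o ≡ o′ ℕ.+ 1
        o-suc = ≡.trans (≡.sym o≡) (ℕₚ.+-comm 1 o′)

      to-Arc : ∀ {v σ η} → ColumnArc c v (rot s₁ σ) (rot s₁ η) → σ < N → η < N → Arc (2 ℕ.+ k) (col (matrix S) a v) σ η
      to-Arc {v} {σ} {η} A σ<N η<N = record
        { source = ≡.subst (σ <_) (≡.sym N≡) σ<N
        ; target = ≡.subst (η <_) (≡.sym N≡) η<N
        ; column = λ i i<m → let i<N = ≡.subst (i <_) N≡ i<m in
            ≡.trans (B-fixed (a i) v) (≡.trans (A (rot s₁ i)) (≡.cong₂ ℤ._-_ (δᶠ-rot s₁ η<N i<N) (δᶠ-rot s₁ σ<N i<N)))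
        }

      own : ∀ i → ColumnArc c (a (suc i)) (rot s₁ (2 ℕ.+ i)) (rot s₁ i)
      own i = ≡.subst₂ (ColumnArc c (a (suc i)))
        (≡.trans (rot-rot s₁ (suc i) 1) (≡.cong (rot s₁) (ℕₚ.+-comm (suc i) 1)))
        (≡.trans (≡.cong prev (≡.trans (≡.cong (rot s₁) (ℕₚ.+-comm 1 i)) (≡.sym (rot-rot s₁ i 1)))) (prev-rot (rot s₁ i)))
        (own-arc c (rot s₁ (suc i)))

      rot-N : rot s₁ (2 ℕ.+ k) ≡ rot s₁ 0
      rot-N = ≡.trans (≡.cong (rot s₁) N≡) (rot-+ s₁ 0)

      below : ∀ {i} → i < 2 ℕ.+ k → i < N
      below {i} = ≡.subst (i <_) N≡

      cycle : Cycle k (matrix S) a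
      cycle = record
        { injective = λ i j i<m j<m e → rot-injectiveʳ s₁ (below i<m) (below j<m) (Vertex-injective e)
        ; skew  = λ i j → ≡.trans (B-fixed i j) (≡.trans (B-skew i j) (≡.cong ℤ.-_ (≡.sym (B-fixed j i))))
        ; arcs  = arcs
        ; first = to-Arc (≡.subst₂ (λ v s → ColumnArc c v s (rot s₁ (suc k))) (≡.cong (c ,_) rot-N) rot-1 (own (suc k)))
                    (below (s≤s (s≤s z≤n))) (below ℕₚ.≤-refl)
        ; inner = λ i i<k → to-Arc (own i) (below (s≤s (s≤s i<k))) (below (ℕₚ.m≤n⇒m≤1+n (ℕₚ.m≤n⇒m≤1+n i<k)))
        ; last  = to-Arc (≡.subst (λ s → ColumnArc c (a (suc k)) s (rot s₁ k)) rot-N (own k)) (below (s≤s z≤n)) (below (s≤s (ℕₚ.n≤1+n k)))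
        }
        where
        rot-1 : rot s₁ (3 ℕ.+ k) ≡ rot s₁ 1
        rot-1 = ≡.trans (≡.cong (rot s₁ ∘ suc) N≡) (rot-+ s₁ 1)
        arcs : ∀ v → ∃₂ (Arc (2 ℕ.+ k) (col (matrix S) a v))
        arcs v with s , e , A ← column-arc c v
          with σ , σ<N , ≡.refl ← rot-surjective s₁ s
          with η , η<N , ≡.refl ← rot-surjective s₁ e
          = σ , η , to-Arc A σ<N η<N

      reflected : Reflected z k a (λ i → W (o ℕ.+ i)) S S′
      reflected = ≡.subst (λ m → Reflected z k a (λ i → W (o ℕ.+ i)) S (run (τ m (label c s₁)) S)) N≡
        (τ-reflects k (label c s₁) S cycle slopes heights)

      -- Labels start at `s₁` while the cover is based at `s₀`, so different lifts of one vertex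
      -- occur. A turn multiplies both sides by `z`; over the naturals two lifts are compared by
      -- ascending to a common later lift and descending from it.
      window-transport : ∀ {u v d} i j → rot s₀ i ≡ rot s₀ j → u ⊗ W i ≈ v ⊗ W (i ℕ.+ d) → u ⊗ W j ≈ v ⊗ W (j ℕ.+ d)
      window-transport {u} {v} {d} i j eq h with α , β , i+α≡j+β ← rot-≡⇒ s₀ s₀ eq =
        descend β j (≡.subst (λ t → u ⊗ W t ≈ v ⊗ W (t ℕ.+ d))
          (ℕₚ.+-cancelˡ-≡ (toℕ s₀) _ _ (≡.trans (≡.sym (ℕₚ.+-assoc (toℕ s₀) i _)) (≡.trans i+α≡j+β (ℕₚ.+-assoc (toℕ s₀) j _))))
          (ascend α i h))
        where
        swap-n : ∀ i → i ℕ.+ N ℕ.+ d ≡ i ℕ.+ d ℕ.+ N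
        swap-n i = ≡.trans (ℕₚ.+-assoc i N d) (≡.trans (≡.cong (i ℕ.+_) (ℕₚ.+-comm N d)) (≡.sym (ℕₚ.+-assoc i d N)))
        pull-z : ∀ x w → x ⊗ (z ⊗ w) ≈ x ⊗ w ⊗ z
        pull-z x w = ≈-trans (⊗-cong ≈-refl (⊗-comm z w)) (≈-sym (⊗-assoc x w z))
        up : ∀ i → u ⊗ W i ≈ v ⊗ W (i ℕ.+ d) → u ⊗ W (i ℕ.+ N) ≈ v ⊗ W (i ℕ.+ N ℕ.+ d)
        up i h = begin
          u ⊗ W (i ℕ.+ N)       ≈⟨ ≈-trans (⊗-cong ≈-refl (window-period i)) (pull-z u _) ⟩
          u ⊗ W i ⊗ z           ≈⟨ ⊗-cong h ≈-refl ⟩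
          v ⊗ W (i ℕ.+ d) ⊗ z   ≈⟨ ≈-trans (⊗-cong ≈-refl (≈-trans (≈-reflexive (≡.cong W (swap-n i))) (window-period (i ℕ.+ d)))) (pull-z v _) ⟨
          v ⊗ W (i ℕ.+ N ℕ.+ d) ∎
        down : ∀ i → u ⊗ W (i ℕ.+ N) ≈ v ⊗ W (i ℕ.+ N ℕ.+ d) → u ⊗ W i ≈ v ⊗ W (i ℕ.+ d)
        down i h = ⊗-cancelʳ z (begin
          u ⊗ W i ⊗ z           ≈⟨ ≈-trans (⊗-cong ≈-refl (window-period i)) (pull-z u _) ⟨
          u ⊗ W (i ℕ.+ N)       ≈⟨ h ⟩
          v ⊗ W (i ℕ.+ N ℕ.+ d) ≈⟨ ≈-trans (⊗-cong ≈-refl (≈-trans (≈-reflexive (≡.cong W (swap-n i))) (window-period (i ℕ.+ d)))) (pull-z v _) ⟩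
          v ⊗ W (i ℕ.+ d) ⊗ z ∎)
        next-period : ∀ i α → i ℕ.+ (N ℕ.+ α ℕ.* N) ≡ i ℕ.+ N ℕ.+ α ℕ.* N
        next-period i α = ≡.sym (ℕₚ.+-assoc i N (α ℕ.* N))
        ascend : ∀ α i → u ⊗ W i ≈ v ⊗ W (i ℕ.+ d) → u ⊗ W (i ℕ.+ α ℕ.* N) ≈ v ⊗ W (i ℕ.+ α ℕ.* N ℕ.+ d)
        ascend zero    i h = ≡.subst (λ t → u ⊗ W t ≈ v ⊗ W (t ℕ.+ d)) (≡.sym (ℕₚ.+-identityʳ i)) h
        ascend (suc α) i h = ≡.subst (λ t → u ⊗ W t ≈ v ⊗ W (t ℕ.+ d)) (≡.sym (next-period i α)) (ascend α (i ℕ.+ N) (up i h))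
        descend : ∀ α i → u ⊗ W (i ℕ.+ α ℕ.* N) ≈ v ⊗ W (i ℕ.+ α ℕ.* N ℕ.+ d) → u ⊗ W i ≈ v ⊗ W (i ℕ.+ d)
        descend zero    i h = ≡.subst (λ t → u ⊗ W t ≈ v ⊗ W (t ℕ.+ d)) (ℕₚ.+-identityʳ i) h
        descend (suc α) i h = down i (descend α (i ℕ.+ N) (≡.subst (λ t → u ⊗ W t ≈ v ⊗ W (t ℕ.+ d)) (next-period i α) h))

      -- The case distinction in `windowAt` asks whether the arc of length `d` passes the start of
      -- the labelling, a point that the cover does not single out.
      windowAt-lift : ∀ σ η d → σ < N → η < N → d < N → rot s₁ (σ ℕ.+ d) ≡ rot s₁ η →
                      windowAt z (λ i → W (o ℕ.+ i)) σ η ≈ W (o ℕ.+ σ ℕ.+ d)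
      windowAt-lift σ η d σ<N η<N d<N eq with σ ℕ.+ d ℕₚ.<? N
      ... | yes σ+d<N with ≡.refl ← rot-injectiveʳ s₁ σ+d<N η<N eq =
        ≈-reflexive (≡.trans (windowAt-≤ _ (ℕₚ.m≤m+n σ d)) (≡.cong W (≡.sym (ℕₚ.+-assoc o σ d))))
      ... | no σ+d≮N = ≈-trans (≈-reflexive (windowAt-> _ η<σ)) (≈-trans (≈-sym (window-period (o ℕ.+ η))) (≈-reflexive (≡.cong W index)))
        where
        η′ = σ ℕ.+ d ℕ.∸ N
        η′+N : η′ ℕ.+ N ≡ σ ℕ.+ d
        η′+N = ℕₚ.m∸n+n≡m (ℕₚ.≮⇒≥ σ+d≮N)
        η′<σ : η′ < σ
        η′<σ = ℕₚ.+-cancelʳ-< N η′ σ (≡.subst (_< σ ℕ.+ N) (≡.sym η′+N) (ℕₚ.+-monoʳ-< σ d<N))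
        η′≡η : η′ ≡ η
        η′≡η = rot-injectiveʳ s₁ (ℕₚ.<-trans η′<σ σ<N) η<N (≡.trans (≡.sym (rot-+ s₁ η′)) (≡.trans (≡.cong (rot s₁) η′+N) eq))
        η<σ : η < σ
        η<σ = ≡.subst (_< σ) η′≡η η′<σ
        index : o ℕ.+ η ℕ.+ N ≡ o ℕ.+ σ ℕ.+ d
        index = ≡.trans (ℕₚ.+-assoc o η N) (≡.trans (≡.cong (o ℕ.+_) (≡.trans (≡.cong (ℕ._+ N) (≡.sym η′≡η)) η′+N)) (≡.sym (ℕₚ.+-assoc o σ d)))

      weighted : ∀ {v κ} → Weight z (2 ℕ.+ k) a v κ → ∀ i d → d < N → ColumnArc c v (rot s₀ i) (rot s₀ (i ℕ.+ d)) →
                 vars S′ v ⊗ κ ⊗ W i ≈ y v ⊗ W (i ℕ.+ d)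
      weighted {v} {κ} wt i d d<N A
        with σ , σ<N , σ≡ ← rot-surjective s₁ (rot s₀ i)
        with η , η<N , η≡ ← rot-surjective s₁ (rot s₀ (i ℕ.+ d))
        = window-transport (o ℕ.+ σ) i (≡.trans (rot-o σ) σ≡) (begin
          vars S′ v ⊗ κ ⊗ W (o ℕ.+ σ)   ≈⟨ ⊗-assoc _ _ _ ⟩
          vars S′ v ⊗ (κ ⊗ W (o ℕ.+ σ)) ≈⟨ Reflected.vars-scaled reflected wt
                                             (to-Arc (≡.subst₂ (ColumnArc c v) (≡.sym σ≡) (≡.sym η≡) A) σ<N η<N) ⟩
          y v ⊗ windowAt z (λ i → W (o ℕ.+ i)) σ η ≈⟨ ⊗-cong ≈-refl (windowAt-lift σ η d σ<N η<N d<N σ+d≡η) ⟩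
          y v ⊗ W (o ℕ.+ σ ℕ.+ d) ∎)
        where
        σ+d≡η : rot s₁ (σ ℕ.+ d) ≡ rot s₁ η
        σ+d≡η = ≡.trans (≡.sym (rot-rot s₁ σ d)) (≡.trans (≡.cong (λ f → rot f d) σ≡) (≡.trans (rot-rot s₀ i d) (≡.sym η≡)))

    matrix-fixed : ∀ i j → matrix S′ i j ≡ B i j
    matrix-fixed i j = ≡.trans (Reflected.matrix-fixed reflected i j) (B-fixed i j)

    vars-away : ∀ {v} → proj₁ v ≢ c → ∀ i d → d < N → ColumnArc c v (rot s₀ i) (rot s₀ (i ℕ.+ d)) →
                vars S′ v ⊗ W i ≈ y v ⊗ W (i ℕ.+ d)
    vars-away {v} v∉c i d d<N A = ≈-trans (⊗-cong (≈-sym (⊗-identityʳ _)) ≈-refl)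
      (weighted (inj₂ ((λ _ _ → v∉c ∘ ,-injectiveˡ) , ≈-refl)) i d d<N A)

    vars-own : ∀ i → vars S′ (c , rot s₀ (suc i)) ⊗ W (2 ℕ.+ i) ≈ y (c , rot s₀ (suc i)) ⊗ W i
    vars-own i with σ , σ<N , σ≡ ← rot-surjective s₁ (rot s₀ (suc i)) = ⊗-cancelʳ z (begin
      vars S′ v ⊗ W (2 ℕ.+ i) ⊗ z   ≈⟨ ≈-trans (⊗-assoc _ _ _) (≈-trans (⊗-cong ≈-refl (⊗-comm _ _)) (≈-sym (⊗-assoc _ _ _))) ⟩
      -- The arc from the successor runs `k = N - 2` steps, to the predecessor one turn later; that
      -- turn accounts for the weight `z`.
      vars S′ v ⊗ z ⊗ W (2 ℕ.+ i)   ≈⟨ weighted (inj₁ (σ , ≡.subst (σ <_) (≡.sym N≡) σ<N , ≡.cong (c ,_) (≡.sym σ≡) , ≈-refl)) (2 ℕ.+ i) k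
                                         (≡.subst (k <_) N≡ (s≤s (ℕₚ.n≤1+n k))) arc ⟩
      y v ⊗ W (2 ℕ.+ i ℕ.+ k)       ≈⟨ ⊗-cong ≈-refl (≈-trans (≈-reflexive (≡.cong W index)) (window-period i)) ⟩
      y v ⊗ (z ⊗ W i)               ≈⟨ ≈-trans (⊗-cong ≈-refl (⊗-comm _ _)) (≈-sym (⊗-assoc _ _ _)) ⟩
      y v ⊗ W i ⊗ z ∎)
      where
      v = (c , rot s₀ (suc i))
      index : 2 ℕ.+ i ℕ.+ k ≡ i ℕ.+ N
      index = ≡.trans (≡.cong (ℕ._+ k) (ℕₚ.+-comm 2 i)) (≡.trans (ℕₚ.+-assoc i 2 k) (≡.cong (i ℕ.+_) N≡))
      arc : ColumnArc c v (rot s₀ (2 ℕ.+ i)) (rot s₀ (2 ℕ.+ i ℕ.+ k))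
      arc = ≡.subst₂ (ColumnArc c v)
        (≡.trans (rot-rot s₀ (suc i) 1) (≡.cong (rot s₀) (ℕₚ.+-comm (suc i) 1)))
        (≡.trans (≡.cong prev (≡.trans (≡.cong (rot s₀) (ℕₚ.+-comm 1 i)) (≡.sym (rot-rot s₀ i 1))))
          (≡.trans (prev-rot (rot s₀ i)) (≡.trans (≡.sym (rot-+ s₀ i)) (≡.cong (rot s₀) (≡.sym index)))))
        (own-arc c (rot s₀ (suc i)))

-- Breakpoints on the cover and the Galois pair between two circles

-- Lifts of k cyclically ordered points on a circle of length n to its universal cover.
record Breakpoints (k n : ℕ) (α : ℕ → ℕ) : Set where
  field
    origin   : α 0 ≡ 0
    step     : ∀ j → α j < α (suc j)
    periodic : ∀ j → α (j ℕ.+ k) ≡ α j ℕ.+ n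

  mono-≤ : ∀ {i j} → i ≤ j → α i ≤ α j
  mono-≤ {i} {j} i≤j with d , ≡.refl ← ℕₚ.m≤n⇒∃[o]m+o≡n i≤j = go i d
    where
    go : ∀ i d → α i ≤ α (i ℕ.+ d)
    go i zero    = ℕₚ.≤-reflexive (≡.cong α (≡.sym (ℕₚ.+-identityʳ i)))
    go i (suc d) = ℕₚ.≤-trans (go i d) (ℕₚ.≤-trans (ℕₚ.<⇒≤ (step (i ℕ.+ d))) (ℕₚ.≤-reflexive (≡.cong α (≡.sym (ℕₚ.+-suc i d)))))

  mono-< : ∀ {i j} → i < j → α i < α j
  mono-< {i} i<j = ℕₚ.<-≤-trans (step i) (mono-≤ i<j)

  cancel-< : ∀ {i j} → α i < α j → i < j
  cancel-< αi<αj = ℕₚ.≰⇒> λ j≤i → ℕₚ.<⇒≱ αi<αj (mono-≤ j≤i)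

  private
    advance : ∀ m j → Dec (suc m ≡ α (suc j)) → ℕ
    advance m j (yes _) = suc j
    advance m j (no _)  = j

  -- The number of breakpoints in `(0, m]`, found by walking along the cover; strict growth of `α`
  -- allows at most one new breakpoint per step.
  index : ℕ → ℕ
  index zero    = 0
  index (suc m) = advance m (index m) (suc m ℕₚ.≟ α (suc (index m)))

  index-bounds : ∀ m → α (index m) ≤ m × m < α (suc (index m))
  index-bounds zero    = ℕₚ.≤-reflexive origin , ≡.subst (_< α 1) origin (step 0)
  index-bounds (suc m) = go (index-bounds m) (suc m ℕₚ.≟ α (suc (index m)))
    where
    go : ∀ {j} → α j ≤ m × m < α (suc j) → (d : Dec (suc m ≡ α (suc j))) →
         α (advance m j d) ≤ suc m × suc m < α (suc (advance m j d))
    go {j} _   (yes e) = ℕₚ.≤-reflexive (≡.sym e) , ≡.subst (_< α (suc (suc j))) (≡.sym e) (step (suc j))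
    go (l , u) (no ¬e) = ℕₚ.m≤n⇒m≤1+n l , ℕₚ.≤∧≢⇒< u ¬e

  index-lower : ∀ m → α (index m) ≤ m
  index-lower m = proj₁ (index-bounds m)

  index-upper : ∀ m → m < α (suc (index m))
  index-upper m = proj₂ (index-bounds m)

  index-mono : ∀ {m m′} → m ≤ m′ → index m ≤ index m′
  index-mono {m} {m′} m≤m′ = ℕₚ.≤-pred (cancel-< (ℕₚ.≤-<-trans (index-lower m) (ℕₚ.≤-<-trans m≤m′ (index-upper m′))))

  index-unique : ∀ {m} j → α j ≤ m → m < α (suc j) → index m ≡ j
  index-unique {m} j l u = ℕₚ.≤-antisym
    (ℕₚ.≤-pred (cancel-< (ℕₚ.≤-<-trans (index-lower m) u)))
    (ℕₚ.≤-pred (cancel-< (ℕₚ.≤-<-trans l (index-upper m))))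

  index-periodic : ∀ m → index (m ℕ.+ n) ≡ index m ℕ.+ k
  index-periodic m = index-unique (index m ℕ.+ k)
    (≡.subst (_≤ m ℕ.+ n) (≡.sym (periodic (index m))) (ℕₚ.+-monoˡ-≤ n (index-lower m)))
    (≡.subst (m ℕ.+ n <_) (≡.sym (periodic (suc (index m)))) (ℕₚ.+-monoˡ-< n (index-upper m)))

  index-suc : ∀ {m} → suc m ≡ α (suc (index m)) → index (suc m) ≡ suc (index m)
  index-suc {m} e = index-unique _ (ℕₚ.≤-reflexive (≡.sym e)) (≡.subst (_< α (suc (suc (index m)))) (≡.sym e) (step _))

  index-stay : ∀ {m} → suc m ≢ α (suc (index m)) → index (suc m) ≡ index m
  index-stay {m} ¬e = index-unique _ (ℕₚ.m≤n⇒m≤1+n (index-lower m)) (ℕₚ.≤∧≢⇒< (index-upper m) ¬e)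

  break-at-suc : ∀ {m} j → α j ≡ suc m → suc m ≡ α (suc (index m))
  break-at-suc {m} j e = ≡.trans (≡.sym e) (≡.cong α (ℕₚ.≤-antisym
    (ℕₚ.≤-pred (cancel-< (≡.subst (_< α (suc (suc (index m)))) (≡.sym e) (ℕₚ.≤-<-trans (index-upper m) (step _)))))
    (cancel-< (≡.subst (α (index m) <_) (≡.sym e) (s≤s (index-lower m))))))

module Interlacing {k n N : ℕ} {α β : ℕ → ℕ} (k≥2 : 2 ≤ k) (A : Breakpoints k n α) (B : Breakpoints k N β) where
  private
    module A = Breakpoints A
    module B = Breakpoints B

  σ ρ : ℕ → ℕ
  σ m = β (A.index m)
  ρ l = α (suc (B.index l))

  σ-periodic : ∀ m → σ (m ℕ.+ n) ≡ σ m ℕ.+ N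
  σ-periodic m = ≡.trans (≡.cong β (A.index-periodic m)) (B.periodic _)

  ρ-periodic : ∀ l → ρ (l ℕ.+ N) ≡ ρ l ℕ.+ n
  ρ-periodic l = ≡.trans (≡.cong (α ∘ suc) (B.index-periodic l)) (A.periodic _)

  σ-mono : ∀ {m m′} → m ≤ m′ → σ m ≤ σ m′
  σ-mono = B.mono-≤ ∘ A.index-mono

  ρ-mono : ∀ {l l′} → l ≤ l′ → ρ l ≤ ρ l′
  ρ-mono = A.mono-≤ ∘ s≤s ∘ B.index-mono

  -- Both inequalities say that `A.index m ≤ B.index l`.
  galois : ∀ {m l} → σ m ≤ l → m < ρ l
  galois {m} {l} σm≤l = ℕₚ.<-≤-trans (A.index-upper m)
    (A.mono-≤ (B.cancel-< (ℕₚ.≤-<-trans σm≤l (B.index-upper l))))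

  galois⁻¹ : ∀ {m l} → l < σ m → ρ l ≤ m
  galois⁻¹ {m} {l} l<σm = ℕₚ.≤-trans (A.mono-≤ (B.cancel-< (ℕₚ.≤-<-trans (B.index-lower l) l<σm))) (A.index-lower m)

  private
    -- Two or more breakpoints keep the arc between consecutive ones shorter than a turn. A full
    -- turn would have the same zero column as the trivial arc but a different ratio of windows.
    short : ∀ {n α} (C : Breakpoints k n α) j → α (suc j) < α j ℕ.+ n
    short {α = α} C j = ≡.subst (α (suc j) <_) (Breakpoints.periodic C j)
      (Breakpoints.mono-< C (≡.subst (_< j ℕ.+ k) (ℕₚ.+-comm j 1) (ℕₚ.+-monoʳ-< j k≥2)))

    index-step : ∀ {n α} (C : Breakpoints k n α) m → let open Breakpoints C in index (suc m) ≤ suc (index m)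
    index-step C m with suc m ℕₚ.≟ _
    ... | yes e = ℕₚ.≤-reflexive (Breakpoints.index-suc C e)
    ... | no ¬e = ℕₚ.≤-trans (ℕₚ.≤-reflexive (Breakpoints.index-stay C ¬e)) (ℕₚ.n≤1+n _)

  σ-short : ∀ m → σ (suc m) < σ m ℕ.+ N
  σ-short m = ℕₚ.≤-<-trans (B.mono-≤ (index-step A m)) (short B (A.index m))

  ρ-short : ∀ l → ρ (suc l) < ρ l ℕ.+ n
  ρ-short l = ℕₚ.≤-<-trans (A.mono-≤ (s≤s (index-step B l))) (short A (suc (B.index l)))

module Lift {k n : ℕ} .{{_ : NonZero k}} .{{_ : NonZero n}} (f : Fin k → Fin n)
            (f-increasing : ∀ {i j} → i Fin.< j → f i Fin.< f j) where

  lift : ℕ → ℕ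
  lift j = toℕ (f (Fin.fromℕ< (DivMod.m%n<n j k))) ℕ.+ j / k ℕ.* n

  lift-+* : ∀ (i : Fin k) t → lift (toℕ i ℕ.+ t ℕ.* k) ≡ toℕ (f i) ℕ.+ t ℕ.* n
  lift-+* i t = ≡.cong₂ (λ i t → toℕ (f i) ℕ.+ t ℕ.* n)
    (Finₚ.toℕ-injective (≡.trans (Finₚ.toℕ-fromℕ< _) (≡.trans (DivMod.[m+kn]%n≡m%n (toℕ i) t k) (DivMod.m<n⇒m%n≡m (Finₚ.toℕ<n i)))))
    (≡.trans (DivMod.+-distrib-/-∣ʳ (toℕ i) (n∣m*n t))
      (≡.cong₂ ℕ._+_ (DivMod.m<n⇒m/n≡0 (Finₚ.toℕ<n i)) (DivMod.m*n/n≡m t k)))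

  split : ∀ j → ∃₂ λ (i : Fin k) t → toℕ i ℕ.+ t ℕ.* k ≡ j
  split j = Fin.fromℕ< (DivMod.m%n<n j k) , j / k , ≡.trans
    (≡.cong (ℕ._+ j / k ℕ.* k) (Finₚ.toℕ-fromℕ< _)) (≡.sym (DivMod.m≡m%n+[m/n]*n j k))

  lift-periodic : ∀ j → lift (j ℕ.+ k) ≡ lift j ℕ.+ n
  lift-periodic j with i , t , ≡.refl ← split j = begin
    lift (toℕ i ℕ.+ t ℕ.* k ℕ.+ k)  ≡⟨ ≡.cong lift (again (toℕ i) t k) ⟩
    lift (toℕ i ℕ.+ suc t ℕ.* k)    ≡⟨ lift-+* i (suc t) ⟩
    toℕ (f i) ℕ.+ suc t ℕ.* n       ≡⟨ again (toℕ (f i)) t n ⟨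
    toℕ (f i) ℕ.+ t ℕ.* n ℕ.+ n     ≡⟨ ≡.cong (ℕ._+ n) (lift-+* i t) ⟨
    lift (toℕ i ℕ.+ t ℕ.* k) ℕ.+ n ∎
    where
    open ≡.≡-Reasoning
    again : ∀ x t k → x ℕ.+ t ℕ.* k ℕ.+ k ≡ x ℕ.+ suc t ℕ.* k
    again x t k = ≡.trans (ℕₚ.+-assoc x _ k) (≡.cong (x ℕ.+_) (ℕₚ.+-comm (t ℕ.* k) k))

  lift-step : ∀ j → lift j < lift (suc j)
  lift-step j with i , t , ≡.refl ← split j = go (suc (toℕ i) ℕₚ.<? k)
    where
    go : Dec (suc (toℕ i) < k) → lift (toℕ i ℕ.+ t ℕ.* k) < lift (suc (toℕ i ℕ.+ t ℕ.* k))
    go (yes i′<k) = ≡.subst₂ _<_ (≡.sym (lift-+* i t))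
      (≡.sym (≡.trans (≡.cong (λ x → lift (x ℕ.+ t ℕ.* k)) (≡.sym (Finₚ.toℕ-fromℕ< i′<k))) (lift-+* (Fin.fromℕ< i′<k) t)))
      (ℕₚ.+-monoˡ-< (t ℕ.* n) (f-increasing (≡.subst (toℕ i <_) (≡.sym (Finₚ.toℕ-fromℕ< i′<k)) ℕₚ.≤-refl)))
    go (no i′≮k) = ≡.subst₂ _<_ (≡.sym (lift-+* i t))
      (≡.sym (≡.trans (≡.cong lift (≡.trans (≡.cong (ℕ._+ t ℕ.* k) (≡.trans i′≡k (≡.sym (ℕₚ.+-identityʳ k)))) (wrap (t ℕ.* k)))) (lift-+* zero′ (suc t))))
      (ℕₚ.<-≤-trans (ℕₚ.+-monoˡ-< (t ℕ.* n) (Finₚ.toℕ<n (f i))) (ℕₚ.m≤n+m _ (toℕ (f zero′))))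
      where
      i′≡k : suc (toℕ i) ≡ k
      i′≡k = ℕₚ.≤-antisym (Finₚ.toℕ<n i) (ℕₚ.≮⇒≥ i′≮k)
      zero′ : Fin k
      zero′ = Fin.fromℕ< (ℕ.>-nonZero⁻¹ k)
      wrap : ∀ x → k ℕ.+ 0 ℕ.+ x ≡ toℕ zero′ ℕ.+ (k ℕ.+ x)
      wrap x = ≡.trans (≡.cong (ℕ._+ x) (ℕₚ.+-identityʳ k)) (≡.cong (ℕ._+ (k ℕ.+ x)) (≡.sym (Finₚ.toℕ-fromℕ< (ℕ.>-nonZero⁻¹ k))))

  lift-< : ∀ {i j} → i < j → lift i < lift j
  lift-< {i} {suc j} (s≤s i≤j) with ℕₚ.m≤n⇒m<n∨m≡n i≤j
  ... | inj₁ i<j    = ℕₚ.<-trans (lift-< i<j) (lift-step j)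
  ... | inj₂ ≡.refl = lift-step j

  module _ (j₀ : Fin k) where

    -- The lift rebased at the breakpoint `j₀`, so that the origin of the cover is itself a
    -- breakpoint.
    gap : ℕ → ℕ
    gap j = lift (toℕ j₀ ℕ.+ j) ℕ.∸ toℕ (f j₀)

    private
      lift-j₀ : lift (toℕ j₀) ≡ toℕ (f j₀)
      lift-j₀ = ≡.trans (≡.cong lift (≡.sym (ℕₚ.+-identityʳ (toℕ j₀)))) (≡.trans (lift-+* j₀ 0) (ℕₚ.+-identityʳ _))

      base≤ : ∀ j → toℕ (f j₀) ≤ lift (toℕ j₀ ℕ.+ j)
      base≤ zero    = ℕₚ.≤-reflexive (≡.trans (≡.sym lift-j₀) (≡.cong lift (≡.sym (ℕₚ.+-identityʳ _))))
      base≤ (suc j) = ℕₚ.≤-trans (ℕₚ.≤-reflexive (≡.sym lift-j₀)) (ℕₚ.<⇒≤ (lift-< (ℕₚ.m<m+n (toℕ j₀) (s≤s z≤n))))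

      base+gap : ∀ j → toℕ (f j₀) ℕ.+ gap j ≡ lift (toℕ j₀ ℕ.+ j)
      base+gap j = ℕₚ.m+[n∸m]≡n (base≤ j)

    gap-breakpoints : Breakpoints k n gap
    gap-breakpoints = record
      { origin   = ℕₚ.m≤n⇒m∸n≡0 (ℕₚ.≤-reflexive (≡.trans (≡.cong lift (ℕₚ.+-identityʳ _)) lift-j₀))
      ; step     = λ j → ℕₚ.+-cancelˡ-< (toℕ (f j₀)) _ _ (≡.subst₂ _<_ (≡.sym (base+gap j)) (≡.sym (base+gap (suc j)))
                     (lift-< (ℕₚ.+-monoʳ-< (toℕ j₀) (ℕₚ.n<1+n j))))
      ; periodic = λ j → ℕₚ.+-cancelˡ-≡ (toℕ (f j₀)) _ _ (≡.trans (base+gap (j ℕ.+ k))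
                     (≡.trans (≡.cong lift (≡.sym (ℕₚ.+-assoc (toℕ j₀) j k)))
                     (≡.trans (lift-periodic _) (≡.trans (≡.cong (ℕ._+ n) (≡.sym (base+gap j))) (ℕₚ.+-assoc (toℕ (f j₀)) _ n)))))
      }

    rot-gap : ∀ j → rot (f j₀) (gap j) ≡ f (rot j₀ j)
    rot-gap j with i , t , i+tk≡ ← split (toℕ j₀ ℕ.+ j) = Finₚ.toℕ-injective (begin
      toℕ (rot (f j₀) (gap j))        ≡⟨ toℕ-rot (f j₀) (gap j) ⟩
      (toℕ (f j₀) ℕ.+ gap j) % n      ≡⟨ ≡.cong (_% n) (≡.trans (base+gap j) (≡.trans (≡.cong lift (≡.sym i+tk≡)) (lift-+* i t))) ⟩
      (toℕ (f i) ℕ.+ t ℕ.* n) % n     ≡⟨ DivMod.[m+kn]%n≡m%n (toℕ (f i)) t n ⟩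
      toℕ (f i) % n                   ≡⟨ DivMod.m<n⇒m%n≡m (Finₚ.toℕ<n (f i)) ⟩
      toℕ (f i)                       ≡⟨ ≡.cong (toℕ ∘ f) (Finₚ.toℕ-injective (≡.sym (≡.trans (toℕ-rot j₀ j)
                                           (≡.trans (≡.cong (_% k) (≡.sym i+tk≡)) (≡.trans (DivMod.[m+kn]%n≡m%n (toℕ i) t k)
                                             (DivMod.m<n⇒m%n≡m (Finₚ.toℕ<n i))))))) ⟩
      toℕ (f (rot j₀ j)) ∎)
      where open ≡.≡-Reasoning

    gap-surjective : ∀ m i → rot (f j₀) m ≡ f i → ∃ λ j → gap j ≡ m
    gap-surjective m i eq = J ℕ.∸ toℕ j₀ , ℕₚ.+-cancelˡ-≡ (toℕ (f j₀)) _ _ (≡.trans (base+gap _)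
      (≡.trans (≡.cong lift (ℕₚ.m+[n∸m]≡n j₀≤J)) lift-J))
      where
      x = toℕ (f j₀) ℕ.+ m
      t = x / n
      -- `x` lies in turn `t` of the circle, so it is the lift of `f i` in that turn.
      J = toℕ i ℕ.+ t ℕ.* k
      lift-J : lift J ≡ x
      lift-J = ≡.trans (lift-+* i t) (≡.trans (≡.cong (ℕ._+ t ℕ.* n) (≡.trans (≡.cong toℕ (≡.sym eq)) (toℕ-rot (f j₀) m)))
        (≡.sym (DivMod.m≡m%n+[m/n]*n x n)))
      j₀≤J : toℕ j₀ ≤ J
      j₀≤J = ℕₚ.≮⇒≥ λ J<j₀ → ℕₚ.<⇒≱ (≡.subst₂ _<_ lift-J lift-j₀ (lift-< J<j₀)) (ℕₚ.m≤m+n (toℕ (f j₀)) m)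

-- Neighbouring circles as linked pairs

module Links (Web : SpiderWeb) where
  open SpiderWeb Web
  open Columns Web

  -- The vertex between the heights `i` and `suc i` of `C` cuts out on `D` the arc from `σ i` to
  -- `σ (suc i)`, and `ρ` does the same in the other direction. Which circle is the outer one is not
  -- recorded, so one argument serves both orders.
  record Linked (C D : Circle) : Set where
    field
      distinct   : C ≢ D
      c₀         : Fin (n C)
      d₀         : Fin (n D)
      σ ρ        : ℕ → ℕ
      σ-periodic : ∀ i → σ (i ℕ.+ n C) ≡ σ i ℕ.+ n D
      ρ-periodic : ∀ l → ρ (l ℕ.+ n D) ≡ ρ l ℕ.+ n C
      σ-mono     : ∀ {i j} → i ≤ j → σ i ≤ σ j
      ρ-mono     : ∀ {l t} → l ≤ t → ρ l ≤ ρ t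
      σ-short    : ∀ i → σ (suc i) < σ i ℕ.+ n D
      ρ-short    : ∀ l → ρ (suc l) < ρ l ℕ.+ n C
      galois     : ∀ {i l} → σ i ≤ l → i < ρ l
      galois⁻¹   : ∀ {i l} → l < σ i → ρ l ≤ i
      σ-arc      : ∀ i → ColumnArc D (C , rot c₀ (suc i)) (rot d₀ (σ i)) (rot d₀ (σ (suc i)))
      ρ-arc      : ∀ l → ColumnArc C (D , rot d₀ (suc l)) (rot c₀ (ρ l)) (rot c₀ (ρ (suc l)))

  -- Contraposition turns the two Galois conditions for `σ` and `ρ` into those for the exchanged
  -- pair.
  flip : ∀ {C D} → Linked C D → Linked D C
  flip L = record
    { distinct = distinct ∘ ≡.sym ; c₀ = d₀ ; d₀ = c₀ ; σ = ρ ; ρ = σ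
    ; σ-periodic = ρ-periodic ; ρ-periodic = σ-periodic ; σ-mono = ρ-mono ; ρ-mono = σ-mono
    ; σ-short = ρ-short ; ρ-short = σ-short
    ; galois   = λ {l} {i} ρl≤i → ℕₚ.≰⇒> λ σi≤l → ℕₚ.<⇒≱ (galois σi≤l) ρl≤i
    ; galois⁻¹ = λ {l} {i} i<ρl → ℕₚ.≮⇒≥ λ l<σi → ℕₚ.<⇒≱ i<ρl (galois⁻¹ l<σi)
    ; σ-arc = ρ-arc ; ρ-arc = σ-arc }
    where open Linked L

  module _ (a : Fin M) where
    private
      j₀ : Fin (k a)
      j₀ = Fin.fromℕ< (ℕ.>-nonZero⁻¹ (k a))
      -- The shift `r a` alone would make `β j` a lift of `Q` at `j` (counted from `j₀`); the extra
      -- one makes it a lift of `Q` at `j + 1`. This is where the arc of outer breakpoint `j` ends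
      -- and that of `j + 1` begins, hence the value of `σ` on the heights between them.
      q₀ : Fin (k a)
      q₀ = rot j₀ (suc (toℕ (r a)))
      module Outer = Lift (p a) (p-increasing a)
      module Inner = Lift (q a) (q-increasing a)
      α = Outer.gap j₀
      β = Inner.gap q₀
      module A = Breakpoints (Outer.gap-breakpoints j₀)
      module B = Breakpoints (Inner.gap-breakpoints q₀)
      open Interlacing (k≥2 a) (Outer.gap-breakpoints j₀) (Inner.gap-breakpoints q₀)

      rot-α : ∀ j → rot (p a j₀) (α j) ≡ p a (rot j₀ j)
      rot-α = Outer.rot-gap j₀

      q₀-rot : ∀ j → rot q₀ j ≡ rot (rot j₀ (suc j)) (toℕ (r a))
      q₀-rot j = ≡.trans (rot-rot j₀ (suc (toℕ (r a))) j) (≡.trans (≡.cong (rot j₀ ∘ suc) (ℕₚ.+-comm (toℕ (r a)) j))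
        (≡.sym (rot-rot j₀ (suc j) (toℕ (r a)))))

      rot-β : ∀ j → rot (q a q₀) (β j) ≡ Q a (rot j₀ (suc j))
      rot-β j = ≡.trans (Inner.rot-gap q₀ j) (≡.cong (q a) (q₀-rot j))

      rot-suc : ∀ j → rot (rot j₀ j) 1 ≡ rot j₀ (suc j)
      rot-suc j = ≡.trans (rot-rot j₀ j 1) (≡.cong (rot j₀) (ℕₚ.+-comm j 1))

      -- At a breakpoint `σ` advances by one inner breakpoint, as the arc there does; at any other
      -- vertex `σ` stays and the arc is trivial.
      σ-arc : ∀ m → ColumnArc (Fin.suc a) (inject₁ a , rot (p a j₀) (suc m)) (rot (q a q₀) (σ m)) (rot (q a q₀) (σ (suc m)))
      σ-arc m = by-cases (suc m ℕₚ.≟ α (suc (A.index m)))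
       where
       by-cases : Dec (suc m ≡ α (suc (A.index m))) →
         ColumnArc (Fin.suc a) (inject₁ a , rot (p a j₀) (suc m)) (rot (q a q₀) (σ m)) (rot (q a q₀) (σ (suc m)))
       by-cases (yes e) = ≡.subst₂ (λ v → ColumnArc (Fin.suc a) v (rot (q a q₀) (σ m)))
        (≡.cong (inject₁ a ,_) (≡.sym (≡.trans (≡.cong (rot (p a j₀)) e) (rot-α _))))
        (≡.sym (≡.trans (≡.cong (rot (q a q₀) ∘ β) (A.index-suc e)) (rot-β _)))
        (≡.subst₂ (ColumnArc (Fin.suc a) (inject₁ a , p a (rot j₀ (suc (A.index m)))))
          (≡.sym (rot-β (A.index m))) (≡.cong (Q a) (rot-suc _)) (inner-arc a (rot j₀ (suc (A.index m)))))
       by-cases (no ¬e) = ≡.subst (λ i → ColumnArc (Fin.suc a) (inject₁ a , rot (p a j₀) (suc m)) (rot (q a q₀) (σ m)) (rot (q a q₀) (β i)))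
        (≡.sym (A.index-stay ¬e))
        (no-inner-arc a _ (λ j e → let j′ , gap≡ = Outer.gap-surjective j₀ (suc m) j (≡.sym e) in ¬e (A.break-at-suc j′ gap≡)) (rot (q a q₀) (σ m)))

      ρ-arc : ∀ l → ColumnArc (inject₁ a) (Fin.suc a , rot (q a q₀) (suc l)) (rot (p a j₀) (ρ l)) (rot (p a j₀) (ρ (suc l)))
      ρ-arc l = by-cases (suc l ℕₚ.≟ β (suc (B.index l)))
       where
       j = rot j₀ (2 ℕ.+ B.index l)
       by-cases : Dec (suc l ≡ β (suc (B.index l))) →
         ColumnArc (inject₁ a) (Fin.suc a , rot (q a q₀) (suc l)) (rot (p a j₀) (ρ l)) (rot (p a j₀) (ρ (suc l)))
       by-cases (yes e) = ≡.subst₂ (λ v → ColumnArc (inject₁ a) v (rot (p a j₀) (ρ l)))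
        (≡.cong (Fin.suc a ,_) (≡.sym (≡.trans (≡.cong (rot (q a q₀)) e) (rot-β _))))
        (≡.sym (≡.trans (≡.cong (rot (p a j₀) ∘ α ∘ suc) (B.index-suc e)) (rot-α _)))
        (≡.subst (λ s → ColumnArc (inject₁ a) (Fin.suc a , Q a j) s (p a j))
          (≡.sym (≡.trans (rot-α _) (≡.cong (p a) (≡.sym (≡.trans (≡.cong prev (≡.sym (rot-suc _))) (prev-rot _))))))
          (outer-arc a j))
       by-cases (no ¬e) = ≡.subst (λ i → ColumnArc (inject₁ a) (Fin.suc a , rot (q a q₀) (suc l)) (rot (p a j₀) (ρ l)) (rot (p a j₀) (α (suc i))))
        (≡.sym (B.index-stay ¬e))
        (no-outer-arc a _ (λ j e → let j′ , gap≡ = Inner.gap-surjective q₀ (suc l) _ (≡.sym e) in ¬e (B.break-at-suc j′ gap≡)) (rot (p a j₀) (ρ l)))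

    annulus-linked : Linked (inject₁ a) (Fin.suc a)
    annulus-linked = record
      { distinct = inject₁≢suc ; c₀ = p a j₀ ; d₀ = q a q₀ ; σ = σ ; ρ = ρ
      ; σ-periodic = σ-periodic ; ρ-periodic = ρ-periodic ; σ-mono = σ-mono ; ρ-mono = ρ-mono
      ; σ-short = σ-short ; ρ-short = ρ-short ; galois = galois ; galois⁻¹ = galois⁻¹
      ; σ-arc = σ-arc ; ρ-arc = ρ-arc }

-- The braid relation for linked circles

module BraidRelation {cℓ ℓ : Level} (P : Semifield cℓ ℓ) (Web : SpiderWeb) where
  open SpiderWeb Web using (n; Circle; Vertex; _≟V_; B; label)
  open Columns Web
  open Links Web
  open CircleReflection P Web hiding (W)
  open Solver using (solve; _:*_; _:=_)

  -- A vertex v whose variable τ on the circle c multiplies by W e / W s, for windows W on the cover of c based at c₀.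
  data Move (c : Circle) (c₀ : Fin (n c)) : Vertex → ℕ → ℕ → Set where
    own  : ∀ i → Move c c₀ (c , rot c₀ (suc i)) (2 ℕ.+ i) i
    away : ∀ {v} s d → proj₁ v ≢ c → d < n c → ColumnArc c v (rot c₀ s) (rot c₀ (s ℕ.+ d)) → Move c c₀ v s (s ℕ.+ d)

  move : ∀ c c₀ v → ∃₂ (Move c c₀ v)
  move c c₀ (c′ , i) with c′ Finₚ.≟ c
  ... | no c′≢c with s , e , A ← column-arc c (c′ , i)
                with x , _ , ≡.refl ← rot-surjective c₀ s
                with d , d<n , ≡.refl ← rot-surjective (rot c₀ x) e
                = x , x ℕ.+ d , away x d c′≢c d<n (≡.subst (ColumnArc c (c′ , i) (rot c₀ x)) (rot-rot c₀ x d) A)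
  move c c₀ (c′ , i) | yes ≡.refl with x , _ , ≡.refl ← rot-surjective (rot c₀ 1) i =
    2 ℕ.+ x , x , ≡.subst (λ f → Move c c₀ (c , f) (2 ℕ.+ x) x) (≡.sym (rot-rot c₀ 1 x)) (own x)

  between-move : ∀ {c c₀ v x y} → proj₁ v ≢ c → x ≤ y → y < x ℕ.+ n c → ColumnArc c v (rot c₀ x) (rot c₀ y) → Move c c₀ v x y
  between-move {c} {x = x} v∉c x≤y y<x+n A with d , ≡.refl ← ℕₚ.m≤n⇒∃[o]m+o≡n x≤y =
    away x d v∉c (ℕₚ.+-cancelˡ-< x d (n c) y<x+n) A

  -- A seed on the original quiver with heights on the circle to be treated next. Since `τ` fixes
  -- the quiver, stages can be chained.
  record Stage (c : Circle) (S : YSeed) : Set (cℓ ⊔ ℓ) where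
    field
      base first : Fin (n c)
      fixed      : ∀ i j → matrix S i j ≡ B i j
      X          : ℕ → Carrier
      slope      : ∀ i → vars S (c , rot base (suc i)) ⊗ X i ≈ X (suc i)

    W : ℕ → Carrier
    W = window (n c) X

    next : YSeed
    next = run (τ (n c) (label c first)) S

    next-fixed : ∀ i j → matrix next i j ≡ B i j
    next-fixed = matrix-fixed c base first S fixed X slope

    period : ∀ i → X (i ℕ.+ n c) ≈ z c base first S fixed X slope ⊗ X i
    period = X-period c base first S fixed X slope

    scaled : ∀ {v s e} → Move c base v s e → vars next v ⊗ W s ≈ vars S v ⊗ W e
    scaled (own i)           = vars-own c base first S fixed X slope i
    scaled (away s d v∉c d<n A) = vars-away c base first S fixed X slope v∉c s d d<n A

  heights : (c : Circle) → Fin (n c) → (Vertex → Carrier) → ℕ → Carrier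
  heights c c₀ y zero    = 1#
  heights c c₀ y (suc i) = y (c , rot c₀ (suc i)) ⊗ heights c c₀ y i

  initial : ∀ c → Fin (n c) → Fin (n c) → (y₀ : Vertex → Carrier) → Stage c (yseed B y₀)
  initial c c₀ s y₀ = record
    { base = c₀ ; first = s ; fixed = λ _ _ → ≡.refl ; X = heights c c₀ y₀ ; slope = λ _ → ≈-refl }

  module _ {C D : Circle} (L : Linked C D) (y₀ : Vertex → Carrier) where
    open Linked L

    X Y W V : ℕ → Carrier
    X = heights C c₀ y₀
    Y = heights D d₀ y₀
    W = window (n C) X
    V = window (n D) Y

    -- The windows of each circle after `τ` on the other one alone, which multiplies the heights by
    -- `V (σ i)` and `W (ρ l)` respectively.
    windowᶜ windowᵈ : ℕ → Carrier
    windowᶜ = window (n C) (λ i → X i ⊗ V (σ i))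
    windowᵈ = window (n D) (λ l → Y l ⊗ W (ρ l))

    module Sequence (sC : Fin (n C)) (sD : Fin (n D)) where

      stage₁ : Stage C (yseed B y₀)
      stage₁ = initial C c₀ sC y₀
      module S₁ = Stage stage₁

      -- The first `τ` multiplies the variable between the heights `l` and `suc l` of `D` by
      -- `W (ρ (suc l)) / W (ρ l)`, so the height `Y l` picks up `W (ρ l)`.
      stage₂ : Stage D S₁.next
      stage₂ = record
        { base = d₀ ; first = sD ; fixed = S₁.next-fixed ; X = λ l → Y l ⊗ W (ρ l)
        ; slope = λ l → begin
            vars S₁.next (γᵈ l) ⊗ (Y l ⊗ W (ρ l))  ≈⟨ drop-just (solve 3 (λ y a b → y :* (a :* b) := (y :* b) :* a) K.refl
                                                     (just (vars S₁.next (γᵈ l))) (just (Y l)) (just (W (ρ l)))) ⟩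
            vars S₁.next (γᵈ l) ⊗ W (ρ l) ⊗ Y l    ≈⟨ ⊗-cong (S₁.scaled (between-move (distinct ∘ ≡.sym) (ρ-mono (ℕₚ.n≤1+n l)) (ρ-short l) (ρ-arc l))) ≈-refl ⟩
            y₀ (γᵈ l) ⊗ W (ρ (suc l)) ⊗ Y l        ≈⟨ drop-just (solve 3 (λ y a b → y :* b :* a := (y :* a) :* b) K.refl
                                                     (just (y₀ (γᵈ l))) (just (Y l)) (just (W (ρ (suc l))))) ⟩
            Y (suc l) ⊗ W (ρ (suc l)) ∎
        }
        where
        γᵈ : ℕ → Vertex
        γᵈ l = D , rot d₀ (suc l)
      module S₂ = Stage stage₂

      σ-move : ∀ i → Move D d₀ (C , rot c₀ (suc i)) (σ i) (σ (suc i))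
      σ-move i = between-move distinct (σ-mono (ℕₚ.n≤1+n i)) (σ-short i) (σ-arc i)

      -- The first `τ` multiplies the variable at `suc i` by `W i / W (2 + i)`, a ratio of
      -- consecutive values of `1 / (W i W (suc i))`; the second contributes consecutive values of
      -- `windowᵈ (σ i)`.
      U : ℕ → Carrier
      U i = X i ⊗ windowᵈ (σ i) ⊗ (W i ⁻¹ ⊗ W (suc i) ⁻¹)

      stage₃ : Stage C S₂.next
      stage₃ = record
        { base = c₀ ; first = sC ; fixed = S₂.next-fixed ; X = U
        ; slope = λ i → let
              y₁ = vars S₁.next (γ i); y₂ = vars S₂.next (γ i)
              K = windowᵈ (σ i); K′ = windowᵈ (σ (suc i)); w = W i; w′ = W (suc i); w″ = W (2 ℕ.+ i) in begin
            y₂ ⊗ (X i ⊗ K ⊗ (w ⁻¹ ⊗ w′ ⁻¹))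
              ≈⟨ drop-just (solve 4 (λ y x k v → y :* (x :* k :* v) := (y :* k) :* x :* v) K.refl
                   (just y₂) (just (X i)) (just K) (just (w ⁻¹ ⊗ w′ ⁻¹))) ⟩
            y₂ ⊗ K ⊗ X i ⊗ (w ⁻¹ ⊗ w′ ⁻¹)
              ≈⟨ ⊗-cong (⊗-cong (S₂.scaled (σ-move i)) ≈-refl) ≈-refl ⟩
            y₁ ⊗ K′ ⊗ X i ⊗ (w ⁻¹ ⊗ w′ ⁻¹)
              ≈⟨ ⊗-cong (⊗-cong (⊗-cong (y₁-own i) ≈-refl) ≈-refl) ≈-refl ⟩
            y₀ (γ i) ⊗ w ⊗ w″ ⁻¹ ⊗ K′ ⊗ X i ⊗ (w ⁻¹ ⊗ w′ ⁻¹)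
              ≈⟨ drop-just (solve 7 (λ y w v″ k x v v′ → y :* w :* v″ :* k :* x :* (v :* v′) := (v :* w) :* (y :* x :* k :* (v′ :* v″))) K.refl
                   (just (y₀ (γ i))) (just w) (just (w″ ⁻¹)) (just K′) (just (X i)) (just (w ⁻¹)) (just (w′ ⁻¹))) ⟩
            w ⁻¹ ⊗ w ⊗ (y₀ (γ i) ⊗ X i ⊗ K′ ⊗ (w′ ⁻¹ ⊗ w″ ⁻¹))
              ≈⟨ ≈-trans (⊗-cong (⊗-inverseˡ w) ≈-refl) (⊗-identityˡ _) ⟩
            y₀ (γ i) ⊗ X i ⊗ K′ ⊗ (w′ ⁻¹ ⊗ w″ ⁻¹) ∎
        }
        where
        γ : ℕ → Vertex
        γ i = C , rot c₀ (suc i)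
        y₁-own : ∀ i → vars S₁.next (γ i) ≈ y₀ (γ i) ⊗ W i ⊗ W (2 ℕ.+ i) ⁻¹
        y₁-own i = ⊗-cancelʳ (W (2 ℕ.+ i)) (≈-trans (S₁.scaled (own i))
          (≈-sym (≈-trans (⊗-assoc _ _ _) (≈-trans (⊗-cong ≈-refl (⊗-inverseˡ _)) (⊗-identityʳ _)))))
      module S₃ = Stage stage₃

      braided : ∀ i → W i ⊗ S₃.W i ≈ windowᶜ i
      braided i = drop-just (K.trans
        (K.*-cong (window-sum (n C) X i) (K.trans (window-sum (n C) U i) (sum-cong i (n C) λ m _ _ →
          K.*-congʳ {x = just (W m ⁻¹ ⊗ W (suc m) ⁻¹)} (K.*-congˡ {x = just (X m)}
            (K.trans (window-sum (n D) _ (σ m)) (sum-cong (σ m) (n D) λ l _ _ → K.*-congˡ {x = just (Y l)} (window-sum (n C) X (ρ l))))))))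
        (K.trans
          (Braid.braid (n C) (n D) (just ∘ X) (just ∘ Y) _ _ σ ρ
            (λ i → just (S₁.period i)) (λ l → just (Stage.period (initial D d₀ sD y₀) l))
            σ-periodic ρ-periodic σ-mono galois galois⁻¹
            (λ i → just (W i ⁻¹)) (λ i → K.trans (K.*-congˡ {x = just (W i ⁻¹)} (K.sym (window-sum (n C) X i))) (just (⊗-inverseˡ (W i)))) i)
          (K.sym (K.trans (window-sum (n C) _ i) (sum-cong i (n C) λ m _ _ → K.*-congˡ {x = just (X m)} (window-sum (n D) Y (σ m)))))))

      -- `braided` fuses the factors of the two moves on `C` into one ratio of `windowᶜ`, which
      -- makes the total factor symmetric in the two circles. `v` is arbitrary, on either circle or
      -- elsewhere.
      total : ∀ {v s e s′ e′} → Move C c₀ v s e → Move D d₀ v s′ e′ →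
              vars S₃.next v ⊗ (windowᶜ s ⊗ windowᵈ s′) ≈ y₀ v ⊗ (windowᶜ e ⊗ windowᵈ e′)
      total {v} {s} {e} {s′} {e′} mC mD = begin
        vars S₃.next v ⊗ (windowᶜ s ⊗ windowᵈ s′)
          ≈⟨ ⊗-cong ≈-refl (⊗-cong (braided s) ≈-refl) ⟨
        vars S₃.next v ⊗ (W s ⊗ S₃.W s ⊗ windowᵈ s′)
          ≈⟨ drop-just (solve 4 (λ y w u k → y :* (w :* u :* k) := (y :* u) :* w :* k) K.refl
               (just (vars S₃.next v)) (just (W s)) (just (S₃.W s)) (just (windowᵈ s′))) ⟩
        vars S₃.next v ⊗ S₃.W s ⊗ W s ⊗ windowᵈ s′
          ≈⟨ ⊗-cong (⊗-cong (S₃.scaled mC) ≈-refl) ≈-refl ⟩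
        vars S₂.next v ⊗ S₃.W e ⊗ W s ⊗ windowᵈ s′
          ≈⟨ drop-just (solve 4 (λ y u w k → y :* u :* w :* k := (y :* k) :* u :* w) K.refl
               (just (vars S₂.next v)) (just (S₃.W e)) (just (W s)) (just (windowᵈ s′))) ⟩
        vars S₂.next v ⊗ windowᵈ s′ ⊗ S₃.W e ⊗ W s
          ≈⟨ ⊗-cong (⊗-cong (S₂.scaled mD) ≈-refl) ≈-refl ⟩
        vars S₁.next v ⊗ windowᵈ e′ ⊗ S₃.W e ⊗ W s
          ≈⟨ drop-just (solve 4 (λ y k u w → y :* k :* u :* w := (y :* w) :* u :* k) K.refl
               (just (vars S₁.next v)) (just (windowᵈ e′)) (just (S₃.W e)) (just (W s))) ⟩
        vars S₁.next v ⊗ W s ⊗ S₃.W e ⊗ windowᵈ e′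
          ≈⟨ ⊗-cong (⊗-cong (S₁.scaled mC) ≈-refl) ≈-refl ⟩
        y₀ v ⊗ W e ⊗ S₃.W e ⊗ windowᵈ e′
          ≈⟨ drop-just (solve 4 (λ y w u k → y :* w :* u :* k := y :* (w :* u :* k)) K.refl
               (just (y₀ v)) (just (W e)) (just (S₃.W e)) (just (windowᵈ e′))) ⟩
        y₀ v ⊗ (W e ⊗ S₃.W e ⊗ windowᵈ e′)
          ≈⟨ ⊗-cong ≈-refl (⊗-cong (braided e) ≈-refl) ⟩
        y₀ v ⊗ (windowᶜ e ⊗ windowᵈ e′) ∎

      run-sequence : run ((τ[ P ] Web at C) sC ++ (τ[ P ] Web at D) sD ++ (τ[ P ] Web at C) sC) (yseed B y₀) ≡ S₃.next
      run-sequence = ≡.trans (run-++ ((τ[ P ] Web at C) sC) _ _) (run-++ ((τ[ P ] Web at D) sD) _ _)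

  linked-braid : ∀ {C D} → Linked C D → ∀ sC sD y₀ v →
    yAfter P Web y₀ ((τ[ P ] Web at C) sC ++ (τ[ P ] Web at D) sD ++ (τ[ P ] Web at C) sC) v ≈
    yAfter P Web y₀ ((τ[ P ] Web at D) sD ++ (τ[ P ] Web at C) sC ++ (τ[ P ] Web at D) sD) v
  linked-braid {C} {D} L sC sD y₀ v
    with s , e , mC ← move C (Linked.c₀ L) v
    with s′ , e′ , mD ← move D (Linked.d₀ L) v =
    ≈-trans (≈-reflexive (≡.cong (λ S → vars S v) CDC.run-sequence))
    (≈-trans (⊗-cancelʳ (Kᶜ s ⊗ Kᵈ s′) (begin
      vars CDC.S₃.next v ⊗ (Kᶜ s ⊗ Kᵈ s′) ≈⟨ CDC.total mC mD ⟩
      y₀ v ⊗ (Kᶜ e ⊗ Kᵈ e′)               ≈⟨ ⊗-cong ≈-refl (⊗-comm _ _) ⟩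
      y₀ v ⊗ (Kᵈ e′ ⊗ Kᶜ e)               ≈⟨ DCD.total mD mC ⟨
      vars DCD.S₃.next v ⊗ (Kᵈ s′ ⊗ Kᶜ s) ≈⟨ ⊗-cong ≈-refl (⊗-comm _ _) ⟩
      vars DCD.S₃.next v ⊗ (Kᶜ s ⊗ Kᵈ s′) ∎))
    (≈-reflexive (≡.cong (λ S → vars S v) (≡.sym DCD.run-sequence))))
    where
    module CDC = Sequence L y₀ sC sD
    -- `flip` exchanges `windowᶜ` and `windowᵈ` definitionally, so both totals concern the same `Kᶜ`
    -- and `Kᵈ`.
    module DCD = Sequence (flip L) y₀ sD sC
    Kᶜ = windowᶜ L y₀
    Kᵈ = windowᵈ L y₀

adjacent-linked : ∀ Web {C D} → toℕ D ≡ suc (toℕ C) → Links.Linked Web C D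
adjacent-linked Web {C} {Fin.suc a} eq = ≡.subst (λ C → Links.Linked Web C (Fin.suc a))
  (Finₚ.toℕ-injective (≡.trans (Finₚ.toℕ-inject₁ a) (ℕₚ.suc-injective eq))) (Links.annulus-linked Web a)

theorem6p10 : {cl ℓl : Level} (P : Semifield cl ℓl) (W : SpiderWeb)
    (C D : SpiderWeb.Circle W) → Adjacent C D →
    (sC : Fin (SpiderWeb.n W C)) (sD : Fin (SpiderWeb.n W D)) →
    (y₀ : SpiderWeb.Vertex W → Semifield.Carrier P) →
    (v : SpiderWeb.Vertex W) →
    Semifield._≈_ P
    (yAfter P W y₀ ((τ[ P ] W at C) sC ++ (τ[ P ] W at D) sD ++ (τ[ P ] W at C) sC) v)
    (yAfter P W y₀ ((τ[ P ] W at D) sD ++ (τ[ P ] W at C) sC ++ (τ[ P ] W at D) sD) v)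
theorem6p10 P W C D (inj₁ D≡1+C) sC sD y₀ v = BraidRelation.linked-braid P W (adjacent-linked W D≡1+C) sC sD y₀ v
theorem6p10 P W C D (inj₂ C≡1+D) sC sD y₀ v =
  BraidRelation.linked-braid P W (Links.flip W (adjacent-linked W C≡1+D)) sC sD y₀ v
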